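{- Let $0<\delta<1/8$, $0<\rho<1$, and let $n\geq1$ be sufficiently large. Let $V_1,V_2,V_3$ be disjoint sets of size $n$, let $G$ be a tripartite graph with parts $V_1,V_2,V_3$, and let $K_3(G)$ denote the set of $(x,y,z)\in V_1\times V_2\times V_3$ with $xy,xz,yz$ all edges of $G$. Let $H=(V_1\cup V_2\cup V_3,F)$ be the tripartite $3$-graph with $F=\{xyz:(x,y,z)\in K_3(G)\}$, and suppose $|K_3(G)|=\rho|V_1||V_2||V_3|$. Let $\mathcal{V}_0$ be a partition of $V(H)$ refining $\{V_1,V_2,V_3\}$ with at most $3^{200}$ parts. Then there is a decomposition $\mathcal{P}=(\mathcal{P}_1,\mathcal{P}_2)$ of $V(H)$ with $\mathcal{P}_1$ refining $\mathcal{V}_0$ which is $\langle\delta\rangle$-regular for $H$ and satisfies $|\mathcal{P}_1|\leq 3^{200}\,T_3(\delta^{ -1000}\rho^{ -1000})$.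
   Context: For $m>0$, $T_m(1)=m$ and $T_m(x+1)=T_m(x)2^{T_m(x)}$; for real $y>0$, $T_3(y)$ means $T_3(\lceil y\rceil)$. A bigraph is $B=(U,W;E)$ with $E\subseteq U\times W$; $d_B(U',W')=|E\cap(U'\times W')|/(|U'||W'|)$. $B$ is $\langle\delta\rangle$-regular if $d_B(U',W')\geq d_B(U,W)/2$ for all $U'\subseteq U$, $W'\subseteq W$ with $|U'|\geq\delta|U|$, $|W'|\geq\delta|W|$. For a graph $\Gamma=(V,E)$, a partition $\mathcal{Q}$ of $V$ is $\langle\delta\rangle$-regular for $\Gamma$ if there is a graph $\Gamma'=(V,E')$ with $|E\,\triangle\,E'|\leq\delta|E|$ such that for all distinct $A,B\in\mathcal{Q}$ the bigraph $(A,B;\{(a,b)\in A\times B: ab\in E'\})$ is $\langle\delta\rangle$-regular. A decomposition $\mathcal{P}$ of a set $V$ consists of a partition $\mathcal{P}_1$ of $V$ and, for each $X,Y\in\mathcal{P}_1$, a partition of $X\times Y$; $\mathcal{P}_2$ is the set of all parts of these partitions. $\mathcal{P}$ is $\langle\delta\rangle$-good if for every $P\in\mathcal{P}_2$ with $P\subseteq X\times Y$ ($X,Y\in\mathcal{P}_1$) the bigraph $(X,Y;P)$ is $\langle\delta\rangle$-regular. For the tripartite $3$-graph $H$ and $\{i_1,i_2,i_3\}=\{1,2,3\}$ with $i_2<i_3$, let $G^{i_1}_H$ be the bipartite graph with parts $V_{i_1}$ and $V_{i_2}\times V_{i_3}$ in which $u\in V_{i_1}$ is adjacent to $(v,w)$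 iff $\{u,v,w\}\in F$. If $\mathcal{P}_1$ refines $\{V_1,V_2,V_3\}$, $\mathcal{P}$ induces the partition $\mathcal{P}^{i_1}_1$ of $V_{i_1}\cup(V_{i_2}\times V_{i_3})$ consisting of the parts of $\mathcal{P}_1$ contained in $V_{i_1}$ together with all $P\in\mathcal{P}_2$ with $P\subseteq X\times Y$ for some $X,Y\in\mathcal{P}_1$ with $X\subseteq V_{i_2}$, $Y\subseteq V_{i_3}$. $\mathcal{P}$ (with $\mathcal{P}_1$ refining $\{V_1,V_2,V_3\}$) is $\langle\delta\rangle$-regular for $H$ if it is $\langle\delta\rangle$-good and for each $i_1\in\{1,2,3\}$, $\mathcal{P}^{i_1}_1$ is a $\langle\delta\rangle$-regular partition of $G^{i_1}_H$.
   Formalization: The parameters δ and ρ are taken to be rational numbers; for ρ this is automatic from |K_3(G)| = ρ|V_1||V_2||V_3|, so the only real restriction is that δ is rational. -}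

module Defs where

open import Data.Bool using (Bool; true; false; _∧_; _xor_; if_then_else_)
open import Data.Nat as ℕ using (ℕ; zero; suc; _∸_)
open import Data.Integer as ℤ using (ℤ; +_; -[1+_])
open import Data.Rational as ℚ using (ℚ; _/_; 0ℚ; 1ℚ; ↥_; ↧ₙ_)
open import Data.Fin using (Fin; zero; suc)
open import Data.List using (List; []; _∷_; map; _++_; filter; length; cartesianProduct; allFin)
open import Data.Product using (_×_; _,_; proj₁; proj₂; Σ; ∃)
open import Data.Sum using (_⊎_; inj₁; inj₂)
open import Relation.Nullary using (¬_)
open import Relation.Nullary.Decidable using (does)
open import Relation.Binary using (DecidableEquality)
open import Relation.Binary.PropositionalEquality using (_≡_; _≢_)
open import Data.Bool.Properties using () renaming (_≟_ to _≟B_)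

ℕ→ℚ : ℕ → ℚ
ℕ→ℚ m = (+ m) / 1

_^ℚ_ : ℚ → ℕ → ℚ
q ^ℚ zero = 1ℚ
q ^ℚ suc m = q ℚ.* (q ^ℚ m)

-- reciprocal (only ever applied to positive rationals; 1/0 := 0)
recip : ℚ → ℚ
recip q with ↥ q
... | + zero = 0ℚ
... | + suc m = (+ (↧ₙ q)) / suc m
... | -[1+ m ] = ℤ.- (+ (↧ₙ q)) / suc m

-- T-function: Tsh m x = T_m(x+1), i.e.  T_m(1) = m, T_m(x+1) = T_m(x) 2^{T_m(x)}
Tsh : ℕ → ℕ → ℕ
Tsh m zero = m
Tsh m (suc x) = Tsh m x ℕ.* (2 ℕ.^ Tsh m x)

-- T_m(x) for x ≥ 1
T : ℕ → ℕ → ℕ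
T m x = Tsh m (x ∸ 1)

-- T_3(y) for real (here rational) y > 0 : T_3(⌈y⌉)
T3ℚ : ℚ → ℕ
T3ℚ y = T 3 ℤ.∣ ℚ.⌈ y ⌉ ∣

-- Finite sets are represented by duplicate-free enumerations (lists);
-- subsets of an enumerated set by Boolean masks.

count : ∀ {a} {A : Set a} → (A → Bool) → List A → ℕ
count p xs = length (filter (λ x → p x ≟B true) xs)

pairs : ∀ {A : Set} → List A → List (A × A)
pairs [] = []
pairs (x ∷ xs) = map (x ,_) xs ++ pairs xs

-- density with the convention 0 when a side is empty
dens : ℕ → ℕ → ℚ
dens e zero = 0ℚ
dens e (suc m) = (+ e) / suc m

-- Bigraphs  B = (U, W; E)  with U ⊆ A, W ⊆ B enumerated, E ⊆ U × W

eB : ∀ {A B : Set} → (A → B → Bool) → List A → List B → ℕ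
eB E U W = count (λ p → E (proj₁ p) (proj₂ p)) (cartesianProduct U W)

dB : ∀ {A B : Set} → (A → B → Bool) → List A → List B → ℚ
dB E U W = dens (eB E U W) (length U ℕ.* length W)

IsRegBigraph : ∀ {A B : Set} → ℚ → List A → List B → (A → B → Bool) → Set
IsRegBigraph {A} {B} δ U W E =
  (s : A → Bool) (t : B → Bool) →
  let U' = filter (λ x → s x ≟B true) U
      W' = filter (λ y → t y ≟B true) W
  in δ ℚ.* ℕ→ℚ (length U) ℚ.≤ ℕ→ℚ (length U') →
     δ ℚ.* ℕ→ℚ (length W) ℚ.≤ ℕ→ℚ (length W') →
     dB E U W ℚ.* ((+ 1) / 2) ℚ.≤ dB E U' W'

-- Partitions of an enumerated set, given by a labelling with labels in a
-- type with decidable equality; the part with label a is {v | q v ≡ a}.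

part : ∀ {T L : Set} → DecidableEquality L → List T → (T → L) → L → List T
part _≟_ V q a = filter (λ v → q v ≟ a) V

-- A graph Γ = (V, E) on an enumerated vertex set, E given by a symmetric
-- Boolean relation; edges are unordered pairs of distinct vertices.
-- The partition q is ⟨δ⟩-regular for Γ.
IsRegPartition : ∀ {T L : Set} → DecidableEquality L → ℚ → List T →
                 (E : T → T → Bool) → (T → L) → Set
IsRegPartition {T} {L} _≟_ δ V E q =
  Σ (T → T → Bool) λ E' →
    (∀ u v → E' u v ≡ E' v u) ×
    (ℕ→ℚ (count (λ p → E (proj₁ p) (proj₂ p) xor E' (proj₁ p) (proj₂ p)) (pairs V))
       ℚ.≤ δ ℚ.* ℕ→ℚ (count (λ p → E (proj₁ p) (proj₂ p)) (pairs V))) ×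
    (∀ a b → a ≢ b → IsRegBigraph δ (part _≟_ V q a) (part _≟_ V q b) E')

-- The concrete setting: V_i = {i} × Fin n  (i ∈ Fin 3 ; index 0,1,2 for V_1,V_2,V_3)

Vtx : ℕ → Set
Vtx n = Fin 3 × Fin n

allVtx : (n : ℕ) → List (Vtx n)
allVtx n = cartesianProduct (allFin 3) (allFin n)

record TriGraph (n : ℕ) : Set where
  field
    e12 : Fin n → Fin n → Bool
    e13 : Fin n → Fin n → Bool
    e23 : Fin n → Fin n → Bool

inK3 : ∀ {n} → TriGraph n → Fin n → Fin n → Fin n → Bool
inK3 G x y z = TriGraph.e12 G x y ∧ TriGraph.e13 G x z ∧ TriGraph.e23 G y z

numK3 : ∀ {n} → TriGraph n → ℕ
numK3 {n} G =
  count (λ t → inK3 G (proj₁ t) (proj₁ (proj₂ t)) (proj₂ (proj₂ t)))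
        (cartesianProduct (allFin n) (cartesianProduct (allFin n) (allFin n)))

inF : ∀ {n} → TriGraph n → Vtx n → Vtx n → Vtx n → Bool
inF G (zero , x) (suc zero , y) (suc (suc zero) , z) = inK3 G x y z
inF G (zero , x) (suc (suc zero) , z) (suc zero , y) = inK3 G x y z
inF G (suc zero , y) (zero , x) (suc (suc zero) , z) = inK3 G x y z
inF G (suc zero , y) (suc (suc zero) , z) (zero , x) = inK3 G x y z
inF G (suc (suc zero) , z) (zero , x) (suc zero , y) = inK3 G x y z
inF G (suc (suc zero) , z) (suc zero , y) (zero , x) = inK3 G x y z
inF G _ _ _ = false

-- {i_2, i_3} = {1,2,3} \ {i_1}, i_2 < i_3
idx2 idx3 : Fin 3 → Fin 3
idx2 zero = suc zero
idx2 (suc _) = zero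
idx3 zero = suc (suc zero)
idx3 (suc zero) = suc (suc zero)
idx3 (suc (suc zero)) = suc zero

-- vertex set of G^{i_1}_H :  V_{i_1} ∪ (V_{i_2} × V_{i_3})
GVtx : ℕ → Set
GVtx n = Fin n ⊎ (Fin n × Fin n)

allGVtx : (n : ℕ) → List (GVtx n)
allGVtx n = map inj₁ (allFin n) ++ map inj₂ (cartesianProduct (allFin n) (allFin n))

GH : ∀ {n} → TriGraph n → Fin 3 → GVtx n → GVtx n → Bool
GH G i (inj₁ u) (inj₂ (v , w)) = inF G (i , u) (idx2 i , v) (idx3 i , w)
GH G i (inj₂ (v , w)) (inj₁ u) = inF G (i , u) (idx2 i , v) (idx3 i , w)
GH G i _ _ = false

-- Partitions of V(H) into k parts: surjective labellings V → Fin k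

record VPartition (n : ℕ) : Set where
  field
    k   : ℕ
    lab : Vtx n → Fin k
    surj : ∀ (j : Fin k) → ∃ λ v → lab v ≡ j

RefinesParts : ∀ {n} → VPartition n → Set
RefinesParts {n} Q = ∀ (u v : Vtx n) → VPartition.lab Q u ≡ VPartition.lab Q v → proj₁ u ≡ proj₁ v

Refines : ∀ {n} → VPartition n → VPartition n → Set
Refines {n} Q Q' = ∀ (u v : Vtx n) → VPartition.lab Q u ≡ VPartition.lab Q v →
                   VPartition.lab Q' u ≡ VPartition.lab Q' v

-- A decomposition 𝒫 = (𝒫_1, 𝒫_2): 𝒫_1 a partition of V, and for X,Y ∈ 𝒫_1 the
-- partition of X × Y whose parts are {(a,b) ∈ X × Y | sub a b ≡ l}.
record Decomposition (n : ℕ) : Set where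
  field
    P1  : VPartition n
    sub : Vtx n → Vtx n → ℕ

open import Data.Fin.Properties using () renaming (_≟_ to _≟F_)
open import Data.Nat.Properties using () renaming (_≟_ to _≟N_)
import Data.Sum.Properties as SumP
import Data.Product.Properties as ProdP

IsGood : ∀ {n} → ℚ → Decomposition n → Set
IsGood {n} δ D =
  ∀ (X Y : Fin (VPartition.k P1)) (l : ℕ) →
    IsRegBigraph δ (part _≟F_ (allVtx n) (VPartition.lab P1) X)
                   (part _≟F_ (allVtx n) (VPartition.lab P1) Y)
                   (λ a b → does (Decomposition.sub D a b ≟N l))
  where P1 = Decomposition.P1 D

PLabel : ℕ → Set
PLabel k = Fin k ⊎ (Fin k × Fin k × ℕ)

PLabel-≟ : (k : ℕ) → DecidableEquality (PLabel k)
PLabel-≟ k = SumP.≡-dec _≟F_ (ProdP.≡-dec _≟F_ (ProdP.≡-dec _≟F_ _≟N_))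

inducedLab : ∀ {n} → (D : Decomposition n) → Fin 3 → GVtx n →
             PLabel (VPartition.k (Decomposition.P1 D))
inducedLab D i (inj₁ u) = inj₁ (VPartition.lab (Decomposition.P1 D) (i , u))
inducedLab D i (inj₂ (v , w)) =
  inj₂ ( VPartition.lab (Decomposition.P1 D) (idx2 i , v)
       , VPartition.lab (Decomposition.P1 D) (idx3 i , w)
       , Decomposition.sub D (idx2 i , v) (idx3 i , w))

IsRegForH : ∀ {n} → ℚ → TriGraph n → Decomposition n → Set
IsRegForH {n} δ G D =
  RefinesParts (Decomposition.P1 D) ×
  IsGood δ D ×
  (∀ (i : Fin 3) → IsRegPartition (PLabel-≟ _) δ (allGVtx n) (GH G i) (inducedLab D i))

{-# OPTIONS --safe #-}
module Submission where

-- Szemerédi's regularity lemma, applied to G starting from 𝒱₀, gives 𝒫₁.  A regular pair of cells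
-- X, Y is split into the edges and the non-edges of G, unless G is very sparse or nearly
-- complete on it, in which case X × Y stays in one piece; both parts then inherit a lower bound on
-- the density of their large subgrids.  Now let A, X, Y be pairwise regular and not sparse, with
-- densities d₁ of (A, X) and d₂ of (A, Y).  For all A′ ⊆ A and P′ ⊆ X × Y, replacing the edges of
-- (A, X) and then those of (A, Y) by their density shows that A′ × P′ contains d₁d₂|A′||P′| cherries,
-- up to 3ε|A||X||Y|.  Hence G^i_H is regular between A and every part of X × Y, and the
-- triples over irregular or sparse pairs, which are the ones E′ discards, form at
-- most a δρ fraction of all triples.
--
-- With N ≈ 1/(δρ) and ε = 1/M, all of this is an argument about integers.

-- Goodness tolerates no exceptional part: every P in 𝒫₂ has to be regular, even over an irregular
-- pair of cells, while G^i_H may lose a δ fraction of its edges. Leaving an irregular or sparse X ×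
-- Y whole makes its part a complete bigraph, and the triangles over it are charged to E′. A nearly
-- complete pair is left whole for another reason: its few non-edges might form an irregular part,
-- yet its triangles are too many to discard; there the non-edges are merely negligible in every
-- large set of pairs. The budget is δ|F| = δρn³, so a single N with 1/N ≤ δρ serves both for the
-- size of the tested sets and for the discarded mass. A pair counts as sparse below density h/M =
-- 1/(54N). This ratio is dictated by the budget, while h itself stays free: raising h shrinks the
-- accuracy 1/M against the product (h/M)³ of three densities, and this is what the cherry count
-- needs. A power of N suffices for h, so the number of refinement rounds is polynomial in 1/(δρ),
-- and each round costs two levels of the tower.

module Regularity where

  open import Defs
  open import Data.Bool using (Bool; true; false; _∧_; _xor_; not; if_then_else_)
  open import Data.Bool.Properties using (not-involutive; ∧-comm; ∧-assoc) renaming (_≟_ to _≟B_)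
  open import Data.Empty using (⊥-elim)
  open import Data.Fin using (Fin; zero; suc; combine; remQuot; finToFun; funToFin; punchIn; punchOut)
  open import Data.Fin.Properties as FinP using () renaming (_≟_ to _≟F_)
  open import Data.Fin.Subset.Properties using (anySubset?)
  open import Data.Integer as ℤ using (ℤ; +_; -[1+_]; 0ℤ; 1ℤ; _+_; _*_; _-_; -_; _≤_; _<_; +≤+)
  import Data.Integer.DivMod as ℤDM
  open import Data.Integer.Properties as ℤP
    using (≤-trans; ≤-refl; ≤-reflexive; +-mono-≤; module ≤-Reasoning)
  open import Data.Integer.Tactic.RingSolver using (solve-∀)
  open import Data.List using (List; []; _∷_; map; _++_; filter; length; cartesianProduct; allFin)
  open import Data.List.Properties using (map-tabulate; filter-≐; length-tabulate)
  open import Data.List.Relation.Unary.All as All using (All; []; _∷_)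
  open import Data.List.Relation.Unary.All.Properties using (all-filter)
  open import Data.Nat as ℕ using (ℕ; zero; suc)
  open import Data.Nat.DivMod using (_%_; m≡m%n+[m/n]*n; m%n<n; m/n*n≤m)
  open import Data.Nat.Properties as ℕP using () renaming (_≟_ to _≟N_)
  open import Data.Nat.Tactic.RingSolver using () renaming (solve-∀ to solve-∀ℕ)
  open import Data.Product using (_×_; _,_; proj₁; proj₂; ∃; uncurry)
  open import Data.Product.Properties using () renaming (≡-dec to ×-≡-dec)
  open import Data.Rational as ℚ using (ℚ; mkℚ; _/_; 0ℚ; 1ℚ; ↥_; ↧_; toℚᵘ)
  import Data.Rational.Properties as ℚP
  open import Data.Rational.Unnormalised as ℚᵘ using (mkℚᵘ)
  import Data.Rational.Unnormalised.Properties as ℚᵘP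
  open import Data.Sum using (_⊎_; inj₁; inj₂)
  open import Data.Sum.Properties using (inj₂-injective)
  open import Data.Vec using (lookup) renaming (tabulate to tabulateᵥ)
  open import Data.Vec.Properties using (lookup∘tabulate)
  open import Function using (_∘_)
  open import Relation.Binary using (DecidableEquality)
  open import Relation.Binary.PropositionalEquality
  open import Relation.Nullary using (¬_; yes; no; does; Dec)
  open import Relation.Nullary.Decidable using (_⊎-dec_; map′; ¬?; decidable-stable)
  open import Relation.Unary using (Decidable)

  -- Integer inequalities and indicators

  private variable
    A B C L : Set

  -- Nonlinear inequalities are proved below by certificates: `d` is a sum of products of
  -- nonnegative quantities, built from the inequalities in use, and the ring solver confirms the
  -- identity.
  ≤-by : ∀ {a b} d → 0ℤ ≤ d → b ≡ a + d → a ≤ b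
  ≤-by {a} d 0≤d refl = subst (_≤ a + d) (ℤP.+-identityʳ a) (ℤP.+-monoʳ-≤ a 0≤d)

  0≤b-a : ∀ {a b} → a ≤ b → 0ℤ ≤ b - a
  0≤b-a = ℤP.i≤j⇒0≤j-i

  0≤+ : ∀ {a b} → 0ℤ ≤ a → 0ℤ ≤ b → 0ℤ ≤ a + b
  0≤+ = +-mono-≤

  0≤+n : ∀ {n} → 0ℤ ≤ + n
  0≤+n = +≤+ ℕ.z≤n

  0≤* : ∀ {a b} → 0ℤ ≤ a → 0ℤ ≤ b → 0ℤ ≤ a * b
  0≤* {+ a} {+ b} _ _ = subst (0ℤ ≤_) (ℤP.pos-* a b) 0≤+n

  *-monoˡ : ∀ {a b c} → 0ℤ ≤ c → a ≤ b → c * a ≤ c * b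
  *-monoˡ {c = + n} _ = ℤP.*-monoˡ-≤-nonNeg (+ n)

  *-monoʳ : ∀ {a b c} → 0ℤ ≤ c → a ≤ b → a * c ≤ b * c
  *-monoʳ {c = + n} _ = ℤP.*-monoʳ-≤-nonNeg (+ n)

  *-mono : ∀ {a b c d} → 0ℤ ≤ a → 0ℤ ≤ d → a ≤ b → c ≤ d → a * c ≤ b * d
  *-mono 0≤a 0≤d a≤b c≤d = ≤-trans (*-monoˡ 0≤a c≤d) (*-monoʳ 0≤d a≤b)

  𝟙 : Bool → ℤ
  𝟙 true  = 1ℤ
  𝟙 false = 0ℤ

  0≤𝟙 : ∀ b → 0ℤ ≤ 𝟙 b
  0≤𝟙 true  = 0≤+n
  0≤𝟙 false = 0≤+n

  𝟙≤1 : ∀ b → 𝟙 b ≤ 1ℤ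
  𝟙≤1 true  = ≤-refl
  𝟙≤1 false = 0≤+n

  𝟙-∧ : ∀ a b → 𝟙 (a ∧ b) ≡ 𝟙 a * 𝟙 b
  𝟙-∧ true  b = sym (ℤP.*-identityˡ (𝟙 b))
  𝟙-∧ false b = refl

  𝟙-not : ∀ a → 𝟙 (not a) ≡ 1ℤ - 𝟙 a
  𝟙-not true  = refl
  𝟙-not false = refl

  -- Finite sums

  #_ : List A → ℤ
  # xs = + length xs

  0≤# : ∀ (xs : List A) → 0ℤ ≤ # xs
  0≤# xs = 0≤+n

  ∑ : List A → (A → ℤ) → ℤ
  ∑ []       f = 0ℤ
  ∑ (x ∷ xs) f = f x + ∑ xs f

  ∑-cong : ∀ (xs : List A) {f g : A → ℤ} → (∀ x → f x ≡ g x) → ∑ xs f ≡ ∑ xs g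
  ∑-cong []       eq = refl
  ∑-cong (x ∷ xs) eq = cong₂ _+_ (eq x) (∑-cong xs eq)

  ∑-cong-All : ∀ {xs : List A} {f g : A → ℤ} → All (λ x → f x ≡ g x) xs → ∑ xs f ≡ ∑ xs g
  ∑-cong-All []         = refl
  ∑-cong-All (eq ∷ eqs) = cong₂ _+_ eq (∑-cong-All eqs)

  ∑-mono : ∀ (xs : List A) {f g : A → ℤ} → (∀ x → f x ≤ g x) → ∑ xs f ≤ ∑ xs g
  ∑-mono []       le = ≤-refl
  ∑-mono (x ∷ xs) le = +-mono-≤ (le x) (∑-mono xs le)

  ∑-nonneg : ∀ (xs : List A) {f : A → ℤ} → (∀ x → 0ℤ ≤ f x) → 0ℤ ≤ ∑ xs f
  ∑-nonneg []       le = ≤-refl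
  ∑-nonneg (x ∷ xs) le = 0≤+ (le x) (∑-nonneg xs le)

  ∑-+ : ∀ (xs : List A) (f g : A → ℤ) → ∑ xs (λ x → f x + g x) ≡ ∑ xs f + ∑ xs g
  ∑-+ []       f g = refl
  ∑-+ (x ∷ xs) f g = trans (cong (_+_ (f x + g x)) (∑-+ xs f g)) (interchange (f x) (g x) _ _)
    where
    interchange : ∀ a b c d → (a + b) + (c + d) ≡ (a + c) + (b + d)
    interchange = solve-∀

  ∑-*ˡ : ∀ (xs : List A) c (f : A → ℤ) → ∑ xs (λ x → c * f x) ≡ c * ∑ xs f
  ∑-*ˡ []       c f = sym (ℤP.*-zeroʳ c)
  ∑-*ˡ (x ∷ xs) c f = trans (cong (_+_ (c * f x)) (∑-*ˡ xs c f)) (sym (ℤP.*-distribˡ-+ c (f x) _))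

  ∑-*ʳ : ∀ (xs : List A) c (f : A → ℤ) → ∑ xs (λ x → f x * c) ≡ ∑ xs f * c
  ∑-*ʳ xs c f = trans (∑-cong xs (λ x → ℤP.*-comm (f x) c)) (trans (∑-*ˡ xs c f) (ℤP.*-comm c _))

  ∑-zero : ∀ (xs : List A) → ∑ xs (λ _ → 0ℤ) ≡ 0ℤ
  ∑-zero []       = refl
  ∑-zero (x ∷ xs) = trans (ℤP.+-identityˡ _) (∑-zero xs)

  #≡∑1 : ∀ (xs : List A) → # xs ≡ ∑ xs (λ _ → 1ℤ)
  #≡∑1 []       = refl
  #≡∑1 (x ∷ xs) = trans (ℤP.pos-+ 1 (length xs)) (cong (_+_ 1ℤ) (#≡∑1 xs))

  ∑-const : ∀ (xs : List A) c → ∑ xs (λ _ → c) ≡ # xs * c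
  ∑-const xs c = trans (∑-cong xs (λ _ → sym (ℤP.*-identityˡ c)))
    (trans (∑-*ʳ xs c (λ _ → 1ℤ)) (cong (_* c) (sym (#≡∑1 xs))))

  ∑-swap : ∀ (xs : List A) (ys : List B) (f : A → B → ℤ) →
    ∑ xs (λ x → ∑ ys (f x)) ≡ ∑ ys (λ y → ∑ xs (λ x → f x y))
  ∑-swap []       ys f = sym (∑-zero ys)
  ∑-swap (x ∷ xs) ys f = trans (cong (_+_ (∑ ys (f x))) (∑-swap xs ys f)) (sym (∑-+ ys _ _))

  ∑-++ : ∀ (xs ys : List A) (f : A → ℤ) → ∑ (xs ++ ys) f ≡ ∑ xs f + ∑ ys f
  ∑-++ []       ys f = sym (ℤP.+-identityˡ _)
  ∑-++ (x ∷ xs) ys f = trans (cong (_+_ (f x)) (∑-++ xs ys f)) (sym (ℤP.+-assoc (f x) _ _))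

  ∑-map : ∀ (h : A → B) (xs : List A) (f : B → ℤ) → ∑ (map h xs) f ≡ ∑ xs (f ∘ h)
  ∑-map h []       f = refl
  ∑-map h (x ∷ xs) f = cong (_+_ (f (h x))) (∑-map h xs f)

  ∑-filter : ∀ {P : A → Set} (P? : Decidable P) (xs : List A) (f : A → ℤ) →
    ∑ (filter P? xs) f ≡ ∑ xs (λ x → 𝟙 (does (P? x)) * f x)
  ∑-filter P? []       f = refl
  ∑-filter P? (x ∷ xs) f with does (P? x)
  ... | true  = cong₂ _+_ (sym (ℤP.*-identityˡ (f x))) (∑-filter P? xs f)
  ... | false = trans (∑-filter P? xs f) (sym (ℤP.+-identityˡ _))

  #-filter : ∀ {P : A → Set} (P? : Decidable P) (xs : List A) →
    # (filter P? xs) ≡ ∑ xs (λ x → 𝟙 (does (P? x)))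
  #-filter P? xs = trans (#≡∑1 (filter P? xs))
    (trans (∑-filter P? xs _) (∑-cong xs (λ x → ℤP.*-identityʳ _)))

  does-≟true : ∀ b → does (b ≟B true) ≡ b
  does-≟true true  = refl
  does-≟true false = refl

  ∑-mask : ∀ (s : A → Bool) (xs : List A) (f : A → ℤ) →
    ∑ (filter (λ x → s x ≟B true) xs) f ≡ ∑ xs (λ x → 𝟙 (s x) * f x)
  ∑-mask s xs f = trans (∑-filter (λ x → s x ≟B true) xs f)
    (∑-cong xs (λ x → cong (λ b → 𝟙 b * f x) (does-≟true (s x))))

  #-mask : ∀ (s : A → Bool) (xs : List A) → # (filter (λ x → s x ≟B true) xs) ≡ ∑ xs (𝟙 ∘ s)
  #-mask s xs = trans (#-filter (λ x → s x ≟B true) xs) (∑-cong xs (λ x → cong 𝟙 (does-≟true (s x))))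

  ∑₂ : List A → List B → (A → B → ℤ) → ℤ
  ∑₂ xs ys f = ∑ xs (λ x → ∑ ys (f x))

  ∑₂-cong : ∀ (xs : List A) (ys : List B) {f g : A → B → ℤ} →
    (∀ x y → f x y ≡ g x y) → ∑₂ xs ys f ≡ ∑₂ xs ys g
  ∑₂-cong xs ys eq = ∑-cong xs (λ x → ∑-cong ys (eq x))

  ∑₂-mono : ∀ (xs : List A) (ys : List B) {f g : A → B → ℤ} →
    (∀ x y → f x y ≤ g x y) → ∑₂ xs ys f ≤ ∑₂ xs ys g
  ∑₂-mono xs ys le = ∑-mono xs (λ x → ∑-mono ys (le x))

  ∑₂-nonneg : ∀ (xs : List A) (ys : List B) {f : A → B → ℤ} →
    (∀ x y → 0ℤ ≤ f x y) → 0ℤ ≤ ∑₂ xs ys f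
  ∑₂-nonneg xs ys le = ∑-nonneg xs (λ x → ∑-nonneg ys (le x))

  ∑₂-+ : ∀ (xs : List A) (ys : List B) (f g : A → B → ℤ) →
    ∑₂ xs ys (λ x y → f x y + g x y) ≡ ∑₂ xs ys f + ∑₂ xs ys g
  ∑₂-+ xs ys f g = trans (∑-cong xs (λ x → ∑-+ ys (f x) (g x))) (∑-+ xs _ _)

  ∑₂-*ˡ : ∀ (xs : List A) (ys : List B) c (f : A → B → ℤ) →
    ∑₂ xs ys (λ x y → c * f x y) ≡ c * ∑₂ xs ys f
  ∑₂-*ˡ xs ys c f = trans (∑-cong xs (λ x → ∑-*ˡ ys c (f x))) (∑-*ˡ xs c _)

  ∑₂-product : ∀ (xs : List A) (ys : List B) (f : A → ℤ) (g : B → ℤ) →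
    ∑₂ xs ys (λ x y → f x * g y) ≡ ∑ xs f * ∑ ys g
  ∑₂-product xs ys f g = trans (∑-cong xs (λ x → ∑-*ˡ ys (f x) g)) (∑-*ʳ xs (∑ ys g) f)

  ∑₂-one : ∀ (xs : List A) (ys : List B) → ∑₂ xs ys (λ _ _ → 1ℤ) ≡ # xs * # ys
  ∑₂-one xs ys = trans (∑₂-product xs ys (λ _ → 1ℤ) (λ _ → 1ℤ)) (cong₂ _*_ (sym (#≡∑1 xs)) (sym (#≡∑1 ys)))

  ∑-cartesian : ∀ (xs : List A) (ys : List B) (f : A × B → ℤ) →
    ∑ (cartesianProduct xs ys) f ≡ ∑₂ xs ys (λ x y → f (x , y))
  ∑-cartesian []       ys f = refl
  ∑-cartesian (x ∷ xs) ys f = trans (∑-++ (map (x ,_) ys) _ f)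
    (cong₂ _+_ (∑-map (x ,_) ys f) (∑-cartesian xs ys f))

  ∑-part-cong : ∀ (_≟_ : DecidableEquality L) (V : List A) (q : A → L) (a : L) {f g : A → ℤ} →
    (∀ x → q x ≡ a → f x ≡ g x) → ∑ (part _≟_ V q a) f ≡ ∑ (part _≟_ V q a) g
  ∑-part-cong _≟_ V q a eq = ∑-cong-All (All.map (λ {x} → eq x) (all-filter (λ v → q v ≟ a) V))

  -- Densities are measured in units of 1/M: φ/M plays the role of the density of E on U × W,
  -- and 1/M that of the accuracy ε.

  disc : ℤ → ℤ → List A → List B → (A → B → Bool) → (A → Bool) → (B → Bool) → ℤ
  disc M φ U W E s t = ∑₂ U W (λ u w → 𝟙 (s u) * 𝟙 (t w) * (M * 𝟙 (E u w) - φ))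

  edges : List A → List B → (A → B → Bool) → (A → Bool) → (B → Bool) → ℤ
  edges U W E s t = ∑₂ U W (λ u w → 𝟙 (s u) * 𝟙 (t w) * 𝟙 (E u w))

  -- Regularity in the cut norm: the error is |U||W|/M on every rectangle, small ones included. This
  -- form lets the cherry count add discrepancies over arbitrary sections of a set of pairs. `φ` is
  -- any integer with this property, not the exact density.
  record Regular (M φ : ℤ) (U : List A) (W : List B) (E : A → B → Bool) : Set where
    constructor regular
    field
      bound : ∀ s t → disc M φ U W E s t ≤ # U * # W × - disc M φ U W E s t ≤ # U * # W

  open Regular public

  all : A → Bool
  all _ = true

  disc-expand : ∀ M φ (U : List A) (W : List B) E s t →
    disc M φ U W E s t ≡ M * edges U W E s t - φ * (∑ U (𝟙 ∘ s) * ∑ W (𝟙 ∘ t))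
  disc-expand M φ U W E s t = begin
    disc M φ U W E s t
      ≡⟨ ∑₂-cong U W (λ u w → expand M φ (𝟙 (s u)) (𝟙 (t w)) (𝟙 (E u w))) ⟩
    ∑₂ U W (λ u w → M * (𝟙 (s u) * 𝟙 (t w) * 𝟙 (E u w)) + (- φ) * (𝟙 (s u) * 𝟙 (t w)))
      ≡⟨ ∑₂-+ U W _ _ ⟩
    ∑₂ U W (λ u w → M * (𝟙 (s u) * 𝟙 (t w) * 𝟙 (E u w))) + ∑₂ U W (λ u w → (- φ) * (𝟙 (s u) * 𝟙 (t w)))
      ≡⟨ cong₂ _+_ (∑₂-*ˡ U W M _) (trans (∑₂-*ˡ U W (- φ) _) (cong (- φ *_) (∑₂-product U W _ _))) ⟩
    M * edges U W E s t + (- φ) * (∑ U (𝟙 ∘ s) * ∑ W (𝟙 ∘ t))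
      ≡⟨ cong (_+_ (M * edges U W E s t)) (sym (ℤP.neg-distribˡ-* φ _)) ⟩
    M * edges U W E s t - φ * (∑ U (𝟙 ∘ s) * ∑ W (𝟙 ∘ t)) ∎
    where
    open ≡-Reasoning
    expand : ∀ M φ a b e → a * b * (M * e - φ) ≡ M * (a * b * e) + (- φ) * (a * b)
    expand = solve-∀

  Regular-upper : ∀ {M φ} {U : List A} {W : List B} {E} → Regular M φ U W E → ∀ s t →
    M * edges U W E s t ≤ φ * (∑ U (𝟙 ∘ s) * ∑ W (𝟙 ∘ t)) + # U * # W
  Regular-upper {M = M} {φ} {U} {W} {E} reg s t =
    ≤-by _ (0≤b-a (subst (_≤ # U * # W) (disc-expand M φ U W E s t) (proj₁ (bound reg s t))))
      (identity (M * edges U W E s t) (φ * (∑ U (𝟙 ∘ s) * ∑ W (𝟙 ∘ t))) (# U * # W))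
    where
    identity : ∀ e f k → f + k ≡ e + (k - (e - f))
    identity = solve-∀

  Regular-lower : ∀ {M φ} {U : List A} {W : List B} {E} → Regular M φ U W E → ∀ s t →
    φ * (∑ U (𝟙 ∘ s) * ∑ W (𝟙 ∘ t)) ≤ M * edges U W E s t + # U * # W
  Regular-lower {M = M} {φ} {U} {W} {E} reg s t =
    ≤-by _ (0≤b-a (subst (λ d → - d ≤ # U * # W) (disc-expand M φ U W E s t) (proj₂ (bound reg s t))))
      (identity (M * edges U W E s t) (φ * (∑ U (𝟙 ∘ s) * ∑ W (𝟙 ∘ t))) (# U * # W))
    where
    identity : ∀ e f k → e + k ≡ f + (k - - (e - f))
    identity = solve-∀

  edges≤ : ∀ (U : List A) (W : List B) E s t → edges U W E s t ≤ ∑ U (𝟙 ∘ s) * ∑ W (𝟙 ∘ t)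
  edges≤ U W E s t = ≤-trans (∑₂-mono U W (λ u w →
      ≤-trans (*-monoˡ (0≤* (0≤𝟙 (s u)) (0≤𝟙 (t w))) (𝟙≤1 (E u w))) (≤-reflexive (ℤP.*-identityʳ _))))
    (≤-reflexive (∑₂-product U W _ _))

  -- Exchanging edges and non-edges changes the sign of every discrepancy once `φ` is replaced by
  -- `M - φ`. This serves the parts that consist of non-edges.
  Regular-complement : ∀ {M φ} {U : List A} {W : List B} {E} →
    Regular M φ U W E → Regular M (M - φ) U W (λ u w → not (E u w))
  Regular-complement {M = M} {φ} {U} {W} {E} reg = regular λ s t →
      subst (_≤ # U * # W) (sym (negated s t)) (proj₂ (bound reg s t))
    , subst (_≤ # U * # W) (sym (trans (cong (-_) (negated s t)) (ℤP.neg-involutive _))) (proj₁ (bound reg s t))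
    where
    pointwise : ∀ M φ a b e → a * b * (M * (1ℤ - e) - (M - φ)) ≡ (- 1ℤ) * (a * b * (M * e - φ))
    pointwise = solve-∀
    negated : ∀ s t → disc M (M - φ) U W (λ u w → not (E u w)) s t ≡ - disc M φ U W E s t
    negated s t = trans (∑₂-cong U W (λ u w →
        trans (cong (λ e → 𝟙 (s u) * 𝟙 (t w) * (M * e - (M - φ))) (𝟙-not (E u w)))
              (pointwise M φ (𝟙 (s u)) (𝟙 (t w)) (𝟙 (E u w)))))
      (trans (∑₂-*ˡ U W (- 1ℤ) _) (ℤP.-1*i≡-i _))

  -- Counting cherries

  ∑-all : ∀ (xs : List A) → ∑ xs (𝟙 ∘ all) ≡ # xs
  ∑-all xs = sym (#≡∑1 xs)

  cherries : List A → List B → List C → (A → B → Bool) → (A → C → Bool) →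
             (A → Bool) → (B → C → Bool) → ℤ
  cherries U X Y a b s p =
    ∑ U λ u → ∑₂ X Y λ v w → 𝟙 (s u) * 𝟙 (p v w) * (𝟙 (a u v) * 𝟙 (b u w))

  -- The edges of a and then those of b are replaced by their average densities; each replacement
  -- is a sum of bipartite discrepancies, one for every vertex of the third class.
  cherries-identity : ∀ M φ₁ φ₂ (U : List A) (X : List B) (Y : List C) a b s p →
    M * M * cherries U X Y a b s p ≡
      φ₁ * φ₂ * (∑ U (𝟙 ∘ s) * ∑₂ X Y (λ v w → 𝟙 (p v w)))
      + (M * ∑ Y (λ w → disc M φ₁ U X a (λ u → s u ∧ b u w) (λ v → p v w))
         + φ₁ * ∑ X (λ v → disc M φ₂ U Y b s (p v)))
  cherries-identity M φ₁ φ₂ U X Y a b s p = sym (begin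
    φ₁ * φ₂ * (∑ U (𝟙 ∘ s) * ∑₂ X Y (λ v w → 𝟙 (p v w))) + (M * D₁ + φ₁ * D₂)
      ≡⟨ cong₂ _+_ main (cong₂ _+_ (cong (_*_ M) first) (cong (_*_ φ₁) second)) ⟩
    ∑₃ F₀ + (M * ∑₃ F₁ + φ₁ * ∑₃ F₂)
      ≡⟨ cong (_+_ (∑₃ F₀)) (cong₂ _+_ (sym (∑₃-*ˡ M F₁)) (sym (∑₃-*ˡ φ₁ F₂))) ⟩
    ∑₃ F₀ + (∑₃ (λ u v w → M * F₁ u v w) + ∑₃ (λ u v w → φ₁ * F₂ u v w))
      ≡⟨ cong (_+_ (∑₃ F₀)) (sym (∑₃-+ _ _)) ⟩
    ∑₃ F₀ + ∑₃ (λ u v w → M * F₁ u v w + φ₁ * F₂ u v w)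
      ≡⟨ sym (∑₃-+ _ _) ⟩
    ∑₃ (λ u v w → F₀ u v w + (M * F₁ u v w + φ₁ * F₂ u v w))
      ≡⟨ ∑-cong U (λ u → ∑₂-cong X Y (λ v w → pointwise u v w)) ⟩
    ∑₃ (λ u v w → M * M * (𝟙 (s u) * 𝟙 (p v w) * (𝟙 (a u v) * 𝟙 (b u w))))
      ≡⟨ ∑₃-*ˡ (M * M) _ ⟩
    M * M * cherries U X Y a b s p ∎)
    where
    open ≡-Reasoning
    ∑₃ : (_ → _ → _ → ℤ) → ℤ
    ∑₃ f = ∑ U λ u → ∑₂ X Y (f u)
    ∑₃-*ˡ : ∀ c f → ∑₃ (λ u v w → c * f u v w) ≡ c * ∑₃ f
    ∑₃-*ˡ c f = trans (∑-cong U (λ u → ∑₂-*ˡ X Y c (f u))) (∑-*ˡ U c _)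
    ∑₃-+ : ∀ f g → ∑₃ (λ u v w → f u v w + g u v w) ≡ ∑₃ f + ∑₃ g
    ∑₃-+ f g = trans (∑-cong U (λ u → ∑₂-+ X Y (f u) (g u))) (∑-+ U _ _)
    D₁ = ∑ Y (λ w → disc M φ₁ U X a (λ u → s u ∧ b u w) (λ v → p v w))
    D₂ = ∑ X (λ v → disc M φ₂ U Y b s (p v))
    F₀ F₁ F₂ : _ → _ → _ → ℤ
    F₀ u v w = φ₁ * φ₂ * (𝟙 (s u) * 𝟙 (p v w))
    F₁ u v w = 𝟙 (s u ∧ b u w) * 𝟙 (p v w) * (M * 𝟙 (a u v) - φ₁)
    F₂ u v w = 𝟙 (s u) * 𝟙 (p v w) * (M * 𝟙 (b u w) - φ₂)
    main : φ₁ * φ₂ * (∑ U (𝟙 ∘ s) * ∑₂ X Y (λ v w → 𝟙 (p v w))) ≡ ∑₃ F₀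
    main = sym (trans (∑₃-*ˡ (φ₁ * φ₂) _) (cong (_*_ (φ₁ * φ₂))
      (trans (∑-cong U (λ u → ∑₂-*ˡ X Y (𝟙 (s u)) _)) (∑-*ʳ U _ _))))
    first : D₁ ≡ ∑₃ F₁
    first = trans (∑-swap Y U _) (∑-cong U (λ u → ∑-swap Y X _))
    second : D₂ ≡ ∑₃ F₂
    second = ∑-swap X U _
    ring-identity : ∀ M φ₁ φ₂ s p a b →
      φ₁ * φ₂ * (s * p) + (M * ((s * b) * p * (M * a - φ₁)) + φ₁ * (s * p * (M * b - φ₂)))
        ≡ M * M * (s * p * (a * b))
    ring-identity = solve-∀
    pointwise : ∀ u v w → F₀ u v w + (M * F₁ u v w + φ₁ * F₂ u v w)
      ≡ M * M * (𝟙 (s u) * 𝟙 (p v w) * (𝟙 (a u v) * 𝟙 (b u w)))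
    pointwise u v w = trans
      (cong (λ z → F₀ u v w + (M * (z * 𝟙 (p v w) * (M * 𝟙 (a u v) - φ₁)) + φ₁ * F₂ u v w)) (𝟙-∧ (s u) (b u w)))
      (ring-identity M φ₁ φ₂ (𝟙 (s u)) (𝟙 (p v w)) (𝟙 (a u v)) (𝟙 (b u w)))

  ∑-bounded : ∀ (xs : List A) {f : A → ℤ} {c} → (∀ x → f x ≤ c) → ∑ xs f ≤ # xs * c
  ∑-bounded xs {c = c} le = ≤-trans (∑-mono xs le) (≤-reflexive (∑-const xs c))

  ∑-neg : ∀ (xs : List A) (f : A → ℤ) → - ∑ xs f ≡ ∑ xs (λ x → - f x)
  ∑-neg []       f = refl
  ∑-neg (x ∷ xs) f = trans (ℤP.neg-distrib-+ (f x) _) (cong (_+_ (- f x)) (∑-neg xs f))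

  -- Since `φ` is produced by an iteration, it may exceed `M`. Testing regularity on the whole
  -- rectangle shows that the excess is at most one unit, unless a side is empty.
  Regular⇒density≤ : ∀ {M φ} {U : List A} {W : List B} {E} → 0ℤ ≤ M → Regular M φ U W E →
    φ * (# U * # W) ≤ (M + 1ℤ) * (# U * # W)
  Regular⇒density≤ {M = M} {φ} {U} {W} {E} 0≤M reg = begin
    φ * (# U * # W)
      ≡⟨ cong (_*_ φ) (sym sizes) ⟩
    φ * (∑ U (𝟙 ∘ all) * ∑ W (𝟙 ∘ all))
      ≤⟨ Regular-lower reg all all ⟩
    M * edges U W E all all + # U * # W
      ≤⟨ ℤP.+-monoˡ-≤ (# U * # W) (*-monoˡ 0≤M (≤-trans (edges≤ U W E all all) (≤-reflexive sizes))) ⟩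
    M * (# U * # W) + # U * # W
      ≡⟨ factor M (# U * # W) ⟩
    (M + 1ℤ) * (# U * # W) ∎
    where
    open ≤-Reasoning
    sizes = cong₂ _*_ (∑-all U) (∑-all W)
    factor : ∀ M k → M * k + k ≡ (M + 1ℤ) * k
    factor = solve-∀

  module _ {M φ₁ φ₂ : ℤ} {U : List A} {X : List B} {Y : List C} {a b}
           (1≤M : 1ℤ ≤ M) (0≤φ₁ : 0ℤ ≤ φ₁)
           (reg₁ : Regular M φ₁ U X a) (reg₂ : Regular M φ₂ U Y b)
           (s : A → Bool) (p : B → C → Bool) where

    private
      0≤M = ≤-trans 0≤+n 1≤M
      volume = # U * # X * # Y
      main = φ₁ * φ₂ * (∑ U (𝟙 ∘ s) * ∑₂ X Y (λ v w → 𝟙 (p v w)))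

      -- The first error carries the factor M and the second φ₁ ≤ M + 1 ≤ 2M, which together give
      -- the 3.
      errors : ∀ D₁ D₂ → D₁ ≤ # Y * (# U * # X) → D₂ ≤ # X * (# U * # Y) →
        M * D₁ + φ₁ * D₂ ≤ + 3 * M * volume
      errors D₁ D₂ le₁ le₂ = begin
        M * D₁ + φ₁ * D₂
          ≤⟨ +-mono-≤ (*-monoˡ 0≤M le₁) (*-monoˡ 0≤φ₁ le₂) ⟩
        M * (# Y * (# U * # X)) + φ₁ * (# X * (# U * # Y))
          ≡⟨ regroup M φ₁ (# U) (# X) (# Y) ⟩
        M * volume + φ₁ * (# U * # X) * # Y
          ≤⟨ ℤP.+-monoʳ-≤ (M * volume) (*-monoʳ (0≤# Y) (Regular⇒density≤ 0≤M reg₁)) ⟩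
        M * volume + (M + 1ℤ) * (# U * # X) * # Y
          ≤⟨ ≤-by _ (0≤* (0≤b-a 1≤M) (0≤* (0≤* (0≤# U) (0≤# X)) (0≤# Y)))
               (slack M (# U) (# X) (# Y)) ⟩
        + 3 * M * volume ∎
        where
        open ≤-Reasoning
        regroup : ∀ M φ u x y → M * (y * (u * x)) + φ * (x * (u * y)) ≡ M * (u * x * y) + φ * (u * x) * y
        regroup = solve-∀
        slack : ∀ M u x y → + 3 * M * (u * x * y) ≡
          (M * (u * x * y) + (M + 1ℤ) * (u * x) * y) + (M - 1ℤ) * (u * x * y)
        slack = solve-∀

    cherries-upper : M * M * cherries U X Y a b s p ≤ main + + 3 * M * volume
    cherries-upper = ≤-trans (≤-reflexive (cherries-identity M φ₁ φ₂ U X Y a b s p))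
      (ℤP.+-monoʳ-≤ main (errors _ _
        (∑-bounded Y (λ w → proj₁ (bound reg₁ (λ u → s u ∧ b u w) (λ v → p v w))))
        (∑-bounded X (λ v → proj₁ (bound reg₂ s (p v))))))

    cherries-lower : main ≤ M * M * cherries U X Y a b s p + + 3 * M * volume
    cherries-lower = ≤-by _
      (0≤b-a (errors _ _
        (≤-trans (≤-reflexive (∑-neg Y _))
          (∑-bounded Y (λ w → proj₂ (bound reg₁ (λ u → s u ∧ b u w) (λ v → p v w)))))
        (≤-trans (≤-reflexive (∑-neg X _)) (∑-bounded X (λ v → proj₂ (bound reg₂ s (p v)))))))
      (trans (cong (_+ + 3 * M * volume) (cherries-identity M φ₁ φ₂ U X Y a b s p))
        (rearrange M φ₁ main _ _ (+ 3 * M * volume)))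
      where
      rearrange : ∀ M φ m d₁ d₂ k →
        (m + (M * d₁ + φ * d₂)) + k ≡ m + (k - (M * (- d₁) + φ * (- d₂)))
      rearrange = solve-∀

  -- ⟨1/N⟩-regularity of a bigraph, with the denominators cleared.
  record HalfRegular (N : ℤ) (U : List A) (W : List B) (E : A → B → Bool) : Set where
    constructor halfRegular
    field
      inherits : ∀ s t → # U ≤ N * ∑ U (𝟙 ∘ s) → # W ≤ N * ∑ W (𝟙 ∘ t) →
        edges U W E all all * (∑ U (𝟙 ∘ s) * ∑ W (𝟙 ∘ t)) ≤ + 2 * (edges U W E s t * (# U * # W))

  open HalfRegular public

  *-cancelˡ : ∀ {c a b} → 1ℤ ≤ c → c * a ≤ c * b → a ≤ b
  *-cancelˡ {+ zero}  (+≤+ ()) _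
  *-cancelˡ {+ suc n} _        = ℤP.*-cancelˡ-≤-pos _ _ (+ suc n)

  0≤∑𝟙 : ∀ (xs : List A) (s : A → Bool) → 0ℤ ≤ ∑ xs (𝟙 ∘ s)
  0≤∑𝟙 xs s = ∑-nonneg xs (λ x → 0≤𝟙 (s x))

  ∑𝟙≤# : ∀ (xs : List A) (s : A → Bool) → ∑ xs (𝟙 ∘ s) ≤ # xs
  ∑𝟙≤# xs s = ≤-trans (∑-mono xs (λ x → 𝟙≤1 (s x))) (≤-reflexive (sym (#≡∑1 xs)))

  HalfRegular-cong : ∀ {N} {U : List A} {W : List B} {E E′} →
    (∀ s t → edges U W E s t ≡ edges U W E′ s t) → HalfRegular N U W E′ → HalfRegular N U W E
  HalfRegular-cong {U = U} {W} eq half = halfRegular λ s t hs ht →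
    subst₂ (λ e e′ → e * (∑ U (𝟙 ∘ s) * ∑ W (𝟙 ∘ t)) ≤ + 2 * (e′ * (# U * # W)))
      (sym (eq all all)) (sym (eq s t)) (inherits half s t hs ht)

  edges-cong-All : ∀ {U : List A} {W : List B} {E E′ : A → B → Bool} →
    All (λ u → All (λ w → E u w ≡ E′ u w) W) U → ∀ s t → edges U W E s t ≡ edges U W E′ s t
  edges-cong-All eqs s t =
    ∑-cong-All (All.map (λ {u} eqs′ → ∑-cong-All (All.map (λ {w} eq → cong (λ b → 𝟙 (s u) * 𝟙 (t w) * 𝟙 b) eq) eqs′)) eqs)

  edges-transpose : ∀ (U : List A) (W : List B) E s t →
    edges W U (λ w u → E u w) t s ≡ edges U W E s t
  edges-transpose U W E s t = trans (∑-swap W U _)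
    (∑₂-cong U W (λ u w → cong (_* 𝟙 (E u w)) (ℤP.*-comm (𝟙 (t w)) (𝟙 (s u)))))

  HalfRegular-transpose : ∀ {N} {U : List A} {W : List B} {E} →
    HalfRegular N U W E → HalfRegular N W U (λ w u → E u w)
  HalfRegular-transpose {U = U} {W} {E} half = halfRegular λ t s ht hs →
    subst₂ _≤_
      (cong₂ _*_ (sym (edges-transpose U W E all all)) (ℤP.*-comm (∑ U (𝟙 ∘ s)) _))
      (cong (_*_ (+ 2)) (cong₂ _*_ (sym (edges-transpose U W E s t)) (ℤP.*-comm (# U) (# W))))
      (inherits half s t hs ht)

  HalfRegular-empty : ∀ {N} {U : List A} {W : List B} → HalfRegular N U W (λ _ _ → false)
  HalfRegular-empty {N = N} {U} {W} = halfRegular λ s t _ _ →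
    subst₂ (λ e e′ → e * (∑ U (𝟙 ∘ s) * ∑ W (𝟙 ∘ t)) ≤ + 2 * (e′ * (# U * # W)))
      (sym (no-edges all all)) (sym (no-edges s t)) ≤-refl
    where
    no-edges : ∀ s t → edges U W (λ _ _ → false) s t ≡ 0ℤ
    no-edges s t = trans (∑₂-cong U W (λ u w → ℤP.*-zeroʳ (𝟙 (s u) * 𝟙 (t w))))
      (trans (∑-cong U (λ _ → ∑-zero W)) (∑-zero U))

  HalfRegular-full : ∀ {N} {U : List A} {W : List B} → HalfRegular N U W (λ _ _ → true)
  HalfRegular-full {N = N} {U} {W} = halfRegular λ s t _ _ →
    subst₂ (λ e e′ → e * (∑ U (𝟙 ∘ s) * ∑ W (𝟙 ∘ t)) ≤ + 2 * (e′ * (# U * # W)))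
      (sym (trans (all-edges all all) (cong₂ _*_ (∑-all U) (∑-all W)))) (sym (all-edges s t))
      (≤-by _ (0≤* (0≤* (0≤# U) (0≤# W)) (0≤* (0≤∑𝟙 U s) (0≤∑𝟙 W t)))
        (double (# U * # W) (∑ U (𝟙 ∘ s) * ∑ W (𝟙 ∘ t))))
    where
    all-edges : ∀ s t → edges U W (λ _ _ → true) s t ≡ ∑ U (𝟙 ∘ s) * ∑ W (𝟙 ∘ t)
    all-edges s t = trans (∑₂-cong U W (λ u w → ℤP.*-identityʳ (𝟙 (s u) * 𝟙 (t w)))) (∑₂-product U W _ _)
    double : ∀ k k′ → + 2 * (k′ * k) ≡ k * k′ + k * k′
    double = solve-∀

  -- In units of 1/M, the discrepancy costs at most N² of density on a rectangle with at least k/N²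
  -- pairs, and at most 1 on the whole bigraph. Half of the density survives because 2(φ - N²) ≥ φ +
  -- 1.
  Regular⇒HalfRegular : ∀ {M N φ} {U : List A} {W : List B} {E} →
    1ℤ ≤ M → 0ℤ ≤ N → + 2 * (N * N) ≤ φ - 1ℤ → Regular M φ U W E → HalfRegular N U W E
  Regular⇒HalfRegular {M = M} {N} {φ} {U} {W} {E} 1≤M 0≤N large reg = halfRegular λ s t hs ht →
    let u′ = ∑ U (𝟙 ∘ s)
        w′ = ∑ W (𝟙 ∘ t)
        k  = # U * # W
        k′ = u′ * w′
        e  = edges U W E all all
        e′ = edges U W E s t
        0≤k  = 0≤* (0≤# U) (0≤# W)
        0≤k′ = 0≤* (0≤∑𝟙 U s) (0≤∑𝟙 W t)
        k≤ : k ≤ N * u′ * (N * w′)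
        k≤ = *-mono (0≤# U) (0≤* 0≤N (0≤∑𝟙 W t)) hs ht
        upper : M * e ≤ φ * k + k
        upper = subst (λ z → M * e ≤ φ * z + k) (cong₂ _*_ (∑-all U) (∑-all W)) (Regular-upper reg all all)
        lower : φ * k′ ≤ M * e′ + k
        lower = Regular-lower reg s t
    in *-cancelˡ 1≤M (≤-by _
         (0≤+ (0≤+ (0≤* (0≤b-a upper) 0≤k′) (0≤* (0≤+n {2}) (0≤* (0≤b-a lower) 0≤k)))
           (0≤* 0≤k (0≤+ (0≤* (0≤b-a large) 0≤k′) (0≤* (0≤+n {2}) (0≤b-a k≤)))))
         (certificate M N φ u′ w′ k e e′))
    where
    certificate : ∀ M N φ u w k e e′ →
      M * (+ 2 * (e′ * k)) ≡ M * (e * (u * w)) +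
        ((φ * k + k - M * e) * (u * w) + + 2 * ((M * e′ + k - φ * (u * w)) * k)
          + k * ((φ - 1ℤ - + 2 * (N * N)) * (u * w) + + 2 * (N * u * (N * w) - k)))
    certificate = solve-∀

  -- The error terms of the cherry counts are absorbed by the main terms as soon as
  -- the densities φ₁/M, φ₂/M and that of the pairs are at least about h/M.
  cherry-arithmetic : ∀ {M N h φ₁ φ₂ u u′ p p′ q q′ x S S′ : ℤ} →
    1ℤ ≤ M → 1ℤ ≤ N → 0ℤ ≤ h → + 18 * (M * M) * (N * N) ≤ h * h * (h - 1ℤ) →
    h ≤ φ₁ → h ≤ φ₂ →
    0ℤ ≤ u → 0ℤ ≤ u′ → 0ℤ ≤ p → 0ℤ ≤ p′ → 0ℤ ≤ x →
    u ≤ N * u′ → u′ ≤ u → p ≤ N * p′ → p′ ≤ p →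
    (h - 1ℤ) * x ≤ M * p → q ≤ p → + 3 * p′ ≤ + 4 * q′ →
    M * M * S ≤ φ₁ * φ₂ * (u * q) + + 3 * M * (u * x) →
    φ₁ * φ₂ * (u′ * q′) ≤ M * M * S′ + + 3 * M * (u * x) →
    S * (u′ * p′) ≤ + 2 * (S′ * (u * p))
  cherry-arithmetic {M} {N} {h} {φ₁} {φ₂} {u} {u′} {p} {p′} {q} {q′} {x} {S} {S′}
    1≤M 1≤N 0≤h const h≤φ₁ h≤φ₂ 0≤u 0≤u′ 0≤p 0≤p′ 0≤x u≤ u′≤u p≤ p′≤p dense q≤p q′≥ upper lower =
    -- After scaling by 2M² the lower count enters with factor 4 and the upper count with factor 2.
    -- By q′ ≥ 3p′/4 and q ≤ p the main terms leave (3 - 2)φ₁φ₂·u′p′·up, and the errors add up to at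
    -- most (12 + 6)M·ux·up; hence the 18.
    *-cancelˡ {+ 2 * (M * M)} 1≤2MM (≤-by _
      (0≤+ (0≤* (0≤+n {4}) (0≤* (0≤b-a lower) (0≤* 0≤u 0≤p)))
      (0≤+ (0≤* (0≤+n {2}) (0≤* (0≤b-a upper) (0≤* 0≤u′ 0≤p′)))
      (0≤+ (0≤* 0≤φφ (0≤* (0≤* 0≤u 0≤p) (0≤* 0≤u′ (0≤b-a q′≥))))
      (0≤+ (0≤* (0≤+n {2}) (0≤* 0≤φφ (0≤* (0≤* 0≤u 0≤u′) (0≤* 0≤p′ (0≤b-a q≤p)))))
      (0≤+ (0≤* (0≤b-a key) (0≤* 0≤u 0≤p))
           (0≤* (0≤* (0≤+n {6}) (0≤* 0≤M (0≤* 0≤u 0≤x))) (0≤b-a (*-mono 0≤u′ 0≤p u′≤u p′≤p))))))))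
      (final M (φ₁ * φ₂) u u′ p p′ q q′ x S S′))
    where
    0≤M = ≤-trans 0≤+n 1≤M
    0≤N = ≤-trans 0≤+n 1≤N
    0≤φ₁ = ≤-trans 0≤h h≤φ₁
    0≤φ₂ = ≤-trans 0≤h h≤φ₂
    0≤φφ = 0≤* 0≤φ₁ 0≤φ₂
    1≤MM : 1ℤ ≤ M * M
    1≤MM = *-mono {1ℤ} {M} {1ℤ} {M} 0≤+n 0≤M 1≤M 1≤M
    1≤2MM : 1ℤ ≤ + 2 * (M * M)
    1≤2MM = *-mono {1ℤ} {+ 2} {1ℤ} {M * M} 0≤+n (0≤* 0≤M 0≤M) (+≤+ (ℕ.s≤s ℕ.z≤n)) 1≤MM
    1≤MNN : 1ℤ ≤ M * (N * N)
    1≤MNN = *-mono {1ℤ} {M} {1ℤ} {N * N} 0≤+n (0≤* 0≤N 0≤N) 1≤M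
      (*-mono {1ℤ} {N} {1ℤ} {N} 0≤+n 0≤N 1≤N 1≤N)
    key-certificate : ∀ M N h u u′ p p′ x →
      M * (N * N) * (h * h * (u′ * p′)) ≡ M * (N * N) * (+ 18 * M * (u * x)) +
        ((h * h * (h - 1ℤ) - + 18 * (M * M) * (N * N)) * (u * x)
         + (h * h * (u * (M * p - (h - 1ℤ) * x)) + h * h * (M * (N * u′ * (N * p′) - u * p))))
    key-certificate = solve-∀
    -- The bounds u′ ≥ u/N, p′ ≥ p/N and p/x ≥ (h - 1)/M reduce this to `const`, which says that the
    -- product of three minimal densities h/M is at least about 18N²/M.
    key₀ : + 18 * M * (u * x) ≤ h * h * (u′ * p′)
    key₀ = *-cancelˡ 1≤MNN (≤-by _
      (0≤+ (0≤* (0≤b-a const) (0≤* 0≤u 0≤x))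
      (0≤+ (0≤* (0≤* 0≤h 0≤h) (0≤* 0≤u (0≤b-a dense)))
           (0≤* (0≤* 0≤h 0≤h) (0≤* 0≤M (0≤b-a (*-mono 0≤u (0≤* 0≤N 0≤p′) u≤ p≤))))))
      (key-certificate M N h u u′ p p′ x))
    key : + 18 * M * (u * x) ≤ φ₁ * φ₂ * (u′ * p′)
    key = ≤-trans key₀ (*-monoʳ (0≤* 0≤u′ 0≤p′) (*-mono 0≤h 0≤φ₂ h≤φ₁ h≤φ₂))
    final : ∀ M φ u u′ p p′ q q′ x S S′ →
      + 2 * (M * M) * (+ 2 * (S′ * (u * p))) ≡ + 2 * (M * M) * (S * (u′ * p′)) +
        (+ 4 * ((M * M * S′ + + 3 * M * (u * x) - φ * (u′ * q′)) * (u * p))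
        + (+ 2 * ((φ * (u * q) + + 3 * M * (u * x) - M * M * S) * (u′ * p′))
        + (φ * (u * p * (u′ * (+ 4 * q′ - + 3 * p′)))
        + (+ 2 * (φ * (u * u′ * (p′ * (p - q))))
        + ((φ * (u′ * p′) - + 18 * M * (u * x)) * (u * p)
        + + 6 * (M * (u * x)) * (u * p - u′ * p′))))))
    final = solve-∀

  -- The selector `c` cuts the part out of X × Y and `g` is the third edge of the triangle. Keeping
  -- them apart covers two cases at once: `c` equal to `g` for a split pair, and `c` constantly true
  -- for an undivided, nearly complete one. The maps `ι` and `κ` embed the three classes into the
  -- vertex set of the bigraph.
  module _ {D : Set} {M N h φ₁ φ₂ : ℤ} {U : List A} {X : List B} {Y : List C} {a b}
           {ι : A → D} {κ : B → C → D} {c g : B → C → Bool} {U⁺ P⁺ : List D} {F : D → D → Bool}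
           (1≤M : 1ℤ ≤ M) (1≤N : 1ℤ ≤ N) (0≤h : 0ℤ ≤ h)
           (const : + 18 * (M * M) * (N * N) ≤ h * h * (h - 1ℤ))
           (h≤φ₁ : h ≤ φ₁) (h≤φ₂ : h ≤ φ₂)
           (reg₁ : Regular M φ₁ U X a) (reg₂ : Regular M φ₂ U Y b)
           (sumU : ∀ f → ∑ U⁺ f ≡ ∑ U (f ∘ ι))
           (sumP : ∀ f → ∑ P⁺ f ≡ ∑₂ X Y (λ v w → 𝟙 (c v w) * f (κ v w)))
           (F-cherry : ∀ u v w → F (ι u) (κ v w) ≡ a u v ∧ (b u w ∧ g v w))
           (dense : (h - 1ℤ) * (# X * # Y) ≤ M * # P⁺)
           (mostly-g : ∀ t → # P⁺ ≤ N * ∑ P⁺ (𝟙 ∘ t) →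
             + 3 * ∑ P⁺ (𝟙 ∘ t) ≤ + 4 * ∑₂ X Y (λ v w → 𝟙 (c v w ∧ (g v w ∧ t (κ v w)))))
           where

    private
      p : (D → Bool) → B → C → Bool
      p t v w = c v w ∧ (g v w ∧ t (κ v w))

      edges≡cherries : ∀ s t → edges U⁺ P⁺ F s t ≡ cherries U X Y a b (s ∘ ι) (p t)
      edges≡cherries s t = trans (sumU _) (∑-cong U (λ u → trans (sumP _) (∑₂-cong X Y (pointwise u))))
        where
        regroup : ∀ c s t a b g → c * (s * t * (a * (b * g))) ≡ s * (c * (g * t)) * (a * b)
        regroup = solve-∀
        pointwise : ∀ u v w → 𝟙 (c v w) * (𝟙 (s (ι u)) * 𝟙 (t (κ v w)) * 𝟙 (F (ι u) (κ v w)))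
          ≡ 𝟙 (s (ι u)) * 𝟙 (p t v w) * (𝟙 (a u v) * 𝟙 (b u w))
        pointwise u v w
          rewrite F-cherry u v w | 𝟙-∧ (c v w) (g v w ∧ t (κ v w)) | 𝟙-∧ (g v w) (t (κ v w))
                | 𝟙-∧ (a u v) (b u w ∧ g v w) | 𝟙-∧ (b u w) (g v w)
          = regroup (𝟙 (c v w)) (𝟙 (s (ι u))) (𝟙 (t (κ v w))) (𝟙 (a u v)) (𝟙 (b u w)) (𝟙 (g v w))

      #U⁺ : # U⁺ ≡ # U
      #U⁺ = trans (#≡∑1 U⁺) (trans (sumU _) (sym (#≡∑1 U)))

      q≤p : ∀ t → ∑₂ X Y (λ v w → 𝟙 (p t v w)) ≤ # P⁺
      q≤p t = ≤-trans (∑₂-mono X Y (λ v w →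
          ≤-trans (≤-reflexive (𝟙-∧ (c v w) _)) (*-monoˡ (0≤𝟙 (c v w)) (𝟙≤1 (g v w ∧ t (κ v w))))))
        (≤-reflexive (sym (trans (#≡∑1 P⁺) (sumP _))))

    cherries-HalfRegular : HalfRegular N U⁺ P⁺ F
    cherries-HalfRegular = halfRegular λ s t hs ht →
      let u′≡ = sumU (𝟙 ∘ s)
      in subst₂ _≤_ (cong (_* (∑ U⁺ (𝟙 ∘ s) * ∑ P⁺ (𝟙 ∘ t))) (sym (edges≡cherries all all)))
        (cong (λ z → + 2 * (z * (# U⁺ * # P⁺))) (sym (edges≡cherries s t)))
        (cherry-arithmetic {M} {N} {h} {φ₁} {φ₂} {# U⁺} {_} {# P⁺} {_}
          {∑₂ X Y (λ v w → 𝟙 (p all v w))} {∑₂ X Y (λ v w → 𝟙 (p t v w))} {# X * # Y}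
          1≤M 1≤N 0≤h const h≤φ₁ h≤φ₂ (0≤# U⁺) (0≤∑𝟙 U⁺ s) (0≤# P⁺) (0≤∑𝟙 P⁺ t)
          (0≤* (0≤# X) (0≤# Y)) hs (∑𝟙≤# U⁺ s) ht (∑𝟙≤# P⁺ t) dense (q≤p all) (mostly-g t ht)
          (subst₂ (λ σ v → M * M * cherries U X Y a b (λ _ → true) (p all) ≤
                     φ₁ * φ₂ * (σ * ∑₂ X Y (λ v w → 𝟙 (p all v w))) + + 3 * M * v)
            (trans (∑-all U) (sym #U⁺)) volume
            (cherries-upper 1≤M (≤-trans 0≤h h≤φ₁) reg₁ reg₂ (λ _ → true) (p all)))
          (subst₂ (λ σ v → φ₁ * φ₂ * (σ * ∑₂ X Y (λ v w → 𝟙 (p t v w)))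
                     ≤ M * M * cherries U X Y a b (s ∘ ι) (p t) + + 3 * M * v)
            (sym u′≡) volume
            (cherries-lower 1≤M (≤-trans 0≤h h≤φ₁) reg₁ reg₂ (s ∘ ι) (p t))))
      where
      volume : # U * # X * # Y ≡ # U⁺ * (# X * # Y)
      volume = trans (ℤP.*-assoc (# U) (# X) (# Y)) (cong (_* (# X * # Y)) (sym #U⁺))

  -- If the density of g on X × Y is close to 1, the non-edges of g are negligible
  -- in every large set of pairs, so that X × Y may stay in one piece.
  module _ {M φ : ℤ} {X : List B} {Y : List C} {g : B → C → Bool}
           (1≤M : 1ℤ ≤ M) (reg : Regular M φ X Y g) where

    private
      k = # X * # Y
      0≤k = 0≤* (0≤# X) (0≤# Y)
      edges-all : edges X Y g all all ≡ ∑₂ X Y (λ v w → 𝟙 (g v w))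
      edges-all = ∑₂-cong X Y (λ v w → ℤP.*-identityˡ (𝟙 (g v w)))
      lower : φ * k ≤ M * ∑₂ X Y (λ v w → 𝟙 (g v w)) + k
      lower = subst₂ (λ z e → φ * z ≤ M * e + k)
        (cong₂ _*_ (∑-all X) (∑-all Y)) edges-all (Regular-lower reg all all)

    nearly-complete : ∀ {N h} → 0ℤ ≤ h → + 4 * (h * N) ≤ M → M - h < φ → (t : B → C → Bool) →
      k ≤ N * ∑₂ X Y (λ v w → 𝟙 (t v w)) →
      + 3 * ∑₂ X Y (λ v w → 𝟙 (t v w)) ≤ + 4 * ∑₂ X Y (λ v w → 𝟙 (g v w ∧ t v w))
    -- With p the number of pairs in `t`, regularity and φ > M - h leave at most hk/M non-edges;
    -- this is at most hNp/M ≤ p/4 by k ≤ Np and 4hN ≤ M.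
    nearly-complete {N} {h} 0≤h 4hN≤M high t k≤ = *-cancelˡ 1≤M (≤-by _
      (0≤+ (0≤* (0≤+n {4}) (0≤* (≤-trans 0≤+n 1≤M) (0≤b-a missing)))
      (0≤+ (0≤* (0≤+n {4}) (0≤b-a lower))
      (0≤+ (0≤* (0≤+n {4}) (0≤* (0≤b-a (ℤP.i<j⇒suc[i]≤j high)) 0≤k))
      (0≤+ (0≤* (0≤+n {4}) (0≤* 0≤h (0≤b-a k≤)))
           (0≤* (0≤b-a 4hN≤M) (∑₂-nonneg X Y (λ v w → 0≤𝟙 (t v w))))))))
      (certificate M N h φ k _ _ _))
      where
      missing : ∑₂ X Y (λ v w → 𝟙 (t v w)) + ∑₂ X Y (λ v w → 𝟙 (g v w)) ≤
                ∑₂ X Y (λ v w → 𝟙 (g v w ∧ t v w)) + k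
      missing = begin
        ∑₂ X Y (λ v w → 𝟙 (t v w)) + ∑₂ X Y (λ v w → 𝟙 (g v w))
          ≡⟨ sym (∑₂-+ X Y _ _) ⟩
        ∑₂ X Y (λ v w → 𝟙 (t v w) + 𝟙 (g v w))
          ≤⟨ ∑₂-mono X Y (λ v w → inclusion-exclusion (t v w) (g v w)) ⟩
        ∑₂ X Y (λ v w → 𝟙 (g v w ∧ t v w) + 1ℤ)
          ≡⟨ trans (∑₂-+ X Y _ _) (cong (_+_ (∑₂ X Y (λ v w → 𝟙 (g v w ∧ t v w)))) (∑₂-one X Y)) ⟩
        ∑₂ X Y (λ v w → 𝟙 (g v w ∧ t v w)) + k ∎
        where
        open ≤-Reasoning
        inclusion-exclusion : ∀ t g → 𝟙 t + 𝟙 g ≤ 𝟙 (g ∧ t) + 1ℤ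
        inclusion-exclusion true  true  = ≤-refl
        inclusion-exclusion true  false = ≤-refl
        inclusion-exclusion false true  = ≤-refl
        inclusion-exclusion false false = 0≤+n
      certificate : ∀ M N h φ k p e q → M * (+ 4 * q) ≡ M * (+ 3 * p) +
        (+ 4 * (M * (q + k - (p + e)))
        + (+ 4 * (M * e + k - φ * k)
        + (+ 4 * ((φ - (1ℤ + (M - h))) * k)
        + (+ 4 * (h * (N * p - k))
        + (M - + 4 * (h * N)) * p))))
      certificate = solve-∀

    Regular⇒dense : ∀ {h} → h ≤ φ → (h - 1ℤ) * k ≤ M * ∑₂ X Y (λ v w → 𝟙 (g v w))
    Regular⇒dense {h} h≤φ = ≤-by _ (0≤+ (0≤* (0≤b-a h≤φ) 0≤k) (0≤b-a lower)) (certificate M h φ k _)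
      where
      certificate : ∀ M h φ k e → M * e ≡ (h - 1ℤ) * k + ((φ - h) * k + (M * e + k - φ * k))
      certificate = solve-∀

  -- Grouping a sum over the vertices by cells

  ∑-allFin-suc : ∀ {k} (f : Fin (suc k) → ℤ) →
    ∑ (allFin (suc k)) f ≡ f zero + ∑ (allFin k) (f ∘ suc)
  ∑-allFin-suc {k} f = cong (_+_ (f zero))
    (trans (cong (λ xs → ∑ xs f) (sym (map-tabulate (λ i → i) suc))) (∑-map suc (allFin k) f))

  ∑-delta : ∀ {k} (i : Fin k) (f : Fin k → ℤ) →
    ∑ (allFin k) (λ j → 𝟙 (does (i ≟F j)) * f j) ≡ f i
  ∑-delta {suc k} zero f = trans (∑-allFin-suc (λ j → 𝟙 (does (zero ≟F j)) * f j))
    (trans (cong₂ _+_ (ℤP.*-identityˡ (f zero)) (∑-zero (allFin k))) (ℤP.+-identityʳ (f zero)))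
  ∑-delta {suc k} (suc i) f = trans (∑-allFin-suc (λ j → 𝟙 (does (suc i ≟F j)) * f j))
    (trans (ℤP.+-identityˡ _) (∑-delta i (f ∘ suc)))

  ∑-cells : ∀ (V : List A) {k} (lab : A → Fin k) (f : Fin k → A → ℤ) →
    ∑ (allFin k) (λ X → ∑ (part _≟F_ V lab X) (f X)) ≡ ∑ V (λ x → f (lab x) x)
  ∑-cells V {k} lab f = begin
    ∑ (allFin k) (λ X → ∑ (part _≟F_ V lab X) (f X))
      ≡⟨ ∑-cong (allFin k) (λ X → ∑-filter (λ v → lab v ≟F X) V (f X)) ⟩
    ∑ (allFin k) (λ X → ∑ V (λ x → 𝟙 (does (lab x ≟F X)) * f X x))
      ≡⟨ ∑-swap (allFin k) V _ ⟩
    ∑ V (λ x → ∑ (allFin k) (λ X → 𝟙 (does (lab x ≟F X)) * f X x))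
      ≡⟨ ∑-cong V (λ x → ∑-delta (lab x) (λ X → f X x)) ⟩
    ∑ V (λ x → f (lab x) x) ∎
    where open ≡-Reasoning

  ∑₂-cells : ∀ (V : List A) {k} (lab : A → Fin k) (f : Fin k → Fin k → A → A → ℤ) →
    ∑₂ (allFin k) (allFin k) (λ X Y → ∑₂ (part _≟F_ V lab X) (part _≟F_ V lab Y) (f X Y))
      ≡ ∑₂ V V (λ x y → f (lab x) (lab y) x y)
  ∑₂-cells V {k} lab f = begin
    ∑₂ (allFin k) (allFin k) (λ X Y → ∑₂ (cell X) (cell Y) (f X Y))
      ≡⟨ ∑-cong (allFin k) (λ X → ∑-swap (allFin k) (cell X) _) ⟩
    ∑ (allFin k) (λ X → ∑ (cell X) (λ x → ∑ (allFin k) (λ Y → ∑ (cell Y) (f X Y x))))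
      ≡⟨ ∑-cong (allFin k) (λ X → ∑-cong (cell X) (λ x → ∑-cells V lab (λ Y → f X Y x))) ⟩
    ∑ (allFin k) (λ X → ∑ (cell X) (λ x → ∑ V (λ y → f X (lab y) x y)))
      ≡⟨ ∑-cells V lab _ ⟩
    ∑₂ V V (λ x y → f (lab x) (lab y) x y) ∎
    where
    open ≡-Reasoning
    cell = part _≟F_ V lab

  ∑₂-cells-mono : ∀ (V : List A) {k} (lab : A → Fin k) (f f′ : Fin k → Fin k → A → A → ℤ) →
    (∀ X Y → ∑₂ (part _≟F_ V lab X) (part _≟F_ V lab Y) (f X Y) ≤
             ∑₂ (part _≟F_ V lab X) (part _≟F_ V lab Y) (f′ X Y)) →
    ∑₂ V V (λ x y → f (lab x) (lab y) x y) ≤ ∑₂ V V (λ x y → f′ (lab x) (lab y) x y)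
  ∑₂-cells-mono V {k} lab f f′ le = subst₂ _≤_ (∑₂-cells V lab f) (∑₂-cells V lab f′)
    (∑₂-mono (allFin k) (allFin k) le)

  -- Tower functions

  n≤n*2^n : ∀ n → n ℕ.≤ n ℕ.* 2 ℕ.^ n
  n≤n*2^n n = ℕP.m≤m*n n (2 ℕ.^ n) ⦃ ℕP.m^n≢0 2 n ⦄

  Tsh-mono : ∀ m {i j} → i ℕ.≤ j → Tsh m i ℕ.≤ Tsh m j
  Tsh-mono m {i} i≤j = go (ℕP.≤⇒≤′ i≤j)
    where
    go : ∀ {j} → i ℕ.≤′ j → Tsh m i ℕ.≤ Tsh m j
    go ℕ.≤′-refl = ℕP.≤-refl
    go (ℕ.≤′-step {j} i≤j) = ℕP.≤-trans (go i≤j) (n≤n*2^n (Tsh m j))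

  -- One level of the tower provides k·2^k. The second factor 2^k is absorbed by the next level, so
  -- a round of refinement costs two levels.
  refinement-size : ∀ m j {k} → k ℕ.≤ Tsh m j → k ℕ.* (2 ℕ.^ k ℕ.* 2 ℕ.^ k) ℕ.≤ Tsh m (2 ℕ.+ j)
  refinement-size m j {k} k≤ = begin
    k ℕ.* (2 ℕ.^ k ℕ.* 2 ℕ.^ k)   ≡⟨ sym (ℕP.*-assoc k _ _) ⟩
    k ℕ.* 2 ℕ.^ k ℕ.* 2 ℕ.^ k     ≤⟨ ℕP.*-mono-≤ (ℕP.*-mono-≤ k≤ (ℕP.^-monoʳ-≤ 2 k≤))
                                       (ℕP.^-monoʳ-≤ 2 (ℕP.≤-trans k≤ (n≤n*2^n (Tsh m j)))) ⟩
    Tsh m (2 ℕ.+ j)               ∎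
    where open ℕP.≤-Reasoning

  -- Encoding two bits per cell into a new label

  bit : Bool → Fin 2
  bit false = zero
  bit true  = suc zero

  unbit : Fin 2 → Bool
  unbit zero       = false
  unbit (suc zero) = true

  unbit-bit : ∀ b → unbit (bit b) ≡ b
  unbit-bit false = refl
  unbit-bit true  = refl

  module Encoding (k : ℕ) where

    size = k ℕ.* (2 ℕ.^ k ℕ.* 2 ℕ.^ k)

    -- For a vertex of the cell X, `σ Y` will record membership in the left side of the witness for
    -- (X, Y), and `τ Y` membership in the right side of the witness for (Y, X). Ordered pairs have
    -- their own witnesses, hence the two masks.
    encode : Fin k → (Fin k → Bool) → (Fin k → Bool) → Fin size
    encode X σ τ = combine X (combine (funToFin (bit ∘ σ)) (funToFin (bit ∘ τ)))

    split : Fin size → Fin k × Fin (2 ℕ.^ k ℕ.* 2 ℕ.^ k)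
    split = remQuot {k} (2 ℕ.^ k ℕ.* 2 ℕ.^ k)

    base : Fin size → Fin k
    base P = proj₁ (split P)

    masks : Fin size → Fin (2 ℕ.^ k) × Fin (2 ℕ.^ k)
    masks P = remQuot {2 ℕ.^ k} (2 ℕ.^ k) (proj₂ (split P))

    leftMask rightMask : Fin size → Fin k → Bool
    leftMask  P Y = unbit (finToFun {2} {k} (proj₁ (masks P)) Y)
    rightMask P Y = unbit (finToFun {2} {k} (proj₂ (masks P)) Y)

    base-encode : ∀ X σ τ → base (encode X σ τ) ≡ X
    base-encode X σ τ = cong proj₁ (FinP.remQuot-combine {k} X _)

    masks-encode : ∀ X σ τ → masks (encode X σ τ) ≡ (funToFin (bit ∘ σ) , funToFin (bit ∘ τ))
    masks-encode X σ τ = trans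
      (cong (λ q → remQuot {2 ℕ.^ k} (2 ℕ.^ k) (proj₂ q)) (FinP.remQuot-combine {k} X _))
      (FinP.remQuot-combine {2 ℕ.^ k} (funToFin (bit ∘ σ)) _)

    leftMask-encode : ∀ X σ τ Y → leftMask (encode X σ τ) Y ≡ σ Y
    leftMask-encode X σ τ Y = trans
      (cong (λ q → unbit (finToFun {2} {k} (proj₁ q) Y)) (masks-encode X σ τ))
      (trans (cong unbit (FinP.finToFun-funToFin (bit ∘ σ) Y)) (unbit-bit (σ Y)))

    rightMask-encode : ∀ X σ τ Y → rightMask (encode X σ τ) Y ≡ τ Y
    rightMask-encode X σ τ Y = trans
      (cong (λ q → unbit (finToFun {2} {k} (proj₂ q) Y)) (masks-encode X σ τ))
      (trans (cong unbit (FinP.finToFun-funToFin (bit ∘ τ) Y)) (unbit-bit (τ Y)))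

  -- Szemerédi's regularity lemma.  Instead of the energy of a partition, the potential is the
  -- squared distance from M g to a step function φ with integer values; on a pair that
  -- is irregular with respect to φ, shifting φ by ±1 on a witnessing rectangle lowers it by |X||Y|.

  -- Exhaustive search replaces excluded middle in finding witnesses of irregularity. Masks are
  -- functions, so the predicate is asked to respect pointwise equality.
  Searchable : Set → Set₁
  Searchable A = ∀ {P : (A → Bool) → Set} → (∀ s → Dec (P s)) →
    (∀ {s s′} → (∀ x → s x ≡ s′ x) → P s → P s′) → Dec (∃ P)

  -- The right side of `gain` is the drop of the sum of (M·E - φ)² when `shift` is added to φ on the
  -- rectangle. A regular pair gets the shift 0, so that one formula can be summed over all pairs.
  record Correction (M φ : ℤ) (U : List A) (W : List B) (E : A → B → Bool) : Set where
    field
      bad        : Bool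
      left       : A → Bool
      right      : B → Bool
      shift      : ℤ
      good       : bad ≡ false → Regular M φ U W E
      gain       : 𝟙 bad * (# U * # W) ≤
                   + 2 * shift * disc M φ U W E left right
                     - shift * shift * (∑ U (𝟙 ∘ left) * ∑ W (𝟙 ∘ right))

  disc-cong : ∀ M φ (U : List A) (W : List B) E {s s′ t t′} →
    (∀ u → s u ≡ s′ u) → (∀ w → t w ≡ t′ w) → disc M φ U W E s t ≡ disc M φ U W E s′ t′
  disc-cong M φ U W E eq eq′ =
    ∑₂-cong U W (λ u w → cong₂ (λ a b → 𝟙 a * 𝟙 b * (M * 𝟙 (E u w) - φ)) (eq u) (eq′ w))

  -- A violating rectangle has |disc| > k and at most k pairs. Shifting by one unit in the direction
  -- of the discrepancy therefore gains 2|disc| minus its number of pairs, which is at least k.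
  correction : Searchable A → Searchable B → ∀ M φ (U : List A) (W : List B) E → Correction M φ U W E
  correction searchA searchB M φ U W E = from (searchA (λ s → searchB (violated? s) (respects-t {s})) respects-s)
    where
    k = # U * # W
    Violated : _ → _ → Set
    Violated s t = k < disc M φ U W E s t ⊎ k < - disc M φ U W E s t
    violated? : ∀ s t → Dec (Violated s t)
    violated? s t = (k ℤP.<? disc M φ U W E s t) ⊎-dec (k ℤP.<? - disc M φ U W E s t)
    respects : ∀ {s s′ t t′} → (∀ u → s u ≡ s′ u) → (∀ w → t w ≡ t′ w) → Violated s t → Violated s′ t′
    respects eq eq′ = subst (λ d → k < d ⊎ k < - d) (disc-cong M φ U W E eq eq′)
    respects-t : ∀ {s t t′} → (∀ w → t w ≡ t′ w) → Violated s t → Violated s t′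
    respects-t {s} = respects {s = s} (λ _ → refl)
    respects-s : ∀ {s s′} → (∀ u → s u ≡ s′ u) → ∃ (Violated s) → ∃ (Violated s′)
    respects-s eq (t , v) = t , respects {t = t} eq (λ _ → refl) v
    rectangle≤ : ∀ s t → ∑ U (𝟙 ∘ s) * ∑ W (𝟙 ∘ t) ≤ k
    rectangle≤ s t = *-mono (0≤∑𝟙 U s) (0≤# W) (∑𝟙≤# U s) (∑𝟙≤# W t)
    positive : ∀ k d r → + 2 * 1ℤ * d - 1ℤ * 1ℤ * r ≡ 1ℤ * k + ((d - k) + (d - k) + (k - r))
    positive = solve-∀
    negative : ∀ k d r → + 2 * (- 1ℤ) * d - (- 1ℤ) * (- 1ℤ) * r ≡ 1ℤ * k + ((- d - k) + (- d - k) + (k - r))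
    negative = solve-∀
    none : ∀ k d r → + 2 * 0ℤ * d - 0ℤ * 0ℤ * r ≡ 0ℤ * k + 0ℤ
    none = solve-∀
    from : Dec (∃ λ s → ∃ (Violated s)) → Correction M φ U W E
    from (yes (s , t , inj₁ v)) = record
      { bad = true ; left = s ; right = t ; shift = 1ℤ ; good = λ ()
      ; gain = ≤-by _ (0≤+ (0≤+ (0≤b-a (ℤP.<⇒≤ v)) (0≤b-a (ℤP.<⇒≤ v))) (0≤b-a (rectangle≤ s t)))
                 (positive k (disc M φ U W E s t) (∑ U (𝟙 ∘ s) * ∑ W (𝟙 ∘ t))) }
    from (yes (s , t , inj₂ v)) = record
      { bad = true ; left = s ; right = t ; shift = - 1ℤ ; good = λ ()
      ; gain = ≤-by _ (0≤+ (0≤+ (0≤b-a (ℤP.<⇒≤ v)) (0≤b-a (ℤP.<⇒≤ v))) (0≤b-a (rectangle≤ s t)))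
                 (negative k (disc M φ U W E s t) (∑ U (𝟙 ∘ s) * ∑ W (𝟙 ∘ t))) }
    from (no ¬v) = record
      { bad = false ; left = all ; right = all ; shift = 0ℤ
      ; good = λ _ → regular λ s t →
          ℤP.≮⇒≥ (λ lt → ¬v (s , t , inj₁ lt)) , ℤP.≮⇒≥ (λ lt → ¬v (s , t , inj₂ lt))
      ; gain = ≤-by 0ℤ ≤-refl (none k (disc M φ U W E all all) (∑ U (𝟙 ∘ all) * ∑ W (𝟙 ∘ all))) }

  -- Irregular pairs of cells are weighed by the vertex pairs they carry, so cells may have any
  -- sizes. `K` is separate from `M` because the admissible share of irregular pairs will be
  -- 1/(54N), larger than the accuracy 1/M by the factor h.
  record RegularLabelling (M K : ℤ) (V : List A) (g : A → A → Bool) (size : ℕ)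
                          {k₀ : ℕ} (lab₀ : A → Fin k₀) : Set where
    field
      k          : ℕ
      lab        : A → Fin k
      φ          : Fin k → Fin k → ℤ
      reg        : Fin k → Fin k → Bool
      k≤size     : k ℕ.≤ size
      refines    : ∀ x y → lab x ≡ lab y → lab₀ x ≡ lab₀ y
      reg-sound  : ∀ X Y → reg X Y ≡ true → Regular M (φ X Y) (part _≟F_ V lab X) (part _≟F_ V lab Y) g
      few-bad    : K * ∑₂ V V (λ x y → 𝟙 (not (reg (lab x) (lab y)))) ≤ # V * # V

  module RegularityLemma {A : Set} (search : Searchable A) (V : List A) (g : A → A → Bool)
                         {M K : ℤ} (0≤K : 0ℤ ≤ K) where

    potential : ∀ {k} → (A → Fin k) → (Fin k → Fin k → ℤ) → ℤ
    potential lab φ = ∑₂ V V λ x y →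
      (M * 𝟙 (g x y) - φ (lab x) (lab y)) * (M * 𝟙 (g x y) - φ (lab x) (lab y))

    0≤square : ∀ a → 0ℤ ≤ a * a
    0≤square (+ n)      = 0≤* (0≤+n {n}) (0≤+n {n})
    0≤square (-[1+ n ]) = 0≤+n

    0≤potential : ∀ {k} (lab : A → Fin k) φ → 0ℤ ≤ potential lab φ
    0≤potential lab φ = ∑₂-nonneg V V (λ x y → 0≤square (M * 𝟙 (g x y) - φ (lab x) (lab y)))

    module Step {k : ℕ} (lab : A → Fin k) (φ : Fin k → Fin k → ℤ) where
      open Encoding k
      open Correction

      cell = part _≟F_ V lab

      corr : ∀ X Y → Correction M (φ X Y) (cell X) (cell Y) g
      corr X Y = correction search search M (φ X Y) (cell X) (cell Y) g

      badMass : ℤ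
      badMass = ∑₂ V V (λ x y → 𝟙 (bad (corr (lab x) (lab y))))

      lab⁺ : A → Fin size
      lab⁺ x = encode (lab x) (λ Y → left (corr (lab x) Y) x) (λ X → right (corr X (lab x)) x)

      shifted : Fin k → Fin k → Bool → Bool → ℤ
      shifted X Y a b = φ X Y + shift (corr X Y) * (𝟙 a * 𝟙 b)

      φ⁺ : Fin size → Fin size → ℤ
      φ⁺ P Q = shifted (base P) (base Q) (leftMask P (base Q)) (rightMask Q (base P))

      φ⁺-encode : ∀ X σ τ Y σ′ τ′ →
        φ⁺ (encode X σ τ) (encode Y σ′ τ′) ≡ shifted X Y (σ Y) (τ′ X)
      φ⁺-encode X σ τ Y σ′ τ′ = trans
        (cong₂ (λ X′ Y′ → shifted X′ Y′ (leftMask (encode X σ τ) Y′) (rightMask (encode Y σ′ τ′) X′))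
          (base-encode X σ τ) (base-encode Y σ′ τ′))
        (cong₂ (shifted X Y) (leftMask-encode X σ τ Y) (rightMask-encode Y σ′ τ′ X))

      refines⁺ : ∀ x y → lab⁺ x ≡ lab⁺ y → lab x ≡ lab y
      refines⁺ x y eq = trans (sym (base-encode (lab x) _ _)) (trans (cong base eq) (base-encode (lab y) _ _))

      decrease : Fin k → Fin k → A → A → ℤ
      decrease X Y x y = (+ 2 * shift c) * (𝟙 (left c x) * 𝟙 (right c y) * (M * 𝟙 (g x y) - φ X Y))
          + (- (shift c * shift c)) * (𝟙 (left c x) * 𝟙 (right c y))
        where c = corr X Y

      -- Expansion of the square at each vertex pair. Idempotence of the two indicators turns the
      -- quadratic term of the shift into a multiple of the indicator of the rectangle.
      potential-decrease : potential lab⁺ φ⁺ + ∑₂ V V (λ x y → decrease (lab x) (lab y) x y) ≡ potential lab φ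
      potential-decrease = trans (sym (∑₂-+ V V _ _)) (∑₂-cong V V pointwise)
        where
        square : ∀ b → 𝟙 b * 𝟙 b ≡ 𝟙 b
        square true  = refl
        square false = refl
        ring-identity : ∀ γ a b d φ → (d - (φ + γ * (a * b))) * (d - (φ + γ * (a * b)))
          + ((+ 2 * γ) * (a * b * (d - φ)) + (- (γ * γ)) * ((a * a) * (b * b))) ≡ (d - φ) * (d - φ)
        ring-identity = solve-∀
        pointwise : ∀ x y →
          (M * 𝟙 (g x y) - φ⁺ (lab⁺ x) (lab⁺ y)) * (M * 𝟙 (g x y) - φ⁺ (lab⁺ x) (lab⁺ y))
            + decrease (lab x) (lab y) x y
            ≡ (M * 𝟙 (g x y) - φ (lab x) (lab y)) * (M * 𝟙 (g x y) - φ (lab x) (lab y))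
        pointwise x y = let c = corr (lab x) (lab y) ; a = 𝟙 (left c x) ; b = 𝟙 (right c y) in trans
          (cong₂ (λ z q → (M * 𝟙 (g x y) - z) * (M * 𝟙 (g x y) - z)
              + ((+ 2 * shift c) * (a * b * (M * 𝟙 (g x y) - φ (lab x) (lab y))) + (- (shift c * shift c)) * q))
            (φ⁺-encode (lab x) _ _ (lab y) _ _) (sym (cong₂ _*_ (square (left c x)) (square (right c y)))))
          (ring-identity (shift c) a b (M * 𝟙 (g x y)) (φ (lab x) (lab y)))

      badMass≤decrease : badMass ≤ ∑₂ V V (λ x y → decrease (lab x) (lab y) x y)
      badMass≤decrease = ∑₂-cells-mono V lab (λ X Y _ _ → 𝟙 (bad (corr X Y))) decrease
        (λ X Y → subst₂ _≤_ (sym (lhs X Y)) (sym (rhs X Y)) (gain (corr X Y)))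
        where
        lhs : ∀ X Y → ∑₂ (cell X) (cell Y) (λ _ _ → 𝟙 (bad (corr X Y))) ≡
          𝟙 (bad (corr X Y)) * (# cell X * # cell Y)
        lhs X Y = let β = 𝟙 (bad (corr X Y)) in trans
          (∑₂-cong (cell X) (cell Y) (λ _ _ → sym (ℤP.*-identityʳ β)))
          (trans (∑₂-*ˡ (cell X) (cell Y) β _) (cong (_*_ β) (∑₂-one (cell X) (cell Y))))
        rhs : ∀ X Y → let c = corr X Y in ∑₂ (cell X) (cell Y) (decrease X Y) ≡
          + 2 * shift c * disc M (φ X Y) (cell X) (cell Y) g (left c) (right c)
            - shift c * shift c * (∑ (cell X) (𝟙 ∘ left c) * ∑ (cell Y) (𝟙 ∘ right c))
        rhs X Y = let c = corr X Y in trans (∑₂-+ (cell X) (cell Y) _ _)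
          (cong₂ _+_ (∑₂-*ˡ (cell X) (cell Y) (+ 2 * shift c) _)
            (trans (∑₂-*ˡ (cell X) (cell Y) (- (shift c * shift c)) _)
              (trans (cong (_*_ (- (shift c * shift c))) (∑₂-product (cell X) (cell Y) _ _))
                (sym (ℤP.neg-distribˡ-* (shift c * shift c) _)))))

      stop : ∀ {J} → k ℕ.≤ J → K * badMass ≤ # V * # V → RegularLabelling M K V g J lab
      stop k≤J few = record
        { k = k ; lab = lab ; φ = φ ; reg = λ X Y → not (bad (corr X Y)) ; k≤size = k≤J
        ; refines = λ _ _ eq → eq
        ; reg-sound = λ X Y eq → good (corr X Y) (not-true _ eq)
        ; few-bad = subst (λ z → K * z ≤ # V * # V)
            (∑₂-cong V V (λ x y → cong 𝟙 (sym (not-involutive (bad (corr (lab x) (lab y))))))) few }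
        where
        not-true : ∀ b → not b ≡ true → b ≡ false
        not-true false _ = refl

    -- Induction on `t`, which bounds K·potential in units of |V|². While irregular pairs carry more
    -- than |V|²/K, a refinement lowers K·potential by more than one unit; at t = 0 this contradicts
    -- nonnegativity. The index `j` counts tower levels, two for each round.
    iterate : ∀ t m j {J k} (lab : A → Fin k) φ → k ℕ.≤ Tsh m j → j ℕ.+ (t ℕ.+ t) ℕ.≤ J →
      K * potential lab φ ≤ + t * (# V * # V) → RegularLabelling M K V g (Tsh m J) lab
    iterate t m j {J} {k} lab φ k≤ j≤J small with K * Step.badMass lab φ ℤP.≤? # V * # V
    ... | yes few = Step.stop lab φ (ℕP.≤-trans k≤ (Tsh-mono m (ℕP.≤-trans (ℕP.m≤m+n j _) j≤J))) few
    ... | no ¬few = continue t j≤J small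
      where
      open Step lab φ
      v = # V * # V
      drop : K * potential lab⁺ φ⁺ + v < K * potential lab φ + 0ℤ
      drop = begin-strict
        K * potential lab⁺ φ⁺ + v
          <⟨ ℤP.+-monoʳ-< (K * potential lab⁺ φ⁺) (ℤP.≰⇒> ¬few) ⟩
        K * potential lab⁺ φ⁺ + K * badMass
          ≤⟨ ℤP.+-monoʳ-≤ (K * potential lab⁺ φ⁺) (*-monoˡ 0≤K badMass≤decrease) ⟩
        K * potential lab⁺ φ⁺ + K * ∑₂ V V (λ x y → decrease (lab x) (lab y) x y)
          ≡⟨ sym (ℤP.*-distribˡ-+ K (potential lab⁺ φ⁺) _) ⟩
        K * (potential lab⁺ φ⁺ + ∑₂ V V (λ x y → decrease (lab x) (lab y) x y))
          ≡⟨ cong (_*_ K) potential-decrease ⟩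
        K * potential lab φ
          ≡⟨ sym (ℤP.+-identityʳ _) ⟩
        K * potential lab φ + 0ℤ ∎
        where open ≤-Reasoning
      continue : ∀ t → j ℕ.+ (t ℕ.+ t) ℕ.≤ J → K * potential lab φ ≤ + t * v →
        RegularLabelling M K V g (Tsh m J) lab
      continue zero _ small = ⊥-elim (ℤP.<-irrefl refl (begin-strict
        0ℤ                          ≤⟨ 0≤+ (0≤* 0≤K (0≤potential lab⁺ φ⁺)) (0≤* (0≤# V) (0≤# V)) ⟩
        K * potential lab⁺ φ⁺ + v   <⟨ drop ⟩
        K * potential lab φ + 0ℤ    ≡⟨ ℤP.+-identityʳ _ ⟩
        K * potential lab φ         ≤⟨ small ⟩
        0ℤ                          ∎))
        where open ≤-Reasoning
      continue (suc t) j≤J small = record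
        { RegularLabelling result
        ; refines = λ x y eq → refines⁺ x y (RegularLabelling.refines result x y eq) }
        where
        identity : ∀ p q t v → t * v ≡ p + ((q + 0ℤ - (p + v)) + ((1ℤ + t) * v - q))
        identity = solve-∀
        small⁺ : K * potential lab⁺ φ⁺ ≤ + t * v
        small⁺ = ≤-by _ (0≤+ (0≤b-a (ℤP.<⇒≤ drop))
            (0≤b-a (subst (λ n → K * potential lab φ ≤ n * v) (ℤP.pos-+ 1 t) small)))
          (identity (K * potential lab⁺ φ⁺) (K * potential lab φ) (+ t) v)
        steps : ∀ j t → 2 ℕ.+ j ℕ.+ (t ℕ.+ t) ≡ j ℕ.+ (suc t ℕ.+ suc t)
        steps = solve-∀ℕ
        result = iterate t m (2 ℕ.+ j) lab⁺ φ⁺ (refinement-size m j k≤)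
          (ℕP.≤-trans (ℕP.≤-reflexive (steps j t)) j≤J) small⁺

  -- Searching masks and compressing labels

  searchable-Fin : ∀ n → Searchable (Fin n)
  searchable-Fin n {P} P? resp = map′
    (λ (S , pS) → lookup S , pS)
    (λ (s , ps) → tabulateᵥ s , resp (λ x → sym (lookup∘tabulate s x)) ps)
    (anySubset? (λ S → P? (lookup S)))

  searchable-retract : (f : A → B) (g : B → A) → (∀ x → g (f x) ≡ x) → Searchable B → Searchable A
  searchable-retract f g gf search {P} P? resp = map′
    (λ (t , pt) → t ∘ f , pt)
    (λ (s , ps) → s ∘ g , resp (λ x → cong s (sym (gf x))) ps)
    (search {λ t → P (t ∘ f)} (λ t → P? (t ∘ f)) (λ eq → resp (λ x → eq (f x))))

  searchable-Vtx : ∀ n → Searchable (Vtx n)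
  searchable-Vtx n = searchable-retract (uncurry combine) (remQuot {3} n)
    (λ (i , u) → FinP.remQuot-combine i u) (searchable-Fin (3 ℕ.* n))

  -- The encoded labels of the iteration need not all be attained, whereas `VPartition` admits
  -- nonempty parts only.
  record SurjectiveFactor {A : Set} {k : ℕ} (lab : A → Fin k) : Set where
    field
      k⁻       : ℕ
      lab⁻     : A → Fin k⁻
      ι        : Fin k⁻ → Fin k
      k⁻≤k     : k⁻ ℕ.≤ k
      ι-inj    : ∀ {X Y} → ι X ≡ ι Y → X ≡ Y
      ι-lab⁻   : ∀ x → ι (lab⁻ x) ≡ lab x
      surj     : ∀ X → ∃ λ x → lab⁻ x ≡ X

  surjectiveFactor : (∀ {k} (lab : A → Fin k) X → Dec (∃ λ x → lab x ≡ X)) →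
    ∀ {k} (lab : A → Fin k) → SurjectiveFactor lab
  surjectiveFactor hit? {zero} lab = record
    { k⁻ = zero ; lab⁻ = lab ; ι = λ X → X ; k⁻≤k = ℕP.≤-refl ; ι-inj = λ eq → eq
    ; ι-lab⁻ = λ _ → refl ; surj = λ () }
  surjectiveFactor {A = A} hit? {suc k} lab with FinP.any? (λ X → ¬? (hit? lab X))
  ... | no all-hit = record
    { k⁻ = suc k ; lab⁻ = lab ; ι = λ X → X ; k⁻≤k = ℕP.≤-refl ; ι-inj = λ eq → eq
    ; ι-lab⁻ = λ _ → refl ; surj = λ X → decidable-stable (hit? lab X) (λ ¬hit → all-hit (X , ¬hit)) }
  ... | yes (X , ¬hit) = record
    { k⁻ = k⁻ ; lab⁻ = lab⁻ ; ι = punchIn X ∘ ι ; k⁻≤k = ℕP.m≤n⇒m≤1+n k⁻≤k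
    ; ι-inj = λ eq → ι-inj (FinP.punchIn-injective X _ _ eq)
    ; ι-lab⁻ = λ x → trans (cong (punchIn X) (ι-lab⁻ x)) (FinP.punchIn-punchOut (missed x))
    ; surj = surj }
    where
    missed : ∀ x → X ≢ lab x
    missed x eq = ¬hit (x , sym eq)
    open SurjectiveFactor (surjectiveFactor hit? (λ x → punchOut (missed x)))

  hit-Vtx? : ∀ {n k} (lab : Vtx n → Fin k) X → Dec (∃ λ x → lab x ≡ X)
  hit-Vtx? lab X = map′ (λ (i , u , eq) → (i , u) , eq) (λ ((i , u) , eq) → i , u , eq)
    (FinP.any? (λ i → FinP.any? (λ u → lab (i , u) ≟F X)))

  module Compress {M K : ℤ} {V : List A} {g : A → A → Bool} {size k₀ : ℕ} {lab₀ : A → Fin k₀}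
                  (R : RegularLabelling M K V g size lab₀)
                  (F : SurjectiveFactor (RegularLabelling.lab R)) where
    open RegularLabelling R
    open SurjectiveFactor F

    cell-ι : ∀ X → part _≟F_ V lab⁻ X ≡ part _≟F_ V lab (ι X)
    cell-ι X = filter-≐ (λ v → lab⁻ v ≟F X) (λ v → lab v ≟F ι X)
      ( (λ {v} eq → trans (sym (ι-lab⁻ v)) (cong ι eq))
      , (λ {v} eq → ι-inj (trans (ι-lab⁻ v) eq))) V

    compressed : RegularLabelling M K V g size lab₀
    compressed = record
      { k = k⁻ ; lab = lab⁻ ; φ = λ X Y → φ (ι X) (ι Y) ; reg = λ X Y → reg (ι X) (ι Y)
      ; k≤size = ℕP.≤-trans k⁻≤k k≤size
      ; refines = λ x y eq → refines x y (trans (sym (ι-lab⁻ x)) (trans (cong ι eq) (ι-lab⁻ y)))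
      ; reg-sound = λ X Y eq → subst₂ (λ U W → Regular M (φ (ι X) (ι Y)) U W g)
          (sym (cell-ι X)) (sym (cell-ι Y)) (reg-sound (ι X) (ι Y) eq)
      ; few-bad = subst (λ z → K * z ≤ # V * # V)
          (∑₂-cong V V (λ x y → cong₂ (λ X Y → 𝟙 (not (reg X Y))) (sym (ι-lab⁻ x)) (sym (ι-lab⁻ y)))) few-bad }

  -- The tripartite setting

  adj : ∀ {n} → TriGraph n → Vtx n → Vtx n → Bool
  adj G (zero , x)          (suc zero , y)       = TriGraph.e12 G x y
  adj G (suc zero , y)      (zero , x)           = TriGraph.e12 G x y
  adj G (zero , x)          (suc (suc zero) , z) = TriGraph.e13 G x z
  adj G (suc (suc zero) , z) (zero , x)          = TriGraph.e13 G x z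
  adj G (suc zero , y)      (suc (suc zero) , z) = TriGraph.e23 G y z
  adj G (suc (suc zero) , z) (suc zero , y)      = TriGraph.e23 G y z
  adj G _ _ = false

  -- A triangle seen from its vertex `u`: a cherry at `u` together with the edge joining its two
  -- ends.
  GH-adj : ∀ {n} (G : TriGraph n) i u v w → GH G i (inj₁ u) (inj₂ (v , w)) ≡
    adj G (i , u) (idx2 i , v) ∧ (adj G (i , u) (idx3 i , w) ∧ adj G (idx2 i , v) (idx3 i , w))
  GH-adj G zero             u v w = refl
  GH-adj G (suc zero)       u v w = cong (_∧_ (TriGraph.e12 G v u)) (∧-comm (TriGraph.e13 G v w) (TriGraph.e23 G u w))
  GH-adj G (suc (suc zero)) u v w = trans (∧-comm (TriGraph.e12 G v w) _) (∧-assoc (TriGraph.e13 G v u) _ _)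

  module Cells {n k : ℕ} (lab : Vtx n → Fin k)
               (tripartite : ∀ u v → lab u ≡ lab v → proj₁ u ≡ proj₁ v) where

    cell : Fin k → List (Vtx n)
    cell = part _≟F_ (allVtx n) lab

    -- Cells live in `Vtx n`, but the graphs `GH G i` are built on bare `Fin n`. This is the trace
    -- of a cell on one class; since the labelling is tripartite, it is the whole cell or empty.
    cellAt : Fin 3 → Fin k → List (Fin n)
    cellAt i = part _≟F_ (allFin n) (λ u → lab (i , u))

    Inhabited : Fin 3 → Fin k → Set
    Inhabited i X = ∃ λ u → lab (i , u) ≡ X

    ∑-uninhabited : ∀ {i X} → ¬ Inhabited i X → ∀ f → ∑ (cellAt i X) f ≡ 0ℤ
    ∑-uninhabited {i} {X} empty f = trans
      (∑-part-cong _≟F_ (allFin n) (λ u → lab (i , u)) X (λ u eq → ⊥-elim (empty (u , eq))))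
      (∑-zero (cellAt i X))

    #-uninhabited : ∀ {i X} → ¬ Inhabited i X → # cellAt i X ≡ 0ℤ
    #-uninhabited {i} {X} empty = trans (#≡∑1 (cellAt i X)) (∑-uninhabited empty _)

    ∑-cell : ∀ X f → ∑ (cell X) f ≡ ∑ (allFin 3) (λ i → ∑ (cellAt i X) (λ u → f (i , u)))
    ∑-cell X f = begin
      ∑ (cell X) f
        ≡⟨ trans (∑-filter (λ v → lab v ≟F X) (allVtx n) f) (∑-cartesian (allFin 3) (allFin n) _) ⟩
      ∑₂ (allFin 3) (allFin n) (λ i u → 𝟙 (does (lab (i , u) ≟F X)) * f (i , u))
        ≡⟨ ∑-cong (allFin 3) (λ i → sym (∑-filter (λ u → lab (i , u) ≟F X) (allFin n) (λ u → f (i , u)))) ⟩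
      ∑ (allFin 3) (λ i → ∑ (cellAt i X) (λ u → f (i , u))) ∎
      where open ≡-Reasoning

    ∑-cell-at : ∀ {i X} → Inhabited i X → ∀ f → ∑ (cell X) f ≡ ∑ (cellAt i X) (λ u → f (i , u))
    ∑-cell-at {i} {X} (u₀ , eq₀) f = trans (∑-cell X f)
      (trans (∑-cong (allFin 3) only-i) (∑-delta i (λ j → ∑ (cellAt j X) (λ u → f (j , u)))))
      where
      only-i : ∀ j → ∑ (cellAt j X) (λ u → f (j , u)) ≡
        𝟙 (does (i ≟F j)) * ∑ (cellAt j X) (λ u → f (j , u))
      only-i j with i ≟F j
      ... | yes _  = sym (ℤP.*-identityˡ _)
      ... | no i≢j = ∑-uninhabited (λ (u , eq) → i≢j (tripartite _ _ (trans eq₀ (sym eq)))) _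

    #-cell-at : ∀ {i X} → Inhabited i X → # cell X ≡ # cellAt i X
    #-cell-at {i} {X} inh = trans (#≡∑1 (cell X)) (trans (∑-cell-at inh _) (sym (#≡∑1 (cellAt i X))))

    inhabited? : ∀ i X → Dec (Inhabited i X)
    inhabited? i X = FinP.any? (λ u → lab (i , u) ≟F X)

    -- If both cells meet the chosen classes, the sums over cells and traces agree. Otherwise a
    -- trace is empty, and the discrepancy and its bound both vanish.
    Regular-at : ∀ {M φ X Y} {E : Vtx n → Vtx n → Bool} → Regular M φ (cell X) (cell Y) E →
      ∀ i j → Regular M φ (cellAt i X) (cellAt j Y) (λ u v → E (i , u) (j , v))
    Regular-at {M} {φ} {X} {Y} {E} reg i j with inhabited? i X | inhabited? j Y
    ... | yes inhX | yes inhY = regular λ s t →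
      subst₂ (λ d z → d ≤ z × - d ≤ z)
        (trans (∑-cell-at inhX _) (∑-cong (cellAt i X) (λ u → ∑-cell-at inhY _)))
        (cong₂ _*_ (#-cell-at inhX) (#-cell-at inhY))
        (bound reg (s ∘ proj₂) (t ∘ proj₂))
    ... | no ¬inhX | _ = regular λ s t →
      subst₂ (λ d z → d ≤ z × - d ≤ z) (sym (∑-uninhabited ¬inhX _))
        (sym (cong (_* # cellAt j Y) (#-uninhabited ¬inhX))) (≤-refl , ≤-refl)
    ... | yes _ | no ¬inhY = regular λ s t →
      subst₂ (λ d z → d ≤ z × - d ≤ z)
        (sym (trans (∑-cong (cellAt i X) (λ u → ∑-uninhabited ¬inhY _)) (∑-zero (cellAt i X))))
        (sym (trans (cong (_*_ (# cellAt i X)) (#-uninhabited ¬inhY)) (ℤP.*-zeroʳ (# cellAt i X))))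
        (≤-refl , ≤-refl)

  -- The decomposition

  does-true : ∀ {P : Set} (d : Dec P) → does d ≡ true → P
  does-true (yes p) _ = p

  does-false : ∀ {P : Set} (d : Dec P) → does d ≡ false → ¬ P
  does-false (no ¬p) _ = ¬p

  ∧-trueˡ : ∀ {a b} → a ∧ b ≡ true → a ≡ true
  ∧-trueˡ {true} _ = refl

  ∧-trueʳ : ∀ {a b} → a ∧ b ≡ true → b ≡ true
  ∧-trueʳ {true} eq = eq

  HalfRegular-part-cong : ∀ {L₁ L₂ : Set} {N} (_≟₁_ : DecidableEquality L₁) (_≟₂_ : DecidableEquality L₂)
    (V : List A) (W : List B) {q r a b} {E E′ : A → B → Bool} →
    (∀ x y → q x ≡ a → r y ≡ b → E x y ≡ E′ x y) →
    HalfRegular N (part _≟₁_ V q a) (part _≟₂_ W r b) E′ → HalfRegular N (part _≟₁_ V q a) (part _≟₂_ W r b) E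
  HalfRegular-part-cong _≟₁_ _≟₂_ V W {q} {r} {a} {b} eq = HalfRegular-cong (edges-cong-All
    (All.map (λ {x} qx → All.map (λ {y} ry → eq x y qx ry) (all-filter (λ y → r y ≟₂ b) W))
      (all-filter (λ x → q x ≟₁ a) V)))

  does-×-≟ : ∀ {A B : Set} (_≟₁_ : DecidableEquality A) (_≟₂_ : DecidableEquality B) a b c d →
    does (×-≡-dec _≟₁_ _≟₂_ (a , b) (c , d)) ≡ does (a ≟₁ c) ∧ does (b ≟₂ d)
  does-×-≟ _≟₁_ _≟₂_ a b c d with a ≟₁ c
  ... | no _     = refl
  ... | yes refl = refl

  module Construction {n k : ℕ} (G : TriGraph n) {N h M : ℤ}
      (1≤N : 1ℤ ≤ N) (1≤M : 1ℤ ≤ M) (0≤h : 0ℤ ≤ h)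
      (const : + 18 * (M * M) * (N * N) ≤ h * h * (h - 1ℤ))
      (2N²≤ : + 2 * (N * N) ≤ h - 1ℤ) (4hN≤M : + 4 * (h * N) ≤ M)
      (lab : Vtx n → Fin k) (surj : ∀ X → ∃ λ x → lab x ≡ X)
      (tripartite : ∀ u v → lab u ≡ lab v → proj₁ u ≡ proj₁ v)
      (φ : Fin k → Fin k → ℤ) (reg : Fin k → Fin k → Bool)
      (reg-sound : ∀ X Y → reg X Y ≡ true →
        Regular M (φ X Y) (part _≟F_ (allVtx n) lab X) (part _≟F_ (allVtx n) lab Y) (adj G))
      where

    open Cells lab tripartite

    -- Both the edges and the non-edges need density at least about h/M to be regular; a pair that
    -- is ok but not split is nearly complete.
    ok splits : Fin k → Fin k → Bool
    ok X Y = reg X Y ∧ does (h ℤP.≤? φ X Y)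
    splits X Y = ok X Y ∧ does (φ X Y ℤP.≤? M - h)

    ok-regular : ∀ {X Y} → ok X Y ≡ true → Regular M (φ X Y) (cell X) (cell Y) (adj G)
    ok-regular {X} {Y} eq = reg-sound X Y (∧-trueˡ eq)

    ok-dense : ∀ {X Y} → ok X Y ≡ true → h ≤ φ X Y
    ok-dense {X} {Y} eq = does-true (h ℤP.≤? φ X Y) (∧-trueʳ {reg X Y} eq)

    -- Edges of G carry label 0 whether or not the pair is split. A part with any other label
    -- therefore lies under no triangle, and only label 0 needs the cherry count.
    subLabel : Bool → Bool → ℕ
    subLabel s e = if s ∧ not e then 1 else 0

    sub : Vtx n → Vtx n → ℕ
    sub a b = subLabel (splits (lab a) (lab b)) (adj G a b)

    decomposition : Decomposition n
    decomposition = record { P1 = record { k = k ; lab = lab ; surj = surj } ; sub = sub }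

    0≤N = ≤-trans 0≤+n 1≤N

    -- An undivided product is a complete bigraph. Over a split pair, h ≤ φ ≤ M - h puts both the
    -- edges and the non-edges above the threshold of `Regular⇒HalfRegular`. Labels that do not
    -- occur give empty bigraphs.
    good : ∀ X Y l → HalfRegular N (cell X) (cell Y) (λ a b → does (sub a b ≟N l))
    good X Y l = HalfRegular-part-cong _≟F_ _≟F_ (allVtx n) (allVtx n)
      (λ { a b refl refl → refl }) (by-label (splits X Y) refl l)
      where
      split-zero : ∀ e → does (subLabel true e ≟N 0) ≡ e
      split-zero true  = refl
      split-zero false = refl
      split-one : ∀ e → does (subLabel true e ≟N 1) ≡ not e
      split-one true  = refl
      split-one false = refl
      split-other : ∀ l e → does (subLabel true e ≟N suc (suc l)) ≡ false
      split-other l true  = refl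
      split-other l false = refl
      cong-cell = λ {E E′ : Vtx n → Vtx n → Bool} (eq : ∀ a b → E a b ≡ E′ a b) →
        HalfRegular-part-cong {N = N} _≟F_ _≟F_ (allVtx n) (allVtx n) {lab} {lab} {X} {Y} (λ a b _ _ → eq a b)
      by-label : ∀ s → splits X Y ≡ s → ∀ l →
        HalfRegular N (cell X) (cell Y) (λ a b → does (subLabel s (adj G a b) ≟N l))
      by-label false _  zero    = HalfRegular-full
      by-label false _  (suc l) = HalfRegular-empty
      by-label true  eq zero    = cong-cell (λ a b → split-zero (adj G a b))
        (Regular⇒HalfRegular 1≤M 0≤N (≤-trans 2N²≤ (ℤP.+-monoˡ-≤ (- 1ℤ) (ok-dense (∧-trueˡ eq))))
          (ok-regular (∧-trueˡ eq)))
      by-label true  eq (suc zero) = cong-cell (λ a b → split-one (adj G a b))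
        (Regular⇒HalfRegular 1≤M 0≤N
          (≤-trans 2N²≤ (ℤP.+-monoˡ-≤ (- 1ℤ) h≤M-φ))
          (Regular-complement (ok-regular (∧-trueˡ eq))))
        where
        swap : ∀ M h φ → M - φ ≡ h + ((M - h) - φ)
        swap = solve-∀
        h≤M-φ : h ≤ M - φ X Y
        h≤M-φ = ≤-by _ (0≤b-a (does-true (φ X Y ℤP.≤? M - h) (∧-trueʳ {ok X Y} eq))) (swap M h (φ X Y))
      by-label true  eq (suc (suc l)) = cong-cell (λ a b → split-other l (adj G a b)) HalfRegular-empty

    okTriple : Fin k → Fin k → Fin k → Bool
    okTriple A X Y = ok A X ∧ (ok A Y ∧ ok X Y)

    E′ : Fin 3 → GVtx n → GVtx n → Bool
    E′ i (inj₁ u)       (inj₂ (v , w)) =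
      GH G i (inj₁ u) (inj₂ (v , w)) ∧ okTriple (lab (i , u)) (lab (idx2 i , v)) (lab (idx3 i , w))
    E′ i (inj₂ (v , w)) (inj₁ u)       = E′ i (inj₁ u) (inj₂ (v , w))
    E′ i (inj₁ _)       (inj₁ _)       = false
    E′ i (inj₂ _)       (inj₂ _)       = false

    E′-sym : ∀ i x y → E′ i x y ≡ E′ i y x
    E′-sym i (inj₁ _) (inj₁ _) = refl
    E′-sym i (inj₁ _) (inj₂ _) = refl
    E′-sym i (inj₂ _) (inj₁ _) = refl
    E′-sym i (inj₂ _) (inj₂ _) = refl

    gpart : Fin 3 → PLabel k → List (GVtx n)
    gpart i = part (PLabel-≟ k) (allGVtx n) (inducedLab decomposition i)

    ∑-gpart : ∀ i a f → ∑ (gpart i a) f ≡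
      ∑ (allFin n) (λ u → 𝟙 (does (PLabel-≟ k (inducedLab decomposition i (inj₁ u)) a)) * f (inj₁ u))
      + ∑₂ (allFin n) (allFin n) (λ v w →
          𝟙 (does (PLabel-≟ k (inducedLab decomposition i (inj₂ (v , w))) a)) * f (inj₂ (v , w)))
    ∑-gpart i a f = trans (∑-filter (λ v → PLabel-≟ k (inducedLab decomposition i v) a) (allGVtx n) f)
      (trans (∑-++ (map inj₁ (allFin n)) _ F)
        (cong₂ _+_ (∑-map inj₁ (allFin n) F) (trans (∑-map inj₂ (cartesianProduct (allFin n) (allFin n)) F)
          (∑-cartesian (allFin n) (allFin n) (F ∘ inj₂)))))
      where
      F : GVtx n → ℤ
      F v = 𝟙 (does (PLabel-≟ k (inducedLab decomposition i v) a)) * f v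

    ∑-gpart₁ : ∀ i A f → ∑ (gpart i (inj₁ A)) f ≡ ∑ (cellAt i A) (f ∘ inj₁)
    ∑-gpart₁ i A f = trans (∑-gpart i (inj₁ A) f) (trans
      (cong₂ _+_ (sym (∑-filter (λ u → lab (i , u) ≟F A) (allFin n) (f ∘ inj₁)))
        (trans (∑-cong (allFin n) (λ _ → ∑-zero (allFin n))) (∑-zero (allFin n))))
      (ℤP.+-identityʳ _))

    ∑-gpart₂ : ∀ i X Y l f → ∑ (gpart i (inj₂ (X , Y , l))) f ≡
      ∑₂ (cellAt (idx2 i) X) (cellAt (idx3 i) Y) (λ v w →
        𝟙 (does (sub (idx2 i , v) (idx3 i , w) ≟N l)) * f (inj₂ (v , w)))
    ∑-gpart₂ i X Y l f = begin
      ∑ (gpart i (inj₂ (X , Y , l))) f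
        ≡⟨ trans (∑-gpart i (inj₂ (X , Y , l)) f)
             (trans (cong (_+ ∑₂ (allFin n) (allFin n) selected) (∑-zero (allFin n))) (ℤP.+-identityˡ _)) ⟩
      ∑₂ (allFin n) (allFin n) selected
        ≡⟨ ∑₂-cong (allFin n) (allFin n) pointwise ⟩
      ∑₂ (allFin n) (allFin n) (λ v w → 𝟙 (does (lab (idx2 i , v) ≟F X)) *
        (𝟙 (does (lab (idx3 i , w) ≟F Y)) * body v w))
        ≡⟨ ∑-cong (allFin n) (λ v → trans (∑-*ˡ (allFin n) (𝟙 (does (lab (idx2 i , v) ≟F X))) _)
             (cong (_*_ (𝟙 (does (lab (idx2 i , v) ≟F X))))
               (sym (∑-filter (λ w → lab (idx3 i , w) ≟F Y) (allFin n) (body v))))) ⟩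
      ∑ (allFin n) (λ v → 𝟙 (does (lab (idx2 i , v) ≟F X)) * ∑ (cellAt (idx3 i) Y) (body v))
        ≡⟨ sym (∑-filter (λ v → lab (idx2 i , v) ≟F X) (allFin n) (λ v → ∑ (cellAt (idx3 i) Y) (body v))) ⟩
      ∑₂ (cellAt (idx2 i) X) (cellAt (idx3 i) Y) body ∎
      where
      open ≡-Reasoning
      selected body : Fin n → Fin n → ℤ
      selected v w = 𝟙 (does (PLabel-≟ k (inducedLab decomposition i (inj₂ (v , w))) (inj₂ (X , Y , l)))) * f (inj₂ (v , w))
      body v w = 𝟙 (does (sub (idx2 i , v) (idx3 i , w) ≟N l)) * f (inj₂ (v , w))
      pointwise : ∀ v w → selected v w ≡
        𝟙 (does (lab (idx2 i , v) ≟F X)) * (𝟙 (does (lab (idx3 i , w) ≟F Y)) * body v w)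
      pointwise v w
        rewrite does-×-≟ _≟F_ (×-≡-dec _≟F_ _≟N_) (lab (idx2 i , v)) (lab (idx3 i , w) , sub (idx2 i , v) (idx3 i , w)) X (Y , l)
              | does-×-≟ _≟F_ _≟N_ (lab (idx3 i , w)) (sub (idx2 i , v) (idx3 i , w)) Y l
              | 𝟙-∧ (does (lab (idx2 i , v) ≟F X)) (does (lab (idx3 i , w) ≟F Y) ∧ does (sub (idx2 i , v) (idx3 i , w) ≟N l))
              | 𝟙-∧ (does (lab (idx3 i , w) ≟F Y)) (does (sub (idx2 i , v) (idx3 i , w) ≟N l))
        = trans (ℤP.*-assoc (𝟙 (does (lab (idx2 i , v) ≟F X))) _ _)
            (cong (_*_ (𝟙 (does (lab (idx2 i , v) ≟F X)))) (ℤP.*-assoc (𝟙 (does (lab (idx3 i , w) ≟F Y))) _ _))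

    gpart-cong : ∀ i {a b E E″} →
      (∀ x y → inducedLab decomposition i x ≡ a → inducedLab decomposition i y ≡ b → E x y ≡ E″ x y) →
      HalfRegular N (gpart i a) (gpart i b) E″ → HalfRegular N (gpart i a) (gpart i b) E
    gpart-cong i = HalfRegular-part-cong (PLabel-≟ k) (PLabel-≟ k) (allGVtx n) (allGVtx n)

    module Cross (i : Fin 3) (A X Y : Fin k) (okAXY : okTriple A X Y ≡ true) where
      j₂ = idx2 i
      j₃ = idx3 i
      g : Fin n → Fin n → Bool
      g v w = adj G (j₂ , v) (j₃ , w)

      okAX = ∧-trueˡ {ok A X} okAXY
      okAY = ∧-trueˡ {ok A Y} (∧-trueʳ {ok A X} okAXY)
      okXY = ∧-trueʳ {ok A Y} (∧-trueʳ {ok A X} okAXY)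

      regXY = Regular-at (ok-regular okXY) j₂ j₃

      P⁺ = gpart i (inj₂ (X , Y , 0))

      assemble : (c : Fin n → Fin n → Bool) →
        (∀ f → ∑ P⁺ f ≡ ∑₂ (cellAt j₂ X) (cellAt j₃ Y) (λ v w → 𝟙 (c v w) * f (inj₂ (v , w)))) →
        (h - 1ℤ) * (# cellAt j₂ X * # cellAt j₃ Y) ≤ M * # P⁺ →
        (∀ t → # P⁺ ≤ N * ∑ P⁺ (𝟙 ∘ t) → + 3 * ∑ P⁺ (𝟙 ∘ t) ≤
          + 4 * ∑₂ (cellAt j₂ X) (cellAt j₃ Y) (λ v w → 𝟙 (c v w ∧ (g v w ∧ t (inj₂ (v , w)))))) →
        HalfRegular N (gpart i (inj₁ A)) P⁺ (GH G i)
      assemble c sumP dense mostly = cherries-HalfRegular {ι = inj₁} {κ = λ v w → inj₂ (v , w)} {c = c} {g = g}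
        1≤M 1≤N 0≤h const (ok-dense okAX) (ok-dense okAY)
        (Regular-at (ok-regular okAX) i j₂) (Regular-at (ok-regular okAY) i j₃)
        (∑-gpart₁ i A) sumP (GH-adj G i) dense mostly

      sum-label0 : ∀ {s} → splits X Y ≡ s → ∀ f → ∑ P⁺ f ≡
        ∑₂ (cellAt j₂ X) (cellAt j₃ Y) (λ v w → 𝟙 (does (subLabel s (g v w) ≟N 0)) * f (inj₂ (v , w)))
      sum-label0 eq f = trans (∑-gpart₂ i X Y 0 f)
        (∑-part-cong _≟F_ (allFin n) _ X (λ v labv → ∑-part-cong _≟F_ (allFin n) _ Y (λ w labw →
          cong (λ s → 𝟙 (does (subLabel s (g v w) ≟N 0)) * f (inj₂ (v , w)))
            (trans (cong₂ splits labv labw) eq))))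

      -- The part consists of edges only, so every pair in it counts towards a cherry and the loss
      -- of a quarter allowed by `assemble` does not occur.
      split-case : splits X Y ≡ true → HalfRegular N (gpart i (inj₁ A)) P⁺ (GH G i)
      split-case eq = assemble g sumP
        (subst (λ z → (h - 1ℤ) * (# cellAt j₂ X * # cellAt j₃ Y) ≤ M * z) (sym #P)
          (Regular⇒dense 1≤M regXY (ok-dense okXY)))
        (λ t _ → subst (λ z → + 3 * z ≤ + 4 * q t) (sym (∑P t))
          (≤-by _ (∑₂-nonneg (cellAt j₂ X) (cellAt j₃ Y) (λ v w → 0≤𝟙 (g v w ∧ (g v w ∧ t (inj₂ (v , w))))))
            (3q+q (q t))))
        where
        q : (GVtx n → Bool) → ℤ
        q t = ∑₂ (cellAt j₂ X) (cellAt j₃ Y) (λ v w → 𝟙 (g v w ∧ (g v w ∧ t (inj₂ (v , w)))))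
        3q+q : ∀ q → + 4 * q ≡ + 3 * q + q
        3q+q = solve-∀
        label0 : ∀ e → does (subLabel true e ≟N 0) ≡ e
        label0 true  = refl
        label0 false = refl
        sumP : ∀ f → ∑ P⁺ f ≡ ∑₂ (cellAt j₂ X) (cellAt j₃ Y) (λ v w → 𝟙 (g v w) * f (inj₂ (v , w)))
        sumP f = trans (sum-label0 eq f)
          (∑₂-cong (cellAt j₂ X) (cellAt j₃ Y) (λ v w → cong (λ b → 𝟙 b * f (inj₂ (v , w))) (label0 (g v w))))
        #P : # P⁺ ≡ ∑₂ (cellAt j₂ X) (cellAt j₃ Y) (λ v w → 𝟙 (g v w))
        #P = trans (#≡∑1 P⁺) (trans (sumP _) (∑₂-cong (cellAt j₂ X) (cellAt j₃ Y) (λ v w → ℤP.*-identityʳ _)))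
        idem : ∀ a b → 𝟙 a * 𝟙 b ≡ 𝟙 (a ∧ (a ∧ b))
        idem true  b = ℤP.*-identityˡ (𝟙 b)
        idem false b = refl
        ∑P : ∀ t → ∑ P⁺ (𝟙 ∘ t) ≡ q t
        ∑P t = trans (sumP (𝟙 ∘ t)) (∑₂-cong (cellAt j₂ X) (cellAt j₃ Y) (λ v w → idem (g v w) (t (inj₂ (v , w)))))

      full-case : splits X Y ≡ false → HalfRegular N (gpart i (inj₁ A)) P⁺ (GH G i)
      full-case eq = assemble (λ _ _ → true) (sum-label0 eq)
        (subst (λ z → (h - 1ℤ) * (# cellAt j₂ X * # cellAt j₃ Y) ≤ M * z) (sym #P)
          (*-monoʳ (0≤* (0≤# (cellAt j₂ X)) (0≤# (cellAt j₃ Y))) h-1≤M))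
        (λ t large → subst (λ z → + 3 * z ≤ + 4 * ∑₂ (cellAt j₂ X) (cellAt j₃ Y) (λ v w → 𝟙 (g v w ∧ t (inj₂ (v , w)))))
            (sym (∑P t))
          (nearly-complete 1≤M regXY 0≤h 4hN≤M high (λ v w → t (inj₂ (v , w)))
            (subst₂ (λ p p′ → p ≤ N * p′) #P (∑P t) large)))
        where
        high : M - h < φ X Y
        high = ℤP.≰⇒> (does-false (φ X Y ℤP.≤? M - h) (trans (cong (_∧ does (φ X Y ℤP.≤? M - h)) (sym okXY)) eq))
        certificate : ∀ M N h → M ≡ (h - 1ℤ) + ((M - + 4 * (h * N)) + (+ 4 * (h * (N - 1ℤ)) + (+ 3 * h + 1ℤ)))
        certificate = solve-∀
        h-1≤M : h - 1ℤ ≤ M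
        h-1≤M = ≤-by _ (0≤+ (0≤b-a 4hN≤M) (0≤+ (0≤* (0≤+n {4}) (0≤* 0≤h (0≤b-a 1≤N)))
          (0≤+ (0≤* (0≤+n {3}) 0≤h) (0≤+n {1})))) (certificate M N h)
        #P : # P⁺ ≡ # cellAt j₂ X * # cellAt j₃ Y
        #P = trans (#≡∑1 P⁺) (trans (sum-label0 eq _) (∑₂-one (cellAt j₂ X) (cellAt j₃ Y)))
        ∑P : ∀ t → ∑ P⁺ (𝟙 ∘ t) ≡ ∑₂ (cellAt j₂ X) (cellAt j₃ Y) (λ v w → 𝟙 (t (inj₂ (v , w))))
        ∑P t = trans (sum-label0 eq (𝟙 ∘ t)) (∑₂-cong (cellAt j₂ X) (cellAt j₃ Y) (λ v w → ℤP.*-identityˡ _))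

      label0 : HalfRegular N (gpart i (inj₁ A)) P⁺ (GH G i)
      label0 = by-split (splits X Y) refl
        where
        by-split : ∀ s → splits X Y ≡ s → HalfRegular N (gpart i (inj₁ A)) P⁺ (GH G i)
        by-split true  = split-case
        by-split false = full-case

    nonzero-label : ∀ {l} a b → sub a b ≡ suc l → adj G a b ≡ false
    nonzero-label a b eq = by-edge (splits (lab a) (lab b)) (adj G a b) eq
      where
      by-edge : ∀ {l} s e → subLabel s e ≡ suc l → e ≡ false
      by-edge s     false _ = refl
      by-edge true  true  ()
      by-edge false true  ()

    -- For a nonzero label the third edge is missing, and for a triple of cells that is not ok all
    -- edges have been discarded; `E′` is empty both times. In the remaining case it coincides with
    -- `GH` on these parts.
    cross : ∀ i A X Y l → HalfRegular N (gpart i (inj₁ A)) (gpart i (inj₂ (X , Y , l))) (E′ i)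
    cross i A X Y l = by-ok (okTriple A X Y) refl l
      where
      open import Data.Bool.Properties using (∧-identityʳ; ∧-zeroʳ)
      on-labels : ∀ {b l} → okTriple A X Y ≡ b → ∀ x y →
        inducedLab decomposition i x ≡ inj₁ A → inducedLab decomposition i y ≡ inj₂ (X , Y , l) →
        E′ i x y ≡ GH G i x y ∧ b
      on-labels eq (inj₁ u) (inj₂ (v , w)) refl refl = cong (_∧_ (GH G i (inj₁ u) (inj₂ (v , w)))) eq
      vanishes : ∀ {l} x y → inducedLab decomposition i x ≡ inj₁ A →
        inducedLab decomposition i y ≡ inj₂ (X , Y , suc l) → E′ i x y ≡ false
      vanishes (inj₁ u) (inj₂ (v , w)) eqx eqy
        rewrite GH-adj G i u v w | nonzero-label (idx2 i , v) (idx3 i , w) (cong proj₂ (cong proj₂ (inj₂-injective eqy)))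
              | ∧-zeroʳ (adj G (i , u) (idx3 i , w)) | ∧-zeroʳ (adj G (i , u) (idx2 i , v)) = refl
      by-ok : ∀ b → okTriple A X Y ≡ b → ∀ l →
        HalfRegular N (gpart i (inj₁ A)) (gpart i (inj₂ (X , Y , l))) (E′ i)
      by-ok _     _  (suc l) = gpart-cong i {E = E′ i} vanishes HalfRegular-empty
      by-ok true  eq zero    = gpart-cong i {E = E′ i}
        (λ x y eqx eqy → trans (on-labels eq x y eqx eqy) (∧-identityʳ _)) (Cross.label0 i A X Y eq)
      by-ok false eq zero    = gpart-cong i {E = E′ i}
        (λ x y eqx eqy → trans (on-labels eq x y eqx eqy) (∧-zeroʳ _)) HalfRegular-empty

    regular-for-H : ∀ i a b → HalfRegular N (gpart i a) (gpart i b) (E′ i)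
    regular-for-H i (inj₁ A) (inj₂ (X , Y , l)) = cross i A X Y l
    regular-for-H i (inj₂ (X , Y , l)) (inj₁ A) = gpart-cong i {E = E′ i}
      (λ x y _ _ → E′-sym i x y) (HalfRegular-transpose (cross i A X Y l))
    regular-for-H i (inj₁ A) (inj₁ B) = gpart-cong i {E = E′ i} vanishes HalfRegular-empty
      where
      vanishes : ∀ x y → inducedLab decomposition i x ≡ inj₁ A → inducedLab decomposition i y ≡ inj₁ B → E′ i x y ≡ false
      vanishes (inj₁ _) (inj₁ _) _ _ = refl
    regular-for-H i (inj₂ _) (inj₂ _) = gpart-cong i {E = E′ i} vanishes HalfRegular-empty
      where
      vanishes : ∀ {p q} x y → inducedLab decomposition i x ≡ inj₂ p → inducedLab decomposition i y ≡ inj₂ q → E′ i x y ≡ false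
      vanishes (inj₂ _) (inj₂ _) _ _ = refl

  -- Counting the edges that are changed

  ∑-pairs-map : ∀ (h : A → B) (xs : List A) (f : B × B → ℤ) →
    ∑ (pairs (map h xs)) f ≡ ∑ (pairs xs) (λ p → f (h (proj₁ p) , h (proj₂ p)))
  ∑-pairs-map h []       f = refl
  ∑-pairs-map h (x ∷ xs) f = trans (∑-++ (map (h x ,_) (map h xs)) _ f)
    (trans (cong₂ _+_
        (trans (∑-map (h x ,_) (map h xs) f) (trans (∑-map h xs _) (sym (∑-map (x ,_) xs _))))
        (∑-pairs-map h xs f))
      (sym (∑-++ (map (x ,_) xs) _ _)))

  ∑-pairs-++ : ∀ (xs ys : List A) (f : A × A → ℤ) →
    ∑ (pairs (xs ++ ys)) f ≡ ∑ (pairs xs) f + (∑₂ xs ys (λ x y → f (x , y)) + ∑ (pairs ys) f)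
  ∑-pairs-++ []       ys f = sym (trans (ℤP.+-identityˡ _) (ℤP.+-identityˡ _))
  ∑-pairs-++ (x ∷ xs) ys f = begin
    ∑ (map (x ,_) (xs ++ ys) ++ pairs (xs ++ ys)) f
      ≡⟨ ∑-++ (map (x ,_) (xs ++ ys)) _ f ⟩
    ∑ (map (x ,_) (xs ++ ys)) f + ∑ (pairs (xs ++ ys)) f
      ≡⟨ cong₂ _+_ (trans (∑-map (x ,_) (xs ++ ys) f) (∑-++ xs ys _)) (∑-pairs-++ xs ys f) ⟩
    (∑ xs (λ y → f (x , y)) + ∑ ys (λ y → f (x , y)))
      + (∑ (pairs xs) f + (∑₂ xs ys (λ x y → f (x , y)) + ∑ (pairs ys) f))
      ≡⟨ regroup (∑ xs (λ y → f (x , y))) _ _ _ _ ⟩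
    (∑ xs (λ y → f (x , y)) + ∑ (pairs xs) f)
      + (∑ ys (λ y → f (x , y)) + ∑₂ xs ys (λ x y → f (x , y)) + ∑ (pairs ys) f)
      ≡⟨ cong (_+ (∑₂ (x ∷ xs) ys (λ x y → f (x , y)) + ∑ (pairs ys) f)) (sym (trans (∑-++ (map (x ,_) xs) _ f) (cong (_+ ∑ (pairs xs) f) (∑-map (x ,_) xs f)))) ⟩
    ∑ (pairs (x ∷ xs)) f + (∑₂ (x ∷ xs) ys (λ x y → f (x , y)) + ∑ (pairs ys) f) ∎
    where
    open ≡-Reasoning
    regroup : ∀ a b c d e → (a + b) + (c + (d + e)) ≡ (a + c) + (b + d + e)
    regroup = solve-∀

  -- In `allGVtx` every `inj₁` precedes every `inj₂`, so `pairs` lists each crossing pair exactly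
  -- once and in this orientation. The count of unordered edges thus becomes a plain triple sum.
  count-pairs : ∀ n (p : GVtx n → GVtx n → Bool) →
    (∀ u u′ → p (inj₁ u) (inj₁ u′) ≡ false) → (∀ v v′ → p (inj₂ v) (inj₂ v′) ≡ false) →
    + count (λ q → p (proj₁ q) (proj₂ q)) (pairs (allGVtx n)) ≡
      ∑ (allFin n) (λ u → ∑₂ (allFin n) (allFin n) (λ v w → 𝟙 (p (inj₁ u) (inj₂ (v , w)))))
  count-pairs n p no₁₁ no₂₂ = begin
    + count (λ q → p (proj₁ q) (proj₂ q)) (pairs (allGVtx n))
      ≡⟨ #-mask _ (pairs (allGVtx n)) ⟩
    ∑ (pairs (allGVtx n)) f
      ≡⟨ ∑-pairs-++ (map inj₁ (allFin n)) (map inj₂ squares) f ⟩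
    ∑ (pairs (map inj₁ (allFin n))) f
      + (∑₂ (map inj₁ (allFin n)) (map inj₂ squares) (λ x y → f (x , y)) + ∑ (pairs (map inj₂ squares)) f)
      ≡⟨ cong₂ _+_ (none inj₁ (allFin n) no₁₁) (cong₂ _+_ crossing (none inj₂ squares no₂₂)) ⟩
    0ℤ + (∑ (allFin n) (λ u → ∑₂ (allFin n) (allFin n) (λ v w → 𝟙 (p (inj₁ u) (inj₂ (v , w))))) + 0ℤ)
      ≡⟨ trans (ℤP.+-identityˡ _) (ℤP.+-identityʳ _) ⟩
    ∑ (allFin n) (λ u → ∑₂ (allFin n) (allFin n) (λ v w → 𝟙 (p (inj₁ u) (inj₂ (v , w))))) ∎
    where
    open ≡-Reasoning
    f : GVtx n × GVtx n → ℤ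
    f q = 𝟙 (p (proj₁ q) (proj₂ q))
    squares = cartesianProduct (allFin n) (allFin n)
    none : ∀ {X : Set} (h : X → GVtx n) (xs : List X) → (∀ x y → p (h x) (h y) ≡ false) →
      ∑ (pairs (map h xs)) f ≡ 0ℤ
    none h xs eq = trans (∑-pairs-map h xs f)
      (trans (∑-cong (pairs xs) (λ q → cong 𝟙 (eq (proj₁ q) (proj₂ q)))) (∑-zero (pairs xs)))
    crossing : ∑₂ (map inj₁ (allFin n)) (map inj₂ squares) (λ x y → f (x , y)) ≡
      ∑ (allFin n) (λ u → ∑₂ (allFin n) (allFin n) (λ v w → 𝟙 (p (inj₁ u) (inj₂ (v , w)))))
    crossing = trans (∑-map inj₁ (allFin n) _) (∑-cong (allFin n) (λ u →
      trans (∑-map inj₂ squares _) (∑-cartesian (allFin n) (allFin n) _)))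

  numK3-sum : ∀ {n} (G : TriGraph n) → + numK3 G ≡
    ∑ (allFin n) (λ x → ∑₂ (allFin n) (allFin n) (λ y z → 𝟙 (inK3 G x y z)))
  numK3-sum {n} G = trans (#-mask _ (cartesianProduct (allFin n) (cartesianProduct (allFin n) (allFin n))))
    (trans (∑-cartesian (allFin n) _ _) (∑-cong (allFin n) (λ x → ∑-cartesian (allFin n) (allFin n) _)))

  GH-count : ∀ {n} (G : TriGraph n) i →
    count (λ q → GH G i (proj₁ q) (proj₂ q)) (pairs (allGVtx n)) ≡ numK3 G
  GH-count {n} G i = ℤP.+-injective (trans (count-pairs n (GH G i) (λ _ _ → refl) (λ _ _ → refl))
    (trans (orders i) (sym (numK3-sum G))))
    where
    orders : ∀ i → ∑ (allFin n) (λ u → ∑₂ (allFin n) (allFin n) (λ v w → 𝟙 (GH G i (inj₁ u) (inj₂ (v , w)))))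
      ≡ ∑ (allFin n) (λ x → ∑₂ (allFin n) (allFin n) (λ y z → 𝟙 (inK3 G x y z)))
    orders zero             = refl
    orders (suc zero)       = ∑-swap (allFin n) (allFin n) _
    orders (suc (suc zero)) = trans (∑-swap (allFin n) (allFin n) _)
      (∑-cong (allFin n) (λ x → ∑-swap (allFin n) (allFin n) _))

  #-allFin : ∀ n → # allFin n ≡ + n
  #-allFin n = cong +_ (length-tabulate {n = n} (λ i → i))

  #-allVtx : ∀ n → # allVtx n ≡ + 3 * + n
  #-allVtx n = trans (#≡∑1 (allVtx n)) (trans (∑-cartesian (allFin 3) (allFin n) _)
    (trans (∑₂-one (allFin 3) (allFin n)) (cong₂ _*_ (#-allFin 3) (#-allFin n))))

  term≤∑ : ∀ {k} (f : Fin k → ℤ) → (∀ i → 0ℤ ≤ f i) → ∀ i → f i ≤ ∑ (allFin k) f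
  term≤∑ {k} f 0≤f i = ≤-trans (≤-reflexive (sym (∑-delta i f)))
    (∑-mono (allFin k) (λ j → ≤-trans (*-monoʳ (0≤f j) (𝟙≤1 (does (i ≟F j)))) (≤-reflexive (ℤP.*-identityˡ (f j)))))

  ∑-at≤∑ : ∀ {n} (f : Vtx n → ℤ) → (∀ x → 0ℤ ≤ f x) → ∀ i → ∑ (allFin n) (λ u → f (i , u)) ≤ ∑ (allVtx n) f
  ∑-at≤∑ {n} f 0≤f i = ≤-trans
    (term≤∑ (λ i → ∑ (allFin n) (λ u → f (i , u))) (λ i → ∑-nonneg (allFin n) (λ u → 0≤f (i , u))) i)
    (≤-reflexive (sym (∑-cartesian (allFin 3) (allFin n) f)))

  ∑₂-at≤∑₂ : ∀ {n} (f : Vtx n → Vtx n → ℤ) → (∀ x y → 0ℤ ≤ f x y) → ∀ i j →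
    ∑₂ (allFin n) (allFin n) (λ u v → f (i , u) (j , v)) ≤ ∑₂ (allVtx n) (allVtx n) f
  ∑₂-at≤∑₂ {n} f 0≤f i j = ≤-trans
    (∑-mono (allFin n) (λ u → ∑-at≤∑ (f (i , u)) (0≤f (i , u)) j))
    (∑-at≤∑ (λ x → ∑ (allVtx n) (f x)) (λ x → ∑-nonneg (allVtx n) (0≤f x)) i)

  module Changes {n k : ℕ} (G : TriGraph n) (lab : Vtx n → Fin k) (ok : Fin k → Fin k → Bool) where

    lost : Vtx n → Vtx n → ℤ
    lost x y = 𝟙 (adj G x y ∧ not (ok (lab x) (lab y)))

    0≤lost : ∀ x y → 0ℤ ≤ lost x y
    0≤lost x y = 0≤𝟙 (adj G x y ∧ not (ok (lab x) (lab y)))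

    totalLost : ℤ
    totalLost = ∑₂ (allVtx n) (allVtx n) lost

    changed : Fin 3 → Fin n → Fin n → Fin n → Bool
    changed i u v w = GH G i (inj₁ u) (inj₂ (v , w)) xor
      (GH G i (inj₁ u) (inj₂ (v , w)) ∧
        (ok (lab (i , u)) (lab (idx2 i , v)) ∧
          (ok (lab (i , u)) (lab (idx3 i , w)) ∧ ok (lab (idx2 i , v)) (lab (idx3 i , w)))))

    -- A triangle that is discarded has an edge over a pair of cells that is not ok; this is the
    -- union bound over its three edges.
    changed≤lost : ∀ i u v w → 𝟙 (changed i u v w) ≤
      lost (i , u) (idx2 i , v) + (lost (i , u) (idx3 i , w) + lost (idx2 i , v) (idx3 i , w))
    changed≤lost i u v w rewrite GH-adj G i u v w =
      by-cases (adj G (i , u) (idx2 i , v)) (adj G (i , u) (idx3 i , w)) (adj G (idx2 i , v) (idx3 i , w)) _ _ _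
      where
      0≤sum : ∀ p q r → 0ℤ ≤ 𝟙 p + (𝟙 q + 𝟙 r)
      0≤sum p q r = 0≤+ (0≤𝟙 p) (0≤+ (0≤𝟙 q) (0≤𝟙 r))
      by-cases : ∀ a b g o₁ o₂ o₃ → 𝟙 ((a ∧ (b ∧ g)) xor ((a ∧ (b ∧ g)) ∧ (o₁ ∧ (o₂ ∧ o₃)))) ≤
        𝟙 (a ∧ not o₁) + (𝟙 (b ∧ not o₂) + 𝟙 (g ∧ not o₃))
      by-cases false b     g     o₁    o₂    o₃    = 0≤sum false (b ∧ not o₂) (g ∧ not o₃)
      by-cases true  false g     o₁    o₂    o₃    = 0≤sum (not o₁) false (g ∧ not o₃)
      by-cases true  true  false o₁    o₂    o₃    = 0≤sum (not o₁) (not o₂) false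
      by-cases true  true  true  true  true  true  = ≤-refl
      by-cases true  true  true  true  true  false = ≤-refl
      by-cases true  true  true  true  false true  = ≤-refl
      by-cases true  true  true  true  false false = +≤+ (ℕ.s≤s ℕ.z≤n)
      by-cases true  true  true  false o₂    o₃    = ℤP.+-monoʳ-≤ 1ℤ (0≤+ (0≤𝟙 (not o₂)) (0≤𝟙 (not o₃)))

    -- A lost edge extends to n triples by the choice of the third vertex. Since `totalLost` runs
    -- over all ordered vertex pairs, it bounds the loss at each of the three positions.
    ∑-changed≤ : ∀ i → ∑ (allFin n) (λ u → ∑₂ (allFin n) (allFin n) (λ v w → 𝟙 (changed i u v w)))
      ≤ + 3 * (+ n * totalLost)
    ∑-changed≤ i = begin
      ∑ (allFin n) (λ u → ∑₂ (allFin n) (allFin n) (λ v w → 𝟙 (changed i u v w)))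
        ≤⟨ ∑-mono (allFin n) (λ u → ∑₂-mono (allFin n) (allFin n) (changed≤lost i u)) ⟩
      ∑ (allFin n) (λ u → ∑₂ (allFin n) (allFin n) (λ v w → a u v + (b u w + c v w)))
        ≡⟨ ∑-cong (allFin n) (λ u → trans (∑₂-+ (allFin n) (allFin n) (λ v _ → a u v) (λ v w → b u w + c v w))
             (cong (_+_ (∑₂ (allFin n) (allFin n) (λ v _ → a u v))) (∑₂-+ (allFin n) (allFin n) (λ _ w → b u w) c))) ⟩
      ∑ (allFin n) (λ u → ∑₂ (allFin n) (allFin n) (λ v _ → a u v) +
        (∑₂ (allFin n) (allFin n) (λ _ w → b u w) + ∑₂ (allFin n) (allFin n) c))
        ≡⟨ trans (∑-+ (allFin n) _ _) (cong (_+_ (∑ (allFin n) (λ u → ∑₂ (allFin n) (allFin n) (λ v _ → a u v)))) (∑-+ (allFin n) _ _)) ⟩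
      ∑ (allFin n) (λ u → ∑₂ (allFin n) (allFin n) (λ v _ → a u v)) +
        (∑ (allFin n) (λ u → ∑₂ (allFin n) (allFin n) (λ _ w → b u w)) + ∑ (allFin n) (λ _ → ∑₂ (allFin n) (allFin n) c))
        ≤⟨ +-mono-≤ first (+-mono-≤ second third) ⟩
      + n * totalLost + (+ n * totalLost + + n * totalLost)
        ≡⟨ triple (+ n * totalLost) ⟩
      + 3 * (+ n * totalLost) ∎
      where
      open ≤-Reasoning
      a = λ u v → lost (i , u) (idx2 i , v)
      b = λ u w → lost (i , u) (idx3 i , w)
      c = λ v w → lost (idx2 i , v) (idx3 i , w)
      triple : ∀ z → z + (z + z) ≡ + 3 * z
      triple = solve-∀
      n-times : ∀ z → ∑ (allFin n) (λ _ → z) ≡ + n * z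
      n-times z = trans (∑-const (allFin n) z) (cong (_* z) (#-allFin n))
      at≤ : ∀ j j′ → + n * ∑₂ (allFin n) (allFin n) (λ u v → lost (j , u) (j′ , v)) ≤ + n * totalLost
      at≤ j j′ = *-monoˡ (0≤+n {n}) (∑₂-at≤∑₂ lost 0≤lost j j′)
      first : ∑ (allFin n) (λ u → ∑₂ (allFin n) (allFin n) (λ v _ → a u v)) ≤ + n * totalLost
      first = ≤-trans (≤-reflexive (trans
        (∑-cong (allFin n) (λ u → trans (∑-cong (allFin n) (λ v → n-times (a u v))) (∑-*ˡ (allFin n) (+ n) (a u))))
        (∑-*ˡ (allFin n) (+ n) _))) (at≤ i (idx2 i))
      second : ∑ (allFin n) (λ u → ∑₂ (allFin n) (allFin n) (λ _ w → b u w)) ≤ + n * totalLost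
      second = ≤-trans (≤-reflexive (trans
        (∑-cong (allFin n) (λ u → n-times (∑ (allFin n) (b u))))
        (∑-*ˡ (allFin n) (+ n) _))) (at≤ i (idx3 i))
      third : ∑ (allFin n) (λ _ → ∑₂ (allFin n) (allFin n) c) ≤ + n * totalLost
      third = ≤-trans (≤-reflexive (n-times _)) (at≤ (idx2 i) (idx3 i))

  module LostMass {n k : ℕ} (G : TriGraph n) {N h : ℤ} (1≤N : 1ℤ ≤ N) (1≤h : 1ℤ ≤ h)
      (lab : Vtx n → Fin k) (φ : Fin k → Fin k → ℤ) (reg : Fin k → Fin k → Bool)
      (reg-sound : ∀ X Y → reg X Y ≡ true →
        Regular (+ 54 * N * h) (φ X Y) (part _≟F_ (allVtx n) lab X) (part _≟F_ (allVtx n) lab Y) (adj G))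
      (few-bad : + 54 * N * ∑₂ (allVtx n) (allVtx n) (λ x y → 𝟙 (not (reg (lab x) (lab y))))
        ≤ # allVtx n * # allVtx n) where

    private
      V = allVtx n
      v = # V * # V
      cell = part _≟F_ V lab
      0≤N = ≤-trans 0≤+n 1≤N
      0≤h = ≤-trans 0≤+n 1≤h
      M = + 54 * N * h

    ok light : Fin k → Fin k → Bool
    ok X Y = reg X Y ∧ does (h ℤP.≤? φ X Y)
    light X Y = reg X Y ∧ not (does (h ℤP.≤? φ X Y))

    open Changes G lab ok

    lightMass : ℤ
    lightMass = ∑₂ V V (λ x y → 𝟙 (light (lab x) (lab y)) * 𝟙 (adj G x y))

    -- On a light pair φ ≤ h - 1, and regularity on the whole pair adds at most one more unit.
    lightMass≤ : M * lightMass ≤ h * v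
    lightMass≤ = begin
      M * lightMass
        ≡⟨ sym (∑₂-*ˡ V V M _) ⟩
      ∑₂ V V (λ x y → M * (𝟙 (light (lab x) (lab y)) * 𝟙 (adj G x y)))
        ≤⟨ ∑₂-cells-mono V lab (λ X Y x y → M * (𝟙 (light X Y) * 𝟙 (adj G x y))) (λ _ _ _ _ → h * 1ℤ)
             (λ X Y → ≤-trans (on-cells X Y (light X Y) refl) (≤-reflexive (sym (h-times (cell X) (cell Y))))) ⟩
      ∑₂ V V (λ _ _ → h * 1ℤ)
        ≡⟨ h-times V V ⟩
      h * v ∎
      where
      open ≤-Reasoning
      h-times : ∀ (xs ys : List (Vtx n)) → ∑₂ xs ys (λ _ _ → h * 1ℤ) ≡ h * (# xs * # ys)
      h-times xs ys = trans (∑₂-*ˡ xs ys h _) (cong (_*_ h) (∑₂-one xs ys))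
      certificate : ∀ h φ k → h * k ≡ (φ * k + k) + (h - (1ℤ + φ)) * k
      certificate = solve-∀
      on-cells : ∀ X Y b → light X Y ≡ b →
        ∑₂ (cell X) (cell Y) (λ x y → M * (𝟙 b * 𝟙 (adj G x y))) ≤ h * (# cell X * # cell Y)
      on-cells X Y false _ = ≤-trans
        (≤-reflexive (trans (∑₂-*ˡ (cell X) (cell Y) M _) (trans (cong (_*_ M)
          (trans (∑-cong (cell X) (λ _ → ∑-zero (cell Y))) (∑-zero (cell X)))) (ℤP.*-zeroʳ M))))
        (0≤* 0≤h (0≤* (0≤# (cell X)) (0≤# (cell Y))))
      on-cells X Y true  eq = begin
        ∑₂ (cell X) (cell Y) (λ x y → M * (1ℤ * 𝟙 (adj G x y)))
          ≡⟨ ∑₂-*ˡ (cell X) (cell Y) M _ ⟩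
        M * edges (cell X) (cell Y) (adj G) all all
          ≤⟨ Regular-upper (reg-sound X Y (∧-trueˡ eq)) all all ⟩
        φ X Y * (∑ (cell X) (𝟙 ∘ all) * ∑ (cell Y) (𝟙 ∘ all)) + # cell X * # cell Y
          ≡⟨ cong (λ z → φ X Y * z + # cell X * # cell Y) (cong₂ _*_ (∑-all (cell X)) (∑-all (cell Y))) ⟩
        φ X Y * (# cell X * # cell Y) + # cell X * # cell Y
          ≤⟨ ≤-by _ (0≤* (0≤b-a (ℤP.i<j⇒suc[i]≤j low)) (0≤* (0≤# (cell X)) (0≤# (cell Y))))
               (certificate h (φ X Y) (# cell X * # cell Y)) ⟩
        h * (# cell X * # cell Y) ∎
        where
        low : φ X Y < h
        low = ℤP.≰⇒> (does-false (h ℤP.≤? φ X Y)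
          (trans (sym (not-involutive _)) (cong not (∧-trueʳ {reg X Y} eq))))

    -- Irregular pairs contribute at most v/(54N) by `few-bad`, and edges over light pairs at most
    -- hv/M, which is again v/(54N) by the choice of M.
    totalLost≤ : + 54 * N * totalLost ≤ + 2 * v
    totalLost≤ = *-cancelˡ 1≤h (≤-by _
      (0≤+ (0≤* 0≤h (0≤b-a few-bad)) (0≤+ (0≤b-a lightMass≤)
        (0≤* 0≤h (0≤* (0≤* (0≤+n {54}) 0≤N) (0≤b-a split)))))
      (certificate N h totalLost _ lightMass v))
      where
      certificate : ∀ N h t b l v → h * (+ 2 * v) ≡ h * (+ 54 * N * t) +
        (h * (v - + 54 * N * b) + (h * v - + 54 * N * h * l + h * (+ 54 * N * (b + l - t))))
      certificate = solve-∀
      pointwise : ∀ a r d → 𝟙 (a ∧ not (r ∧ d)) ≤ 𝟙 (not r) + 𝟙 (r ∧ not d) * 𝟙 a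
      pointwise false false d     = 0≤+n
      pointwise true  false d     = ≤-refl
      pointwise false true  true  = ≤-refl
      pointwise false true  false = ≤-refl
      pointwise true  true  true  = ≤-refl
      pointwise true  true  false = ≤-refl
      split : totalLost ≤ ∑₂ V V (λ x y → 𝟙 (not (reg (lab x) (lab y)))) + lightMass
      split = ≤-trans (∑₂-mono V V (λ x y → pointwise (adj G x y) (reg (lab x) (lab y)) _))
        (≤-reflexive (∑₂-+ V V _ _))

    -- This is the origin of the constant 54. As |V|² = 9n², at most 18n²/(54N) = n²/(3N) ordered
    -- pairs are lost; three positions with n extensions each make n³/N.
    few-changes : ∀ i →
      N * ∑ (allFin n) (λ u → ∑₂ (allFin n) (allFin n) (λ v w → 𝟙 (changed i u v w))) ≤ + n * + n * + n
    few-changes i = *-cancelˡ {+ 18} (+≤+ (ℕ.s≤s ℕ.z≤n)) (≤-by _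
      (0≤+ (0≤* (0≤+n {18}) (0≤* 0≤N (0≤b-a (∑-changed≤ i))))
           (0≤* (0≤+n {n}) (0≤b-a (subst (λ z → + 54 * N * totalLost ≤ + 2 * (z * z)) (#-allVtx n) totalLost≤))))
      (certificate N (+ n) _ totalLost))
      where
      certificate : ∀ N n c t → + 18 * (n * n * n) ≡ + 18 * (N * c) +
        (+ 18 * (N * (+ 3 * (n * t) - c)) + n * (+ 2 * (+ 3 * n * (+ 3 * n)) - + 54 * N * t))
      certificate = solve-∀

  -- The decomposition with integer parameters

  record RegularDecomposition (N : ℤ) {n : ℕ} (G : TriGraph n) (V₀ : VPartition n) (size : ℕ) : Set where
    field
      𝒫              : Decomposition n
      refines        : Refines (Decomposition.P1 𝒫) V₀
      refines-parts  : RefinesParts (Decomposition.P1 𝒫)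
      small          : VPartition.k (Decomposition.P1 𝒫) ℕ.≤ size
      good           : ∀ X Y l → HalfRegular N
        (part _≟F_ (allVtx n) (VPartition.lab (Decomposition.P1 𝒫)) X)
        (part _≟F_ (allVtx n) (VPartition.lab (Decomposition.P1 𝒫)) Y)
        (λ a b → does (Decomposition.sub 𝒫 a b ≟N l))
      E′             : Fin 3 → GVtx n → GVtx n → Bool
      E′-sym         : ∀ i x y → E′ i x y ≡ E′ i y x
      E′-close       : ∀ i → N * + count (λ q → GH G i (proj₁ q) (proj₂ q) xor E′ i (proj₁ q) (proj₂ q))
        (pairs (allGVtx n)) ≤ + n * + n * + n
      E′-regular     : ∀ i a b → HalfRegular N
        (part (PLabel-≟ _) (allGVtx n) (inducedLab 𝒫 i) a)
        (part (PLabel-≟ _) (allGVtx n) (inducedLab 𝒫 i) b) (E′ i)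

  module Decompose {N h : ℤ} (1≤N : 1ℤ ≤ N) (1≤h : 1ℤ ≤ h)
      (const : + 18 * ((+ 54 * N * h) * (+ 54 * N * h)) * (N * N) ≤ h * h * (h - 1ℤ))
      (2N²≤h-1 : + 2 * (N * N) ≤ h - 1ℤ)
      (steps : ℕ) (steps≡ : + steps ≡ + 54 * N * ((+ 54 * N * h) * (+ 54 * N * h))) where

    M K : ℤ
    M = + 54 * N * h
    K = + 54 * N

    private
      0≤N = ≤-trans 0≤+n 1≤N
      0≤h = ≤-trans 0≤+n 1≤h
      0≤K = 0≤* (0≤+n {54}) 0≤N
      0≤M = 0≤* 0≤K 0≤h
      1≤M : 1ℤ ≤ M
      1≤M = *-mono {1ℤ} {K} {1ℤ} {h} 0≤+n 0≤h (*-mono {1ℤ} {+ 54} {1ℤ} {N} 0≤+n 0≤N (+≤+ (ℕ.s≤s ℕ.z≤n)) 1≤N) 1≤h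
      4hN≤M : + 4 * (h * N) ≤ M
      4hN≤M = ≤-by _ (0≤* (0≤+n {50}) (0≤* 0≤h 0≤N)) (identity N h)
        where
        identity : ∀ N h → + 54 * N * h ≡ + 4 * (h * N) + + 50 * (h * N)
        identity = solve-∀

    decompose : ∀ {n} (G : TriGraph n) (V₀ : VPartition n) → RefinesParts V₀ →
      ∀ j → VPartition.k V₀ ℕ.≤ Tsh 3 j → RegularDecomposition N G V₀ (Tsh 3 (j ℕ.+ (steps ℕ.+ steps)))
    decompose {n} G V₀ parts j k₀≤ = record
      { 𝒫 = C.decomposition ; refines = refines ; refines-parts = tripartite ; small = k≤size
      ; good = C.good ; E′ = C.E′ ; E′-sym = C.E′-sym
      ; E′-close = λ i → subst (λ z → N * z ≤ + n * + n * + n)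
          (sym (count-pairs n (λ x y → GH G i x y xor C.E′ i x y) (λ _ _ → refl) (λ _ _ → refl)))
          (LostMass.few-changes G 1≤N 1≤h lab φ reg reg-sound few-bad i)
      ; E′-regular = C.regular-for-H }
      where
      V = allVtx n
      zeroTable : Fin (VPartition.k V₀) → Fin (VPartition.k V₀) → ℤ
      zeroTable _ _ = 0ℤ
      open RegularityLemma (searchable-Vtx n) V (adj G) {M} {K} 0≤K
      square-bound : ∀ b → (M * 𝟙 b - 0ℤ) * (M * 𝟙 b - 0ℤ) ≤ M * M * 1ℤ
      square-bound true  = ≤-reflexive (identity M)
        where
        identity : ∀ M → (M * 1ℤ - 0ℤ) * (M * 1ℤ - 0ℤ) ≡ M * M * 1ℤ
        identity = solve-∀
      square-bound false = ≤-by (M * M * 1ℤ) (0≤* (0≤* 0≤M 0≤M) (0≤+n {1})) (identity M)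
        where
        identity : ∀ M → M * M * 1ℤ ≡ (M * 0ℤ - 0ℤ) * (M * 0ℤ - 0ℤ) + M * M * 1ℤ
        identity = solve-∀
      initial : K * potential (VPartition.lab V₀) zeroTable ≤ + steps * (# V * # V)
      initial = begin
        K * potential (VPartition.lab V₀) zeroTable
          ≤⟨ *-monoˡ 0≤K (∑₂-mono V V (λ x y → square-bound (adj G x y))) ⟩
        K * ∑₂ V V (λ _ _ → M * M * 1ℤ)
          ≡⟨ cong (_*_ K) (trans (∑₂-*ˡ V V (M * M) _) (cong (_*_ (M * M)) (∑₂-one V V))) ⟩
        K * (M * M * (# V * # V))
          ≡⟨ sym (ℤP.*-assoc K (M * M) (# V * # V)) ⟩
        K * (M * M) * (# V * # V)
          ≡⟨ cong (_* (# V * # V)) (sym steps≡) ⟩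
        + steps * (# V * # V) ∎
        where open ≤-Reasoning
      raw : RegularLabelling M K V (adj G) (Tsh 3 (j ℕ.+ (steps ℕ.+ steps))) (VPartition.lab V₀)
      raw = iterate steps 3 j (VPartition.lab V₀) zeroTable k₀≤ ℕP.≤-refl initial
      factor : SurjectiveFactor (RegularLabelling.lab raw)
      factor = surjectiveFactor hit-Vtx? (RegularLabelling.lab raw)
      open RegularLabelling (Compress.compressed raw factor)
      tripartite : ∀ x y → lab x ≡ lab y → proj₁ x ≡ proj₁ y
      tripartite x y eq = parts x y (refines x y eq)
      module C = Construction G 1≤N 1≤M 0≤h const 2N²≤h-1 4hN≤M lab (SurjectiveFactor.surj factor)
        tripartite φ reg reg-sound

  -- Rational arithmetic

  -- `_/_` reduces to lowest terms, which hides the given numerator and denominator; the comparison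
  -- is therefore made on unnormalised fractions.
  /-mono : ∀ a c b d → a * + suc d ≤ b * + suc c → a / suc c ℚ.≤ b / suc d
  /-mono a c b d le = ℚP.toℚᵘ-cancel-≤ (begin
    toℚᵘ (a / suc c)   ≃⟨ ℚP.toℚᵘ-fromℚᵘ (mkℚᵘ a c) ⟩
    mkℚᵘ a c           ≤⟨ ℚᵘ.*≤* le ⟩
    mkℚᵘ b d           ≃⟨ ℚP.toℚᵘ-fromℚᵘ (mkℚᵘ b d) ⟨
    toℚᵘ (b / suc d)   ∎)
    where open ℚᵘP.≤-Reasoning

  /-cancel : ∀ a c b d → a / suc c ℚ.≤ b / suc d → a * + suc d ≤ b * + suc c
  /-cancel a c b d le = ℚᵘP.drop-*≤* (begin
    mkℚᵘ a c           ≃⟨ ℚP.toℚᵘ-fromℚᵘ (mkℚᵘ a c) ⟨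
    toℚᵘ (a / suc c)   ≤⟨ ℚP.toℚᵘ-mono-≤ le ⟩
    toℚᵘ (b / suc d)   ≃⟨ ℚP.toℚᵘ-fromℚᵘ (mkℚᵘ b d) ⟩
    mkℚᵘ b d           ∎)
    where open ℚᵘP.≤-Reasoning

  /-* : ∀ a c b d → (a / suc c) ℚ.* (b / suc d) ≡ (a * b) / (suc c ℕ.* suc d)
  /-* a c b d = ℚP.toℚᵘ-injective (begin
    toℚᵘ ((a / suc c) ℚ.* (b / suc d))
      ≈⟨ ℚP.toℚᵘ-homo-* (a / suc c) (b / suc d) ⟩
    toℚᵘ (a / suc c) ℚᵘ.* toℚᵘ (b / suc d)
      ≈⟨ ℚᵘP.*-cong (ℚP.toℚᵘ-fromℚᵘ (mkℚᵘ a c)) (ℚP.toℚᵘ-fromℚᵘ (mkℚᵘ b d)) ⟩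
    mkℚᵘ a c ℚᵘ.* mkℚᵘ b d
      ≈⟨ ℚP.toℚᵘ-fromℚᵘ (mkℚᵘ a c ℚᵘ.* mkℚᵘ b d) ⟨
    toℚᵘ ((a * b) / (suc c ℕ.* suc d)) ∎)
    where open ℚᵘP.≃-Reasoning

  ℕ→ℚ-mono : ∀ {m n} → m ℕ.≤ n → ℕ→ℚ m ℚ.≤ ℕ→ℚ n
  ℕ→ℚ-mono {m} {n} m≤n = /-mono (+ m) 0 (+ n) 0 (*-monoʳ (0≤+n {1}) (+≤+ m≤n))

  ℕ→ℚ-cancel : ∀ {m n} → ℕ→ℚ m ℚ.≤ ℕ→ℚ n → m ℕ.≤ n
  ℕ→ℚ-cancel {m} {n} le = ℤP.drop‿+≤+ (subst₂ _≤_ (ℤP.*-identityʳ (+ m)) (ℤP.*-identityʳ (+ n)) (/-cancel (+ m) 0 (+ n) 0 le))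

  ℕ→ℚ-* : ∀ m n → ℕ→ℚ (m ℕ.* n) ≡ ℕ→ℚ m ℚ.* ℕ→ℚ n
  ℕ→ℚ-* m n = sym (trans (/-* (+ m) 0 (+ n) 0) (cong (_/ 1) (sym (ℤP.pos-* m n))))

  0≤ℕ→ℚ : ∀ n → 0ℚ ℚ.≤ ℕ→ℚ n
  0≤ℕ→ℚ n = ℕ→ℚ-mono {0} {n} ℕ.z≤n

  ℚ-*-monoˡ : ∀ {r p q} → 0ℚ ℚ.≤ r → p ℚ.≤ q → r ℚ.* p ℚ.≤ r ℚ.* q
  ℚ-*-monoˡ {r} 0≤r = ℚP.*-monoˡ-≤-nonNeg r ⦃ ℚ.nonNegative 0≤r ⦄

  ℚ-*-monoʳ : ∀ {r p q} → 0ℚ ℚ.≤ r → p ℚ.≤ q → p ℚ.* r ℚ.≤ q ℚ.* r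
  ℚ-*-monoʳ {r} 0≤r = ℚP.*-monoʳ-≤-nonNeg r ⦃ ℚ.nonNegative 0≤r ⦄

  -- From cleared denominators to rational densities

  #-masked-edges : ∀ (U : List A) (W : List B) E (s : A → Bool) (t : B → Bool) →
    + eB E (filter (λ x → s x ≟B true) U) (filter (λ y → t y ≟B true) W) ≡ edges U W E s t
  #-masked-edges U W E s t = begin
    + eB E U′ W′
      ≡⟨ trans (#-mask _ (cartesianProduct U′ W′)) (∑-cartesian U′ W′ _) ⟩
    ∑₂ U′ W′ (λ u w → 𝟙 (E u w))
      ≡⟨ trans (∑-mask s U _) (∑-cong U (λ u → cong (_*_ (𝟙 (s u))) (∑-mask t W _))) ⟩
    ∑ U (λ u → 𝟙 (s u) * ∑ W (λ w → 𝟙 (t w) * 𝟙 (E u w)))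
      ≡⟨ ∑-cong U (λ u → sym (∑-*ˡ W (𝟙 (s u)) _)) ⟩
    ∑₂ U W (λ u w → 𝟙 (s u) * (𝟙 (t w) * 𝟙 (E u w)))
      ≡⟨ ∑₂-cong U W (λ u w → sym (ℤP.*-assoc (𝟙 (s u)) (𝟙 (t w)) (𝟙 (E u w)))) ⟩
    edges U W E s t ∎
    where
    open ≡-Reasoning
    U′ = filter (λ x → s x ≟B true) U
    W′ = filter (λ y → t y ≟B true) W

  #-edges : ∀ (U : List A) (W : List B) E → + eB E U W ≡ edges U W E all all
  #-edges U W E = trans (#-mask _ (cartesianProduct U W)) (trans (∑-cartesian U W _)
    (∑₂-cong U W (λ u w → sym (ℤP.*-identityˡ (𝟙 (E u w))))))

  ½ : ℚ
  ½ = (+ 1) / 2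

  0≤dens : ∀ e m → 0ℚ ℚ.≤ dens e m
  0≤dens e zero    = ℚP.≤-refl
  0≤dens e (suc m) = /-mono 0ℤ 0 (+ e) m (0≤* {+ e} {1ℤ} 0≤+n 0≤+n)

  -- `dens` is 0 by convention when a side is empty. The bound could fail if only the smaller
  -- rectangle were empty, and the first hypothesis excludes this.
  half-dens : ∀ e m e′ m′ → (m′ ≡ 0 → m ≡ 0) → + e * + m′ ≤ + 2 * (+ e′ * + m) →
    dens e m ℚ.* ½ ℚ.≤ dens e′ m′
  half-dens e zero    e′ m′       _     _  = subst (ℚ._≤ dens e′ m′) (sym (ℚP.*-zeroˡ ½)) (0≤dens e′ m′)
  half-dens e (suc m) e′ zero     empty _  with () ← empty refl
  half-dens e (suc m) e′ (suc m′) _     le = subst (ℚ._≤ dens e′ (suc m′)) (sym (/-* (+ e) m (+ 1) 1))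
    (/-mono (+ e * + 1) (1 ℕ.+ m ℕ.* 2) (+ e′) m′
      (subst₂ _≤_ (cong (_* + suc m′) (sym (ℤP.*-identityʳ (+ e))))
        (trans (regroup (+ e′) (+ suc m)) (cong (_*_ (+ e′)) (sym (ℤP.pos-* (suc m) 2)))) le))
    where
    regroup : ∀ e m → + 2 * (e * m) ≡ e * (m * + 2)
    regroup = solve-∀

  -- All that is asked of δ is that a set of relative size δ also has relative size 1/N. The same
  -- hypothesis shows that such a subset is empty only if the whole side is.
  HalfRegular⇒IsRegBigraph : ∀ {δ N} → (∀ a b → δ ℚ.* ℕ→ℚ a ℚ.≤ ℕ→ℚ b → a ℕ.≤ N ℕ.* b) →
    ∀ {A B : Set} {U : List A} {W : List B} {E} → HalfRegular (+ N) U W E → IsRegBigraph δ U W E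
  HalfRegular⇒IsRegBigraph {δ} {N} scale {U = U} {W} {E} half s t hU hW =
    half-dens (eB E U W) (length U ℕ.* length W) (eB E U′ W′) (length U′ ℕ.* length W′) nonempty
      (subst₂ _≤_
        (cong₂ _*_ (sym (#-edges U W E)) (trans (cong₂ _*_ (sym (#-mask s U)) (sym (#-mask t W)))
          (sym (ℤP.pos-* (length U′) (length W′)))))
        (cong₂ (λ e k → + 2 * (e * k)) (sym (#-masked-edges U W E s t)) (sym (ℤP.pos-* (length U) (length W))))
        (inherits half s t (toℤ s U (scale _ _ hU)) (toℤ t W (scale _ _ hW))))
    where
    U′ = filter (λ x → s x ≟B true) U
    W′ = filter (λ y → t y ≟B true) W
    toℤ : ∀ {C : Set} (r : C → Bool) (xs : List C) →
      length xs ℕ.≤ N ℕ.* length (filter (λ x → r x ≟B true) xs) → # xs ≤ + N * ∑ xs (𝟙 ∘ r)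
    toℤ r xs le = subst (# xs ≤_) (trans (ℤP.pos-* N _) (cong (_*_ (+ N)) (#-mask r xs))) (+≤+ le)
    vanishes : ∀ {a b} → δ ℚ.* ℕ→ℚ a ℚ.≤ ℕ→ℚ b → b ≡ 0 → a ≡ 0
    vanishes {a} le refl = ℕP.n≤0⇒n≡0 (subst (a ℕ.≤_) (ℕP.*-zeroʳ N) (scale a 0 le))
    nonempty : length U′ ℕ.* length W′ ≡ 0 → length U ℕ.* length W ≡ 0
    nonempty eq with ℕP.m*n≡0⇒m≡0∨n≡0 (length U′) eq
    ... | inj₁ U′≡0 = cong (ℕ._* length W) (vanishes {length U} {length U′} hU U′≡0)
    ... | inj₂ W′≡0 = trans (cong (length U ℕ.*_) (vanishes {length W} {length W′} hW W′≡0)) (ℕP.*-zeroʳ (length U))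

  -- Choice of the parameters

  /-monoℕ : ∀ a c b d → a ℕ.* suc d ℕ.≤ b ℕ.* suc c → (+ a) / suc c ℚ.≤ (+ b) / suc d
  /-monoℕ a c b d le = /-mono (+ a) c (+ b) d (subst₂ _≤_ (ℤP.pos-* a (suc d)) (ℤP.pos-* b (suc c)) (+≤+ le))

  /-cancelℕ : ∀ a c b d → (+ a) / suc c ℚ.≤ (+ b) / suc d → a ℕ.* suc d ℕ.≤ b ℕ.* suc c
  /-cancelℕ a c b d le = ℤP.drop‿+≤+ (subst₂ _≤_ (sym (ℤP.pos-* a (suc d))) (sym (ℤP.pos-* b (suc c)))
    (/-cancel (+ a) c (+ b) d le))

  ℕ→ℚ-*/ : ∀ m a d → ℕ→ℚ m ℚ.* ((+ a) / suc d) ≡ (+ (m ℕ.* a)) / suc d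
  ℕ→ℚ-*/ m a d = trans (/-* (+ m) 0 (+ a) d)
    (ℚP./-cong (sym (ℤP.pos-* m a)) (ℕP.*-identityˡ (suc d)))

  -- For q = a/d the witness ⌊d/a⌋ + 1 lies between 1/q and 1/q + 1, and q ≤ 1 turns the latter into
  -- Nq ≤ 2.
  bracket : ∀ q → 0ℚ ℚ.< q → q ℚ.≤ 1ℚ → ∃ λ N → 1ℚ ℚ.≤ ℕ→ℚ N ℚ.* q × ℕ→ℚ N ℚ.* q ℚ.≤ ℕ→ℚ 2
  bracket (mkℚ (+ zero) d _)      (ℚ.*<* lt) _ = ⊥-elim (ℤP.<-irrefl (sym (ℤP.*-zeroˡ (+ 1))) lt)
  bracket (mkℚ -[1+ _ ] d _)      (ℚ.*<* ()) _
  bracket q@(mkℚ (+ suc a) d _) _ q≤1 = N , lower , upper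
    where
    N = suc (suc d ℕ./ suc a)
    q≡ : q ≡ (+ suc a) / suc d
    q≡ = sym (ℚP.↥p/↧p≡p q)
    a≤d : suc a ℕ.≤ suc d
    a≤d = subst₂ ℕ._≤_ (ℕP.*-identityʳ (suc a)) (ℕP.*-identityˡ (suc d))
      (/-cancelℕ (suc a) d 1 0 (subst (ℚ._≤ 1ℚ) q≡ q≤1))
    lower : 1ℚ ℚ.≤ ℕ→ℚ N ℚ.* q
    lower = subst (1ℚ ℚ.≤_) (sym (trans (cong (ℕ→ℚ N ℚ.*_) q≡) (ℕ→ℚ-*/ N (suc a) d)))
      (/-monoℕ 1 0 (N ℕ.* suc a) d (begin
        1 ℕ.* suc d                                          ≡⟨ ℕP.*-identityˡ (suc d) ⟩
        suc d                                                ≡⟨ m≡m%n+[m/n]*n (suc d) (suc a) ⟩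
        suc d % suc a ℕ.+ suc d ℕ./ suc a ℕ.* suc a          ≤⟨ ℕP.+-monoˡ-≤ _ (ℕP.<⇒≤ (m%n<n (suc d) (suc a))) ⟩
        N ℕ.* suc a                                          ≡⟨ sym (ℕP.*-identityʳ _) ⟩
        N ℕ.* suc a ℕ.* 1                                    ∎))
      where open ℕP.≤-Reasoning
    upper : ℕ→ℚ N ℚ.* q ℚ.≤ ℕ→ℚ 2
    upper = subst (ℚ._≤ ℕ→ℚ 2) (sym (trans (cong (ℕ→ℚ N ℚ.*_) q≡) (ℕ→ℚ-*/ N (suc a) d)))
      (/-monoℕ (N ℕ.* suc a) d 2 0 (begin
        N ℕ.* suc a ℕ.* 1                          ≡⟨ ℕP.*-identityʳ _ ⟩
        suc a ℕ.+ suc d ℕ./ suc a ℕ.* suc a        ≤⟨ ℕP.+-mono-≤ a≤d (m/n*n≤m (suc d) (suc a)) ⟩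
        suc d ℕ.+ suc d                            ≡⟨ cong (suc d ℕ.+_) (sym (ℕP.+-identityʳ (suc d))) ⟩
        2 ℕ.* suc d                                ∎))
      where open ℕP.≤-Reasoning

  ≤recip : ∀ Q m → 0ℚ ℚ.< Q → ℕ→ℚ m ℚ.* Q ℚ.≤ 1ℚ → ℕ→ℚ m ℚ.≤ recip Q
  ≤recip (mkℚ (+ zero) d _)      m (ℚ.*<* lt) _ = ⊥-elim (ℤP.<-irrefl (sym (ℤP.*-zeroˡ (+ 1))) lt)
  ≤recip (mkℚ -[1+ _ ] d _)      m (ℚ.*<* ()) _
  ≤recip Q@(mkℚ (+ suc a) d _) m _ le = /-monoℕ m 0 (suc d) a
    (subst₂ ℕ._≤_ (ℕP.*-identityʳ _) (trans (ℕP.*-identityˡ (suc d)) (sym (ℕP.*-identityʳ (suc d))))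
      (/-cancelℕ (m ℕ.* suc a) d 1 0 (subst (ℚ._≤ 1ℚ)
        (trans (cong (ℕ→ℚ m ℚ.*_) (sym (ℚP.↥p/↧p≡p Q))) (ℕ→ℚ-*/ m (suc a) d)) le)))

  floor-lower : ∀ p → ℚ.⌊ p ⌋ * ↧ p ≤ ↥ p
  floor-lower p@record{} = ℤDM.[n/d]*d≤n (↥ p) (↧ p)

  -- The absolute value stems from `T3ℚ`. As the ceiling of r is minus the floor of -r, an upper
  -- bound for that floor is what is needed.
  ≤ceiling : ∀ r m → ℕ→ℚ m ℚ.≤ r → m ℕ.≤ ℤ.∣ ℚ.⌈ r ⌉ ∣
  ≤ceiling r@(mkℚ num d _) m le = ℤP.drop‿+≤+ (≤-trans m≤⌈r⌉ (i≤∣i∣ ℚ.⌈ r ⌉))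
    where
    i≤∣i∣ : ∀ i → i ≤ + ℤ.∣ i ∣
    i≤∣i∣ (+ n)    = ≤-refl
    i≤∣i∣ -[1+ n ] = ℤ.-≤+
    z = ℚ.⌊ ℚ.- r ⌋
    floor : z * + suc d ≤ - num
    floor = subst₂ _≤_ (cong (z *_) (ℚP.↧-neg r)) (ℚP.↥-neg r) (floor-lower (ℚ.- r))
    numerator : + m * + suc d ≤ num * 1ℤ
    numerator = /-cancel (+ m) 0 num d (subst (ℕ→ℚ m ℚ.≤_) (sym (ℚP.↥p/↧p≡p r)) le)
    identity : ∀ z n m D → D * (- z) ≡ D * m + ((n * 1ℤ - m * D) + (- n - z * D))
    identity = solve-∀
    m≤⌈r⌉ : + m ≤ - z
    m≤⌈r⌉ = *-cancelˡ {+ suc d} (+≤+ (ℕ.s≤s ℕ.z≤n)) (≤-by _ (0≤+ (0≤b-a numerator) (0≤b-a floor))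
      (identity z num (+ m) (+ suc d)))

  ^ℚ-distrib : ∀ p q m → (p ^ℚ m) ℚ.* (q ^ℚ m) ≡ (p ℚ.* q) ^ℚ m
  ^ℚ-distrib p q zero    = ℚP.*-identityˡ 1ℚ
  ^ℚ-distrib p q (suc m) = trans (interchange p (p ^ℚ m) q (q ^ℚ m)) (cong ((p ℚ.* q) ℚ.*_) (^ℚ-distrib p q m))
    where
    interchange : ∀ a b c d → (a ℚ.* b) ℚ.* (c ℚ.* d) ≡ (a ℚ.* c) ℚ.* (b ℚ.* d)
    interchange a b c d = begin
      (a ℚ.* b) ℚ.* (c ℚ.* d)   ≡⟨ ℚP.*-assoc a b (c ℚ.* d) ⟩
      a ℚ.* (b ℚ.* (c ℚ.* d))   ≡⟨ cong (a ℚ.*_) (sym (ℚP.*-assoc b c d)) ⟩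
      a ℚ.* (b ℚ.* c ℚ.* d)     ≡⟨ cong (λ z → a ℚ.* (z ℚ.* d)) (ℚP.*-comm b c) ⟩
      a ℚ.* (c ℚ.* b ℚ.* d)     ≡⟨ cong (a ℚ.*_) (ℚP.*-assoc c b d) ⟩
      a ℚ.* (c ℚ.* (b ℚ.* d))   ≡⟨ sym (ℚP.*-assoc a c (b ℚ.* d)) ⟩
      (a ℚ.* c) ℚ.* (b ℚ.* d)   ∎
      where open ≡-Reasoning

  ^ℚ-+ : ∀ p m n → p ^ℚ (m ℕ.+ n) ≡ (p ^ℚ m) ℚ.* (p ^ℚ n)
  ^ℚ-+ p zero    n = sym (ℚP.*-identityˡ _)
  ^ℚ-+ p (suc m) n = trans (cong (p ℚ.*_) (^ℚ-+ p m n)) (sym (ℚP.*-assoc p _ _))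

  ℕ→ℚ-^ : ∀ N m → ℕ→ℚ (N ℕ.^ m) ≡ ℕ→ℚ N ^ℚ m
  ℕ→ℚ-^ N zero    = refl
  ℕ→ℚ-^ N (suc m) = trans (ℕ→ℚ-* N (N ℕ.^ m)) (cong (ℕ→ℚ N ℚ.*_) (ℕ→ℚ-^ N m))

  ℚ-*-pos : ∀ {p q} → 0ℚ ℚ.< p → 0ℚ ℚ.< q → 0ℚ ℚ.< p ℚ.* q
  ℚ-*-pos {p} {q} 0<p 0<q = subst (ℚ._< p ℚ.* q) (ℚP.*-zeroʳ p) (ℚP.*-monoʳ-<-pos p ⦃ ℚ.positive 0<p ⦄ 0<q)

  ℚ-*≤1 : ∀ {p q} → 0ℚ ℚ.≤ p → p ℚ.≤ 1ℚ → q ℚ.≤ 1ℚ → p ℚ.* q ℚ.≤ 1ℚ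
  ℚ-*≤1 {p} 0≤p p≤1 q≤1 = ℚP.≤-trans (ℚ-*-monoˡ 0≤p q≤1) (subst (ℚ._≤ 1ℚ) (sym (ℚP.*-identityʳ p)) p≤1)

  0<^ℚ : ∀ {p} m → 0ℚ ℚ.< p → 0ℚ ℚ.< p ^ℚ m
  0<^ℚ zero    0<p = ℚ.*<* (ℤ.+<+ (ℕ.s≤s ℕ.z≤n))
  0<^ℚ (suc m) 0<p = ℚ-*-pos 0<p (0<^ℚ m 0<p)

  ^ℚ≤1 : ∀ {p} m → 0ℚ ℚ.≤ p → p ℚ.≤ 1ℚ → p ^ℚ m ℚ.≤ 1ℚ
  ^ℚ≤1 zero    0≤p p≤1 = ℚP.≤-refl
  ^ℚ≤1 (suc m) 0≤p p≤1 = ℚ-*≤1 0≤p p≤1 (^ℚ≤1 m 0≤p p≤1)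

  -- For N ≈ 1/q and q ≤ 1/2 one has N q² ≤ 1, so powers of N are dominated by powers of 1/q.
  power-bound : ∀ {q N} m r → 0ℚ ℚ.< q → q ℚ.≤ ½ → ℕ→ℚ N ℚ.* q ℚ.≤ ℕ→ℚ 2 →
    ℕ→ℚ (N ℕ.^ m) ℚ.* (q ^ℚ (m ℕ.+ m ℕ.+ r)) ℚ.≤ 1ℚ
  power-bound {q} {N} m r 0<q q≤½ Nq≤2 = subst (ℚ._≤ 1ℚ) (sym rewritten)
    (ℚ-*≤1 (ℚP.<⇒≤ (0<^ℚ r 0<q)) (^ℚ≤1 r 0≤q (ℚP.≤-trans q≤½ ½≤1)) (^ℚ≤1 m 0≤Nqq Nqq≤1))
    where
    open ≡-Reasoning
    0≤q = ℚP.<⇒≤ 0<q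
    ½≤1 : ½ ℚ.≤ 1ℚ
    ½≤1 = /-monoℕ 1 1 1 0 (ℕ.s≤s ℕ.z≤n)
    Nqq = ℕ→ℚ N ℚ.* q ℚ.* q
    0≤Nqq : 0ℚ ℚ.≤ Nqq
    0≤Nqq = subst (ℚ._≤ Nqq) (ℚP.*-zeroˡ q)
      (ℚ-*-monoʳ 0≤q (subst (ℚ._≤ ℕ→ℚ N ℚ.* q) (ℚP.*-zeroˡ q) (ℚ-*-monoʳ 0≤q (0≤ℕ→ℚ N))))
    Nqq≤1 : Nqq ℚ.≤ 1ℚ
    Nqq≤1 = ℚP.≤-trans (ℚ-*-monoʳ 0≤q Nq≤2) (ℚ-*-monoˡ (0≤ℕ→ℚ 2) q≤½)
    rewritten : ℕ→ℚ (N ℕ.^ m) ℚ.* (q ^ℚ (m ℕ.+ m ℕ.+ r)) ≡ (q ^ℚ r) ℚ.* (Nqq ^ℚ m)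
    rewritten = begin
      ℕ→ℚ (N ℕ.^ m) ℚ.* (q ^ℚ (m ℕ.+ m ℕ.+ r))
        ≡⟨ cong₂ ℚ._*_ (ℕ→ℚ-^ N m) (trans (^ℚ-+ q (m ℕ.+ m) r) (cong (ℚ._* (q ^ℚ r)) (^ℚ-+ q m m))) ⟩
      (ℕ→ℚ N ^ℚ m) ℚ.* ((q ^ℚ m) ℚ.* (q ^ℚ m) ℚ.* (q ^ℚ r))
        ≡⟨ sym (ℚP.*-assoc (ℕ→ℚ N ^ℚ m) _ _) ⟩
      (ℕ→ℚ N ^ℚ m) ℚ.* ((q ^ℚ m) ℚ.* (q ^ℚ m)) ℚ.* (q ^ℚ r)
        ≡⟨ cong (ℚ._* (q ^ℚ r)) (sym (ℚP.*-assoc (ℕ→ℚ N ^ℚ m) _ _)) ⟩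
      (ℕ→ℚ N ^ℚ m) ℚ.* (q ^ℚ m) ℚ.* (q ^ℚ m) ℚ.* (q ^ℚ r)
        ≡⟨ cong (λ z → z ℚ.* (q ^ℚ m) ℚ.* (q ^ℚ r)) (^ℚ-distrib (ℕ→ℚ N) q m) ⟩
      ((ℕ→ℚ N ℚ.* q) ^ℚ m) ℚ.* (q ^ℚ m) ℚ.* (q ^ℚ r)
        ≡⟨ cong (ℚ._* (q ^ℚ r)) (^ℚ-distrib (ℕ→ℚ N ℚ.* q) q m) ⟩
      (Nqq ^ℚ m) ℚ.* (q ^ℚ r)
        ≡⟨ ℚP.*-comm (Nqq ^ℚ m) (q ^ℚ r) ⟩
      (q ^ℚ r) ℚ.* (Nqq ^ℚ m) ∎


  -- The initial potential is at most M²|V|² and every step lowers it by |V|²/K, where K = 54 N;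
  -- hence K M² steps suffice.
  module Parameters (N : ℕ) (8≤N : 8 ℕ.≤ N) where

    w c h M steps : ℕ
    w = N ℕ.* N
    -- With M = 54Nh, the inequality `const` reads 18·54²·w² ≤ h - 1 after division by h². Since w ≥
    -- 64 exceeds 18 and 54, the fifth power is enough.
    c = w ℕ.^ 5
    h = suc c
    M = 54 ℕ.* N ℕ.* h
    steps = 54 ℕ.* N ℕ.* (M ℕ.* M)

    private
      64≤w : 64 ℕ.≤ w
      64≤w = ℕP.*-mono-≤ 8≤N 8≤N
      1≤w : 1 ℕ.≤ w
      1≤w = ℕP.≤-trans (ℕP.≤ᵇ⇒≤ 1 64 _) 64≤w
      54≤w : 54 ℕ.≤ w
      54≤w = ℕP.≤-trans (ℕP.≤ᵇ⇒≤ 54 64 _) 64≤w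
      18≤w : 18 ℕ.≤ w
      18≤w = ℕP.≤-trans (ℕP.≤ᵇ⇒≤ 18 64 _) 64≤w
      N≤w : N ℕ.≤ w
      N≤w = ℕP.m≤m*n N N ⦃ ℕ.>-nonZero (ℕP.≤-trans (ℕ.s≤s ℕ.z≤n) 8≤N) ⦄
      1≤w^ : ∀ m → 1 ℕ.≤ w ℕ.^ m
      1≤w^ zero    = ℕP.≤-refl
      1≤w^ (suc m) = ℕP.*-mono-≤ 1≤w (1≤w^ m)

    M-ℤ : + M ≡ + 54 * + N * + h
    M-ℤ = trans (ℤP.pos-* (54 ℕ.* N) h) (cong (_* + h) (ℤP.pos-* 54 N))

    steps-ℤ : + steps ≡ + 54 * + N * ((+ 54 * + N * + h) * (+ 54 * + N * + h))
    steps-ℤ = trans (ℤP.pos-* (54 ℕ.* N) (M ℕ.* M))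
      (cong₂ _*_ (ℤP.pos-* 54 N) (trans (ℤP.pos-* M M) (cong₂ _*_ M-ℤ M-ℤ)))

    const : + 18 * ((+ 54 * + N * + h) * (+ 54 * + N * + h)) * (+ N * + N) ≤ + h * + h * (+ h - 1ℤ)
    const = subst₂ _≤_
      (trans (ℤP.pos-* (18 ℕ.* (M ℕ.* M)) w) (cong₂ _*_
        (trans (ℤP.pos-* 18 (M ℕ.* M)) (cong (+ 18 *_) (trans (ℤP.pos-* M M) (cong₂ _*_ M-ℤ M-ℤ))))
        (ℤP.pos-* N N)))
      (trans (ℤP.pos-* (h ℕ.* h) c) (cong (_* + c) (ℤP.pos-* h h)))
      (+≤+ (begin
        18 ℕ.* (M ℕ.* M) ℕ.* w
          ≡⟨ regroup 18 54 N h ⟩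
        (18 ℕ.* (54 ℕ.* 54)) ℕ.* (w ℕ.* w) ℕ.* (h ℕ.* h)
          ≤⟨ ℕP.*-monoˡ-≤ (h ℕ.* h) (ℕP.*-monoˡ-≤ (w ℕ.* w) (ℕP.*-mono-≤ 18≤w (ℕP.*-mono-≤ 54≤w 54≤w))) ⟩
        (w ℕ.* (w ℕ.* w)) ℕ.* (w ℕ.* w) ℕ.* (h ℕ.* h)
          ≡⟨ fifth w (h ℕ.* h) ⟩
        h ℕ.* h ℕ.* c ∎))
      where
      open ℕP.≤-Reasoning
      regroup : ∀ x y N h → x ℕ.* ((y ℕ.* N ℕ.* h) ℕ.* (y ℕ.* N ℕ.* h)) ℕ.* (N ℕ.* N)
        ≡ (x ℕ.* (y ℕ.* y)) ℕ.* ((N ℕ.* N) ℕ.* (N ℕ.* N)) ℕ.* (h ℕ.* h)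
      regroup = solve-∀ℕ
      fifth : ∀ w k → (w ℕ.* (w ℕ.* w)) ℕ.* (w ℕ.* w) ℕ.* k ≡ k ℕ.* (w ℕ.* (w ℕ.* (w ℕ.* (w ℕ.* (w ℕ.* 1)))))
      fifth = solve-∀ℕ

    2N²≤h-1 : + 2 * (+ N * + N) ≤ + h - 1ℤ
    2N²≤h-1 = subst (_≤ + h - 1ℤ) (trans (ℤP.pos-* 2 w) (cong (+ 2 *_) (ℤP.pos-* N N))) (+≤+ (begin
      2 ℕ.* w          ≤⟨ ℕP.*-monoˡ-≤ w (ℕP.≤-trans (ℕP.≤ᵇ⇒≤ 2 64 _) 64≤w) ⟩
      w ℕ.* w          ≤⟨ ℕP.*-monoʳ-≤ w (ℕP.m≤m*n w (w ℕ.^ 3) ⦃ ℕ.>-nonZero (1≤w^ 3) ⦄) ⟩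
      w ℕ.^ 5          ∎))
      where open ℕP.≤-Reasoning

    -- From 54N ≤ w² and h ≤ w⁶ follow M ≤ w⁸ and `steps` ≤ w¹⁸, so the total is at most 6w¹⁸ ≤ w¹⁹
    -- = N³⁸. The summand 3 is the level reserved for the initial partition, and `suc` compensates
    -- for the shift between `T` and `Tsh`.
    height-bound : suc (3 ℕ.+ (steps ℕ.+ steps)) ℕ.≤ N ℕ.^ 38
    height-bound = begin
      4 ℕ.+ (steps ℕ.+ steps)                ≤⟨ ℕP.+-mono-≤ (ℕP.*-monoʳ-≤ 4 (1≤w^ 18)) (ℕP.+-mono-≤ steps≤ steps≤) ⟩
      4 ℕ.* w ℕ.^ 18 ℕ.+ (w ℕ.^ 18 ℕ.+ w ℕ.^ 18)   ≡⟨ six (w ℕ.^ 18) ⟩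
      6 ℕ.* w ℕ.^ 18                         ≤⟨ ℕP.*-monoˡ-≤ (w ℕ.^ 18) (ℕP.≤-trans (ℕP.≤ᵇ⇒≤ 6 64 _) 64≤w) ⟩
      w ℕ.* w ℕ.^ 18                         ≡⟨ cong (ℕ._^ 19) (cong (N ℕ.*_) (sym (ℕP.*-identityʳ N))) ⟩
      (N ℕ.^ 2) ℕ.^ 19                       ≡⟨ ℕP.^-*-assoc N 2 19 ⟩
      N ℕ.^ 38                               ∎
      where
      open ℕP.≤-Reasoning
      six : ∀ x → 4 ℕ.* x ℕ.+ (x ℕ.+ x) ≡ 6 ℕ.* x
      six = solve-∀ℕ
      h≤ : h ℕ.≤ w ℕ.^ 6
      h≤ = begin
        1 ℕ.+ c          ≤⟨ ℕP.+-monoˡ-≤ c (1≤w^ 5) ⟩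
        c ℕ.+ c          ≡⟨ cong (c ℕ.+_) (sym (ℕP.+-identityʳ c)) ⟩
        2 ℕ.* c          ≤⟨ ℕP.*-monoˡ-≤ c (ℕP.≤-trans (ℕP.≤ᵇ⇒≤ 2 64 _) 64≤w) ⟩
        w ℕ.^ 6          ∎
      54N≤ : 54 ℕ.* N ℕ.≤ w ℕ.^ 2
      54N≤ = subst (54 ℕ.* N ℕ.≤_) (cong (w ℕ.*_) (sym (ℕP.*-identityʳ w))) (ℕP.*-mono-≤ 54≤w N≤w)
      M≤ : M ℕ.≤ w ℕ.^ 8
      M≤ = subst (M ℕ.≤_) (sym (ℕP.^-distribˡ-+-* w 2 6)) (ℕP.*-mono-≤ 54N≤ h≤)
      steps≤ : steps ℕ.≤ w ℕ.^ 18
      steps≤ = subst (steps ℕ.≤_)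
        (trans (cong (w ℕ.^ 2 ℕ.*_) (sym (ℕP.^-distribˡ-+-* w 8 8))) (sym (ℕP.^-distribˡ-+-* w 2 16)))
        (ℕP.*-mono-≤ 54N≤ (ℕP.*-mono-≤ M≤ M≤))


  -- The comparison goes through 3^200 ≤ 4^200 = 2^400. The levels are variables, so that the tower
  -- stays unevaluated.
  3^200≤Tsh-suc : ∀ m {i} j → suc i ≡ j → 400 ℕ.≤ Tsh m i → 3 ℕ.^ 200 ℕ.≤ Tsh m j
  3^200≤Tsh-suc m {i} _ refl 400≤ = begin
    3 ℕ.^ 200              ≤⟨ ℕP.^-monoˡ-≤ 200 (ℕP.≤ᵇ⇒≤ 3 4 _) ⟩
    (2 ℕ.^ 2) ℕ.^ 200      ≡⟨ ℕP.^-*-assoc 2 2 200 ⟩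
    2 ℕ.^ 400              ≤⟨ ℕP.^-monoʳ-≤ 2 400≤ ⟩
    2 ℕ.^ Tsh m i          ≤⟨ ℕP.m≤n*m (2 ℕ.^ Tsh m i) (Tsh m i) ⦃ ℕ.>-nonZero (ℕP.≤-trans (ℕ.s≤s ℕ.z≤n) 400≤) ⦄ ⟩
    Tsh m (suc i)          ∎
    where open ℕP.≤-Reasoning

  -- Level 2 is 24·2^24, which exceeds 400. This gives the level at which the iteration starts with
  -- the at most 3^200 parts of 𝒱₀.
  3^200≤Tsh : 3 ℕ.^ 200 ℕ.≤ Tsh 3 3
  3^200≤Tsh = 3^200≤Tsh-suc 3 3 refl (ℕP.≤ᵇ⇒≤ 400 (Tsh 3 2) _)

  -- Return to δ and ρ

  module Transfer {δ ρ : ℚ} {N : ℕ} (0≤δ : 0ℚ ℚ.≤ δ) (0≤ρ : 0ℚ ℚ.≤ ρ) (ρ≤1 : ρ ℚ.≤ 1ℚ)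
                  (1≤Nδρ : 1ℚ ℚ.≤ ℕ→ℚ N ℚ.* (δ ℚ.* ρ)) where

    swap-factors : ∀ r a → (ℕ→ℚ N ℚ.* r) ℚ.* ℕ→ℚ a ≡ ℕ→ℚ N ℚ.* (r ℚ.* ℕ→ℚ a)
    swap-factors r a = ℚP.*-assoc (ℕ→ℚ N) r (ℕ→ℚ a)

    ≤Nδρ : ∀ a → ℕ→ℚ a ℚ.≤ ℕ→ℚ N ℚ.* (δ ℚ.* ρ ℚ.* ℕ→ℚ a)
    ≤Nδρ a = subst₂ ℚ._≤_ (ℚP.*-identityˡ (ℕ→ℚ a)) (swap-factors (δ ℚ.* ρ) a) (ℚ-*-monoʳ (0≤ℕ→ℚ a) 1≤Nδρ)

    -- Because ρ ≤ 1, one has 1/N ≤ δρ ≤ δ.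
    scale : ∀ a b → δ ℚ.* ℕ→ℚ a ℚ.≤ ℕ→ℚ b → a ℕ.≤ N ℕ.* b
    scale a b le = ℕ→ℚ-cancel (begin
      ℕ→ℚ a                             ≤⟨ ≤Nδρ a ⟩
      ℕ→ℚ N ℚ.* (δ ℚ.* ρ ℚ.* ℕ→ℚ a)     ≤⟨ ℚ-*-monoˡ (0≤ℕ→ℚ N) (ℚ-*-monoʳ (0≤ℕ→ℚ a) δρ≤δ) ⟩
      ℕ→ℚ N ℚ.* (δ ℚ.* ℕ→ℚ a)           ≤⟨ ℚ-*-monoˡ (0≤ℕ→ℚ N) le ⟩
      ℕ→ℚ N ℚ.* ℕ→ℚ b                   ≡⟨ sym (ℕ→ℚ-* N b) ⟩
      ℕ→ℚ (N ℕ.* b)                     ∎)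
      where
      open ℚP.≤-Reasoning
      δρ≤δ : δ ℚ.* ρ ℚ.≤ δ
      δρ≤δ = subst (δ ℚ.* ρ ℚ.≤_) (ℚP.*-identityʳ δ) (ℚ-*-monoˡ 0≤δ ρ≤1)

    -- Here ρ enters: the changes number at most m/N ≤ δρm, and ρm is the number of edges. With m =
    -- n³ this is the reason for comparing N with 1/(δρ) and not with 1/δ.
    close : ∀ {a k m} → N ℕ.* a ℕ.≤ m → ℕ→ℚ k ≡ ρ ℚ.* ℕ→ℚ m → ℕ→ℚ a ℚ.≤ δ ℚ.* ℕ→ℚ k
    close {a} {k} {m} Na≤m k≡ρm = begin
      ℕ→ℚ a                             ≤⟨ ≤Nδρ a ⟩
      ℕ→ℚ N ℚ.* (δ ℚ.* ρ ℚ.* ℕ→ℚ a)     ≡⟨ rotate ⟩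
      δ ℚ.* ρ ℚ.* ℕ→ℚ (N ℕ.* a)         ≤⟨ ℚ-*-monoˡ 0≤δρ (ℕ→ℚ-mono Na≤m) ⟩
      δ ℚ.* ρ ℚ.* ℕ→ℚ m                 ≡⟨ trans (ℚP.*-assoc δ ρ (ℕ→ℚ m)) (cong (δ ℚ.*_) (sym k≡ρm)) ⟩
      δ ℚ.* ℕ→ℚ k                       ∎
      where
      open ℚP.≤-Reasoning
      0≤δρ : 0ℚ ℚ.≤ δ ℚ.* ρ
      0≤δρ = subst (ℚ._≤ δ ℚ.* ρ) (ℚP.*-zeroʳ δ) (ℚ-*-monoˡ 0≤δ 0≤ρ)
      rotate : ℕ→ℚ N ℚ.* (δ ℚ.* ρ ℚ.* ℕ→ℚ a) ≡ δ ℚ.* ρ ℚ.* ℕ→ℚ (N ℕ.* a)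
      rotate = trans (sym (swap-factors (δ ℚ.* ρ) a)) (trans (cong (ℚ._* ℕ→ℚ a) (ℚP.*-comm (ℕ→ℚ N) (δ ℚ.* ρ)))
        (trans (ℚP.*-assoc (δ ℚ.* ρ) (ℕ→ℚ N) (ℕ→ℚ a)) (cong (δ ℚ.* ρ ℚ.*_) (sym (ℕ→ℚ-* N a)))))

    isRegForH : ∀ {n size} {G : TriGraph n} {V₀} (D : RegularDecomposition (+ N) G V₀ size) →
      ℕ→ℚ (numK3 G) ≡ ρ ℚ.* ℕ→ℚ (n ℕ.* n ℕ.* n) → IsRegForH δ G (RegularDecomposition.𝒫 D)
    isRegForH {n} {G = G} D density = refines-parts
      , (λ X Y l → HalfRegular⇒IsRegBigraph {δ} scale (good X Y l))
      , (λ i → E′ i , E′-sym i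
          , close {k = count (λ q → GH G i (proj₁ q) (proj₂ q)) (pairs (allGVtx n))} (few i)
              (trans (cong ℕ→ℚ (GH-count G i)) density)
          , λ a b _ → HalfRegular⇒IsRegBigraph {δ} scale (E′-regular i a b))
      where
      open RegularDecomposition D
      few : ∀ i → N ℕ.* count (λ q → GH G i (proj₁ q) (proj₂ q) xor E′ i (proj₁ q) (proj₂ q)) (pairs (allGVtx n))
        ℕ.≤ n ℕ.* n ℕ.* n
      few i = ℤP.drop‿+≤+ (subst₂ _≤_ (sym (ℤP.pos-* N _))
        (trans (cong (_* + n) (sym (ℤP.pos-* n n))) (sym (ℤP.pos-* (n ℕ.* n) n))) (E′-close i))

  8≤1/q : ∀ {q N} → q ℚ.≤ (+ 1) / 8 → 1ℚ ℚ.≤ ℕ→ℚ N ℚ.* q → 8 ℕ.≤ N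
  8≤1/q {q} {N} q≤⅛ 1≤Nq = subst₂ ℕ._≤_ (ℕP.*-identityˡ 8) (trans (ℕP.*-identityʳ _) (ℕP.*-identityʳ N))
    (/-cancelℕ 1 0 (N ℕ.* 1) 7 (subst (1ℚ ℚ.≤_) (ℕ→ℚ-*/ N 1 7) (ℚP.≤-trans 1≤Nq (ℚ-*-monoˡ (0≤ℕ→ℚ N) q≤⅛))))

  -- By `power-bound`, N^m ≤ (δρ)^(-e), so the ceiling in `T3ℚ` is at least t + 1, and the shift in
  -- `T` brings this back to t. The surplus `r` pads the exponent 2m up to `e`.
  tower-height : ∀ {δ ρ N} m r → 0ℚ ℚ.< δ ℚ.* ρ → δ ℚ.* ρ ℚ.≤ ½ → ℕ→ℚ N ℚ.* (δ ℚ.* ρ) ℚ.≤ ℕ→ℚ 2 →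
    ∀ {t e} → suc t ℕ.≤ N ℕ.^ m → m ℕ.+ m ℕ.+ r ≡ e →
    Tsh 3 t ℕ.≤ T3ℚ (recip ((δ ^ℚ e) ℚ.* (ρ ^ℚ e)))
  tower-height {δ} {ρ} {N} m r 0<q q≤½ Nq≤2 {t} t≤ refl =
    Tsh-mono 3 (ℕP.∸-monoˡ-≤ 1 (≤ceiling (recip Q) (suc t)
      (ℚP.≤-trans (ℕ→ℚ-mono t≤) (≤recip Q (N ℕ.^ m) 0<Q small))))
    where
    e = m ℕ.+ m ℕ.+ r
    Q = (δ ^ℚ e) ℚ.* (ρ ^ℚ e)
    0<Q : 0ℚ ℚ.< Q
    0<Q = subst (0ℚ ℚ.<_) (sym (^ℚ-distrib δ ρ e)) (0<^ℚ e 0<q)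
    small : ℕ→ℚ (N ℕ.^ m) ℚ.* Q ℚ.≤ 1ℚ
    small = subst (λ z → ℕ→ℚ (N ℕ.^ m) ℚ.* z ℚ.≤ 1ℚ) (sym (^ℚ-distrib δ ρ e)) (power-bound m r 0<q q≤½ Nq≤2)

  module Assembly {δ ρ : ℚ} (0<δ : 0ℚ ℚ.< δ) (δ<⅛ : δ ℚ.< (+ 1) / 8) (0<ρ : 0ℚ ℚ.< ρ) (ρ<1 : ρ ℚ.< 1ℚ) where

    private
      0<δρ : 0ℚ ℚ.< δ ℚ.* ρ
      0<δρ = ℚ-*-pos 0<δ 0<ρ
      δρ≤⅛ : δ ℚ.* ρ ℚ.≤ (+ 1) / 8
      δρ≤⅛ = ℚP.≤-trans (ℚ-*-monoˡ (ℚP.<⇒≤ 0<δ) (ℚP.<⇒≤ ρ<1))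
        (subst (ℚ._≤ (+ 1) / 8) (sym (ℚP.*-identityʳ δ)) (ℚP.<⇒≤ δ<⅛))
      δρ≤½ : δ ℚ.* ρ ℚ.≤ ½
      δρ≤½ = ℚP.≤-trans δρ≤⅛ (/-monoℕ 1 7 1 1 (ℕP.≤ᵇ⇒≤ 2 8 _))
      δρ≤1 : δ ℚ.* ρ ℚ.≤ 1ℚ
      δρ≤1 = ℚP.≤-trans δρ≤⅛ (/-monoℕ 1 7 1 0 (ℕP.≤ᵇ⇒≤ 1 8 _))
      choice = bracket (δ ℚ.* ρ) 0<δρ δρ≤1
      N : ℕ
      N = proj₁ choice
      1≤Nδρ = proj₁ (proj₂ choice)
      Nδρ≤2 = proj₂ (proj₂ choice)
      8≤N : 8 ℕ.≤ N
      8≤N = 8≤1/q {N = N} δρ≤⅛ 1≤Nδρ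
      module P = Parameters N 8≤N

    height : ℕ
    height = 3 ℕ.+ (P.steps ℕ.+ P.steps)

    height≤ : Tsh 3 height ℕ.≤ T3ℚ (recip ((δ ^ℚ 1000) ℚ.* (ρ ^ℚ 1000)))
    -- 1000 = 38 + 38 + 924: two factors 1/(δρ) pay for each of the 38 factors N in `height-bound`,
    -- and 924 are surplus.
    height≤ = tower-height {δ} {ρ} {N} 38 924 0<δρ δρ≤½ Nδρ≤2 {height} {1000} P.height-bound refl

    module _ {n : ℕ} (G : TriGraph n) (V₀ : VPartition n) (parts : RefinesParts V₀)
             (k₀≤ : VPartition.k V₀ ℕ.≤ 3 ℕ.^ 200) where

      decomposition : RegularDecomposition (+ N) G V₀ (Tsh 3 height)
      decomposition = Decompose.decompose (+≤+ (ℕP.≤-trans (ℕ.s≤s ℕ.z≤n) 8≤N)) (+≤+ (ℕ.s≤s ℕ.z≤n))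
        P.const P.2N²≤h-1 P.steps P.steps-ℤ G V₀ parts 3 (ℕP.≤-trans k₀≤ 3^200≤Tsh)

      regularForH : ℕ→ℚ (numK3 G) ≡ ρ ℚ.* ℕ→ℚ (n ℕ.* n ℕ.* n) →
        IsRegForH δ G (RegularDecomposition.𝒫 decomposition)
      regularForH = Transfer.isRegForH (ℚP.<⇒≤ 0<δ) (ℚP.<⇒≤ 0<ρ) (ℚP.<⇒≤ ρ<1) 1≤Nδρ decomposition

      small : VPartition.k (Decomposition.P1 (RegularDecomposition.𝒫 decomposition)) ℕ.≤
        3 ℕ.^ 200 ℕ.* T3ℚ (recip ((δ ^ℚ 1000) ℚ.* (ρ ^ℚ 1000)))
      small = ℕP.≤-trans (RegularDecomposition.small decomposition)
        (ℕP.≤-trans height≤ (ℕP.m≤n*m (T3ℚ (recip ((δ ^ℚ 1000) ℚ.* (ρ ^ℚ 1000)))) (3 ℕ.^ 200) ⦃ ℕP.m^n≢0 3 200 ⦄))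

open import Defs
open import Data.Nat using (ℕ; _≥_; _≤_; _^_; _*_)
open import Data.Integer using (+_)
open import Data.Rational as ℚ using (ℚ; 0ℚ; 1ℚ; _/_)
open import Data.Product using (Σ; ∃; _×_; _,_)
open import Relation.Binary.PropositionalEquality using (_≡_)

theorem6p7 : (δ ρ : ℚ) → 0ℚ ℚ.< δ → δ ℚ.< (+ 1) / 8 → 0ℚ ℚ.< ρ → ρ ℚ.< 1ℚ →
    ∃ λ (n₀ : ℕ) → (n : ℕ) → n ≥ 1 → n ≥ n₀ →
    (G : TriGraph n) →
    ℕ→ℚ (numK3 G) ≡ ρ ℚ.* ℕ→ℚ (n * n * n) →
    (V₀ : VPartition n) → RefinesParts V₀ → VPartition.k V₀ ≤ 3 ^ 200 →
    Σ (Decomposition n) λ 𝒫 →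
    Refines (Decomposition.P1 𝒫) V₀ ×
    IsRegForH δ G 𝒫 ×
    VPartition.k (Decomposition.P1 𝒫)
    ≤ 3 ^ 200 * T3ℚ (recip ((δ ^ℚ 1000) ℚ.* (ρ ^ℚ 1000)))
theorem6p7 δ ρ 0<δ δ<⅛ 0<ρ ρ<1 = 0 , λ n _ _ G density V₀ parts k₀≤ →
  RegularDecomposition.𝒫 (decomposition G V₀ parts k₀≤) ,
  RegularDecomposition.refines (decomposition G V₀ parts k₀≤) ,
  regularForH G V₀ parts k₀≤ density ,
  small G V₀ parts k₀≤
  where
  open Regularity using (module RegularDecomposition)
  open Regularity.Assembly 0<δ δ<⅛ 0<ρ ρ<1
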